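{- The Balance SWOR algorithm is at least $0.513$-competitive for Online Bipartite Matching; that is, for every bipartite graph $G=(I,J,E)$ and every arrival order of the online vertices, the expected size of the matching produced by Balance SWOR is at least $0.513$ times the size of a maximum matching of $G$.
   Context: Online Bipartite Matching: $G=(I,J,E)$ is a bipartite graph with online vertices $I=\{1,\dots,n\}$ (indexed by arrival order) and offline vertices $J$; $J_i$ denotes the set of neighbors of $i\in I$. The algorithm knows $J$ in advance; online vertices arrive one at a time, and when $i$ arrives its incident edges are revealed and the algorithm must immediately and irrevocably match $i$ to an unmatched neighbor or leave it unmatched. An algorithm is $\Gamma$-competitive if for every graph and arrival order its expected matching size (over its internal randomness) is at least $\Gamma$ times the maximum matching size. Balance SWOR: maintain $y_j^i$ for $j\in J$, with $y_j^0=0$. When online vertex $i$ arrives (with $J_i\neq\emptyset$), find the threshold $\bar y>0$ with $\sum_{j\in J_i}(\bar y-y_j^{i-1})^+=1$, where $a^+=\max\{a,0\}$; set $x_{ij}=(\bar y-y_j^{i-1})^+$ for $j\in J_i$ and $x_{ij}=0$ otherwise, and $y_j^i=y_j^{i-1}+x_{ij}$ (this is the "unbounded Balance" fractional allocation). Then match $i$ to an unmatched neighbor $j$ with probability proportional to $x_{ij}$, i.e. with probability $x_{ij}/\sum_{k\in J_i\text{ unmatched}}x_{ik}$ (in the degenerate case where every unmatched neighbor has $x_{ij}=0$, $i$ may be matched to any unmatched neighbor or left unmatched). -}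

module Defs where

open import Data.Bool using (Bool; true; false; if_then_else_; _∧_; not)
open import Data.Nat using (ℕ; zero; suc)
import Data.Nat as ℕ
open import Data.Integer using (+_)
open import Data.Fin using (Fin; toℕ)
open import Data.List using (List; []; _∷_; foldr; allFin; length)
open import Data.Vec using (Vec; []; _∷_; lookup)
open import Data.Maybe using (Maybe; just; nothing; maybe′)
open import Data.Product using (_×_; ∃)
open import Data.Unit using (⊤)
open import Relation.Nullary using (does)
open import Relation.Binary.PropositionalEquality using (_≡_)
open import Data.Rational using (ℚ; 0ℚ; 1ℚ; _+_; _-_; _*_; _÷_; _⊔_; _<_; _/_)
open import Data.Rational.Properties using (_≟_)
open import Data.Fin.Properties using () renaming (_≟_ to _≟ᶠ_)

Σ : ∀ {m} → (Fin m → ℚ) → ℚ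
Σ {m} f = foldr (λ j acc → f j + acc) 0ℚ (allFin m)

pos : ℚ → ℚ
pos a = a ⊔ 0ℚ

ℕtoℚ : ℕ → ℚ
ℕtoℚ k = (+ k) / 1

-- Division by q, total: returns 0 if q = 0 (only used when q ≠ 0).
divq : ℚ → ℚ → ℚ
divq p q with q ≟ 0ℚ
... | Relation.Nullary.yes _ = 0ℚ
... | Relation.Nullary.no q≢0 = _÷_ p q {{Data.Rational.≢-nonZero q≢0}}

-- An online vertex is given by its neighbour set J_i ⊆ J = Fin m.
Nbrs : ℕ → Set
Nbrs m = Fin m → Bool

-- A bipartite graph G = (I, J, E) with I = {0,…,n-1} in arrival order and J = Fin m:
-- the i-th entry of the vector is J_i.
Graph : ℕ → ℕ → Set
Graph n m = Vec (Nbrs m) n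

-- Unbounded-Balance allocation x_{ij} = (t - y_j^{i-1})⁺ for j ∈ J_i, 0 otherwise,
-- given current loads y and threshold t.
alloc : ∀ {m} → Nbrs m → (Fin m → ℚ) → ℚ → Fin m → ℚ
alloc N y t j = if N j then pos (t - y j) else 0ℚ

update : ∀ {m} → Nbrs m → (Fin m → ℚ) → ℚ → Fin m → ℚ
update N y t j = y j + alloc N y t j

ValidThresholds : ∀ {n m} → Graph n m → Vec ℚ n → (Fin m → ℚ) → Set
ValidThresholds [] [] y = ⊤
ValidThresholds (N ∷ G) (t ∷ ts) y =
  ((∃ λ j → N j ≡ true) → (0ℚ < t) × (Σ (alloc N y t) ≡ 1ℚ))
  × ValidThresholds G ts (update N y t)

-- History of the random process: the outcomes for the online vertices so far,
-- most recent first (just j = matched to j, nothing = left unmatched).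
History : ℕ → Set
History m = List (Maybe (Fin m))

matched : ∀ {m} → History m → Fin m → Bool
matched [] j = false
matched (nothing ∷ h) j = matched h j
matched (just k ∷ h) j = if does (k ≟ᶠ j) then true else matched h j

-- Rule used in the degenerate case (all unmatched neighbours have x_{ij} = 0);
-- it may depend on the whole history (the current vertex index is length h).
Policy : ℕ → Set
Policy m = History m → Maybe (Fin m)

ValidPolicy : ∀ {n m} → Graph n m → Policy m → Set
ValidPolicy {n} {m} G pol =
  ∀ (i : Fin n) (h : History m) → length h ≡ toℕ i →
  ∀ j → pol h ≡ just j → (lookup G i j ≡ true) × (matched h j ≡ false)

expBalanceSWOR : ∀ {k m} → Vec (Nbrs m) k → Vec ℚ k → (Fin m → ℚ) → Policy m → History m → ℚ
expBalanceSWOR [] [] y pol h = 0ℚ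
expBalanceSWOR (N ∷ G) (t ∷ ts) y pol h =
  if does (S ≟ 0ℚ)
  then maybe′ (λ j → 1ℚ + next (just j)) (next nothing) (pol h)
  else Σ (λ j → if u j then divq (x j) S * (1ℚ + next (just j)) else 0ℚ)
  where
  x = alloc N y t
  u = λ j → N j ∧ not (matched h j)
  S = Σ (λ j → if u j then x j else 0ℚ)
  next = λ c → expBalanceSWOR G ts (update N y t) pol (c ∷ h)

IsMatching : ∀ {n m} → Graph n m → (Fin n → Maybe (Fin m)) → Set
IsMatching {n} {m} G M =
  (∀ (i : Fin n) (j : Fin m) → M i ≡ just j → lookup G i j ≡ true)
  × (∀ (i i' : Fin n) (j : Fin m) → M i ≡ just j → M i' ≡ just j → i ≡ i')

matchingSize : ∀ {n m} → (Fin n → Maybe (Fin m)) → ℕ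
matchingSize {n} M = foldr (λ i acc → maybe′ (λ _ → suc acc) acc (M i)) 0 (allFin n)

{-# OPTIONS --safe #-}
-- Survival bound.  Let φ = 1/τ with τ′(y) = ρ(y) τ(y), where ρ(y) = 1 for y ≤ 1 and
-- ρ(y) = τ(y - 1) afterwards (capped).  For every set U of offline vertices with loads y_j,
-- the probability that all of U is unmatched is at most ∏_{j ∈ U} φ(y_j).  When an online
-- vertex raises its neighbours to the level v, U survives with probability R / (X + R), where
-- X and R are the masses x_j inside U and on the unmatched vertices outside U.  This is
-- concave in R, so only E[R] matters, and by induction that is bounded by
-- Q = ∑_{k ∉ U} x_k φ(v - x_k) ≤ (1 - X) φ(v - 1 + X): all neighbours end at the same level
-- v, and no x_k exceeds 1 - X.  The delay equation for τ is chosen so that Q / (X + Q) is at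
-- most the decrease of ∏ φ.
--
-- Primal-dual.  Let β ≥ 0 be nonincreasing, ψ′ = -β, φ ≤ β + ψ and β(0) + ψ(0) = 1.  Charge
-- β(v) to an online vertex with level v and β(0) - β(y_j) to an offline vertex with final
-- load y_j.  Both ends of an edge together carry at least β(0), and the total charge is at
-- most ∑_j (1 - φ(y_j)).
--
-- Explicit piecewise polynomials τ and ψ with β(0) > 0.513 are checked by evaluation.
module Submission where

open import Defs
open import Data.Bool using (Bool; true; false; T; if_then_else_; not; _∧_; _∨_)
open import Data.Bool.Properties using (T-∧; T-∨) renaming (_≟_ to _≟ᵇ_)
open import Data.Nat using (ℕ; zero; suc; z≤n; s≤s)
import Data.Nat as ℕ
import Data.Nat.Properties as ℕ
open import Data.Integer using (ℤ; +_; 0ℤ; 1ℤ; -1ℤ)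
import Data.Integer as ℤ
import Data.Integer.Properties as ℤ
open import Data.Fin using (Fin; zero; suc)
open import Data.Fin.Properties using (any?) renaming (_≟_ to _≟ᶠ_)
open import Data.Vec using (Vec; []; _∷_)
open import Data.Maybe using (Maybe; just; nothing; maybe′)
open import Data.List using (List; []; _∷_; length; foldr; allFin; tabulate)
open import Data.Product using (_×_; _,_; proj₁; proj₂; ∃)
open import Data.Sum using (_⊎_; inj₁; inj₂)
open import Data.Unit using (⊤; tt)
open import Data.Empty using (⊥-elim)
open import Data.Rational hiding (∣_∣; pos)
open import Data.Rational.Properties
import Data.Rational.Unnormalised as ℚᵘ
import Data.Rational.Unnormalised.Properties as ℚᵘ
open import Function using (Equivalence; _∘_)
open import Relation.Nullary using (¬_; Dec; yes; no; does)
open import Relation.Nullary.Decidable using (dec⇒maybe; from-yes; _×-dec_)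
open import Relation.Binary.PropositionalEquality
open import Tactic.RingSolver using (solve-∀)
open import Tactic.RingSolver.Core.AlmostCommutativeRing using (AlmostCommutativeRing; fromCommutativeRing)

-- Equality in φ ≤ β + ψ means ψ - ψ′ = φ, so the best ratio that φ supports is β(0) = 1 - ∫ e^(-s)
-- φ(s) ds over s ≥ 0. With hazard rate 1 throughout, φ would be e^(-y) and this would be exactly
-- 1/2; all the gain comes from the faster decay of φ beyond load 1. To first order in X, the bound
-- (1 - X) φ(v - 1 + X) on Q gives Q / (X + Q) = 1 - X τ(v - 1), so τ(v - 1) is the largest rate it
-- permits. To second order it requires τ(u) ≤ 2 (1 + ρ(u)) at u = v - 1. This fails at u = 1.6
-- (6.18 against 5.64), which is why the delayed load is capped, at 1.4. Everything stays rational: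
-- (1 - ρ X / 32)^32 takes the place of exp(-ρ X), and differential inequalities become inequalities
-- between two points u ≤ w, which can be concatenated across cells. Inside a cell they follow from
-- convexity, since the cell polynomials have nonnegative coefficients.

ℚ-ring : AlmostCommutativeRing _ _
ℚ-ring = fromCommutativeRing +-*-commutativeRing (λ x → dec⇒maybe (0ℚ ≟ x))

-- Ordered-field arithmetic

≤⇒0≤- : ∀ {a b} → a ≤ b → 0ℚ ≤ b - a
≤⇒0≤- {a} {b} a≤b = subst (_≤ b - a) (+-inverseʳ a) (+-monoˡ-≤ (- a) a≤b)

0≤-⇒≤ : ∀ {a b} → 0ℚ ≤ b - a → a ≤ b
0≤-⇒≤ {a} {b} 0≤b-a = subst₂ _≤_ (+-identityˡ a) (b-a+a b a) (+-monoˡ-≤ a 0≤b-a)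
  where
  b-a+a : ∀ b a → b - a + a ≡ b
  b-a+a = solve-∀ ℚ-ring

by-diff : ∀ {a b d} → b - a ≡ d → 0ℚ ≤ d → a ≤ b
by-diff eq 0≤d = 0≤-⇒≤ (subst (0ℚ ≤_) (sym eq) 0≤d)

0≤+ : ∀ {a b} → 0ℚ ≤ a → 0ℚ ≤ b → 0ℚ ≤ a + b
0≤+ = +-mono-≤

0≤* : ∀ {a b} → 0ℚ ≤ a → 0ℚ ≤ b → 0ℚ ≤ a * b
0≤* {a} {b} 0≤a 0≤b =
  subst (_≤ a * b) (*-zeroʳ a) (*-monoˡ-≤-nonNeg a {{nonNegative 0≤a}} 0≤b)

*-monoʳ-≤ : ∀ {a b c} → 0ℚ ≤ a → b ≤ c → a * b ≤ a * c
*-monoʳ-≤ {a} 0≤a b≤c = *-monoˡ-≤-nonNeg a {{nonNegative 0≤a}} b≤c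

*-monoˡ-≤ : ∀ {a b c} → 0ℚ ≤ a → b ≤ c → b * a ≤ c * a
*-monoˡ-≤ {a} 0≤a b≤c = *-monoʳ-≤-nonNeg a {{nonNegative 0≤a}} b≤c

*-mono-≤ : ∀ {a b c d} → 0ℚ ≤ a → 0ℚ ≤ d → a ≤ b → c ≤ d → a * c ≤ b * d
*-mono-≤ 0≤a 0≤d a≤b c≤d = ≤-trans (*-monoʳ-≤ 0≤a c≤d) (*-monoˡ-≤ 0≤d a≤b)

*-cancelˡ-≤ : ∀ {a b c} → 0ℚ < a → a * b ≤ a * c → b ≤ c
*-cancelˡ-≤ {a} 0<a = *-cancelˡ-≤-pos a {{positive 0<a}}

0≤² : ∀ a → 0ℚ ≤ a * a
0≤² a with ≤-total 0ℚ a
... | inj₁ 0≤a = 0≤* 0≤a 0≤a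
... | inj₂ a≤0 = subst (0ℚ ≤_) (neg² a) (0≤* 0≤-a 0≤-a)
  where
  0≤-a = neg-antimono-≤ a≤0
  neg² : ∀ a → - a * - a ≡ a * a
  neg² = solve-∀ ℚ-ring

0≤1ℚ : 0ℚ ≤ 1ℚ
0≤1ℚ = from-yes (0ℚ ≤? 1ℚ)

-- Integer polynomials and a nonnegativity test on the unit interval

opaque
  fromℤ : ℤ → ℚ
  fromℤ a = a / 1

  toℚᵘ-fromℤ : ∀ a → toℚᵘ (fromℤ a) ℚᵘ.≃ ℚᵘ.mkℚᵘ a 0
  toℚᵘ-fromℤ a = toℚᵘ-fromℚᵘ (ℚᵘ.mkℚᵘ a 0)

  fromℤ-0 : fromℤ 0ℤ ≡ 0ℚ
  fromℤ-0 = refl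

  fromℤ-1 : fromℤ 1ℤ ≡ 1ℚ
  fromℤ-1 = refl

  fromℤ-2 : fromℤ (+ 2) ≡ 1ℚ + 1ℚ
  fromℤ-2 = refl

fromℤ-+ : ∀ a b → fromℤ (a ℤ.+ b) ≡ fromℤ a + fromℤ b
fromℤ-+ a b = toℚᵘ-injective (begin
  toℚᵘ (fromℤ (a ℤ.+ b))                ≈⟨ toℚᵘ-fromℤ (a ℤ.+ b) ⟩
  ℚᵘ.mkℚᵘ (a ℤ.+ b) 0                   ≈⟨ ℚᵘ.*≡* (cong (ℤ._* 1ℤ) (sym (cong₂ ℤ._+_ (ℤ.*-identityʳ a) (ℤ.*-identityʳ b)))) ⟩
  ℚᵘ.mkℚᵘ a 0 ℚᵘ.+ ℚᵘ.mkℚᵘ b 0          ≈⟨ ℚᵘ.+-cong (ℚᵘ.≃-sym (toℚᵘ-fromℤ a)) (ℚᵘ.≃-sym (toℚᵘ-fromℤ b)) ⟩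
  toℚᵘ (fromℤ a) ℚᵘ.+ toℚᵘ (fromℤ b)    ≈⟨ ℚᵘ.≃-sym (toℚᵘ-homo-+ (fromℤ a) (fromℤ b)) ⟩
  toℚᵘ (fromℤ a + fromℤ b)              ∎)
  where open ℚᵘ.≃-Reasoning

fromℤ-* : ∀ a b → fromℤ (a ℤ.* b) ≡ fromℤ a * fromℤ b
fromℤ-* a b = toℚᵘ-injective (begin
  toℚᵘ (fromℤ (a ℤ.* b))                ≈⟨ toℚᵘ-fromℤ (a ℤ.* b) ⟩
  ℚᵘ.mkℚᵘ a 0 ℚᵘ.* ℚᵘ.mkℚᵘ b 0          ≈⟨ ℚᵘ.*-cong (ℚᵘ.≃-sym (toℚᵘ-fromℤ a)) (ℚᵘ.≃-sym (toℚᵘ-fromℤ b)) ⟩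
  toℚᵘ (fromℤ a) ℚᵘ.* toℚᵘ (fromℤ b)    ≈⟨ ℚᵘ.≃-sym (toℚᵘ-homo-* (fromℤ a) (fromℤ b)) ⟩
  toℚᵘ (fromℤ a * fromℤ b)              ∎)
  where open ℚᵘ.≃-Reasoning

fromℤ-nonNeg : ∀ {a} → 0ℤ ℤ.≤ a → 0ℚ ≤ fromℤ a
fromℤ-nonNeg {a} 0≤a = toℚᵘ-cancel-≤
  (ℚᵘ.≤-respʳ-≃ (ℚᵘ.≃-sym (toℚᵘ-fromℤ a)) (ℚᵘ.*≤* (subst (0ℤ ℤ.≤_) (sym (ℤ.*-identityʳ a)) 0≤a)))

Poly : Set
Poly = List ℤ

⟦_⟧ : Poly → ℚ → ℚ
⟦ [] ⟧ x = 0ℚ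
⟦ a ∷ p ⟧ x = fromℤ a + x * ⟦ p ⟧ x

infixl 6 _⊕_
infixl 7 _⊗_ _⊙_

_⊕_ : Poly → Poly → Poly
[] ⊕ q = q
(a ∷ p) ⊕ [] = a ∷ p
(a ∷ p) ⊕ (b ∷ q) = a ℤ.+ b ∷ p ⊕ q

_⊙_ : ℤ → Poly → Poly
c ⊙ [] = []
c ⊙ (a ∷ p) = c ℤ.* a ∷ c ⊙ p

_⊗_ : Poly → Poly → Poly
[] ⊗ q = []
(a ∷ p) ⊗ q = a ⊙ q ⊕ (0ℤ ∷ p ⊗ q)

_^ₚ_ : Poly → ℕ → Poly
p ^ₚ zero = 1ℤ ∷ []
p ^ₚ suc n = p ⊗ (p ^ₚ n)

deriv : Poly → Poly
deriv [] = []
deriv (a ∷ p) = p ⊕ (0ℤ ∷ deriv p)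

infixr 9 _∘ₚ_
_∘ₚ_ : Poly → Poly → Poly
[] ∘ₚ q = []
(a ∷ p) ∘ₚ q = (a ∷ []) ⊕ q ⊗ (p ∘ₚ q)

⟦⊕⟧ : ∀ p q x → ⟦ p ⊕ q ⟧ x ≡ ⟦ p ⟧ x + ⟦ q ⟧ x
⟦⊕⟧ [] q x = sym (+-identityˡ _)
⟦⊕⟧ (a ∷ p) [] x = sym (+-identityʳ _)
⟦⊕⟧ (a ∷ p) (b ∷ q) x = trans (cong₂ (λ c r → c + x * r) (fromℤ-+ a b) (⟦⊕⟧ p q x)) (regroup (fromℤ a) (fromℤ b) x (⟦ p ⟧ x) (⟦ q ⟧ x))
  where
  regroup : ∀ a b x p q → a + b + x * (p + q) ≡ a + x * p + (b + x * q)
  regroup = solve-∀ ℚ-ring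

⟦⊙⟧ : ∀ c p x → ⟦ c ⊙ p ⟧ x ≡ fromℤ c * ⟦ p ⟧ x
⟦⊙⟧ c [] x = sym (*-zeroʳ (fromℤ c))
⟦⊙⟧ c (a ∷ p) x = trans (cong₂ (λ a r → a + x * r) (fromℤ-* c a) (⟦⊙⟧ c p x)) (regroup (fromℤ c) (fromℤ a) x (⟦ p ⟧ x))
  where
  regroup : ∀ c a x p → c * a + x * (c * p) ≡ c * (a + x * p)
  regroup = solve-∀ ℚ-ring

⟦⊗⟧ : ∀ p q x → ⟦ p ⊗ q ⟧ x ≡ ⟦ p ⟧ x * ⟦ q ⟧ x
⟦⊗⟧ [] q x = sym (*-zeroˡ (⟦ q ⟧ x))
⟦⊗⟧ (a ∷ p) q x = begin
  ⟦ a ⊙ q ⊕ (0ℤ ∷ p ⊗ q) ⟧ x                    ≡⟨ ⟦⊕⟧ (a ⊙ q) _ x ⟩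
  ⟦ a ⊙ q ⟧ x + (fromℤ 0ℤ + x * ⟦ p ⊗ q ⟧ x)     ≡⟨ cong (λ c → ⟦ a ⊙ q ⟧ x + (c + x * ⟦ p ⊗ q ⟧ x)) fromℤ-0 ⟩
  ⟦ a ⊙ q ⟧ x + (0ℚ + x * ⟦ p ⊗ q ⟧ x)           ≡⟨ cong₂ (λ u v → u + (0ℚ + x * v)) (⟦⊙⟧ a q x) (⟦⊗⟧ p q x) ⟩
  fromℤ a * ⟦ q ⟧ x + (0ℚ + x * (⟦ p ⟧ x * ⟦ q ⟧ x)) ≡⟨ regroup (fromℤ a) (⟦ q ⟧ x) x (⟦ p ⟧ x) ⟩
  (fromℤ a + x * ⟦ p ⟧ x) * ⟦ q ⟧ x              ∎
  where
  open ≡-Reasoning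
  regroup : ∀ a q x p → a * q + (0ℚ + x * (p * q)) ≡ (a + x * p) * q
  regroup = solve-∀ ℚ-ring

⟦const⟧ : ∀ a x → ⟦ a ∷ [] ⟧ x ≡ fromℤ a
⟦const⟧ a x = trans (cong (λ z → fromℤ a + z) (*-zeroʳ x)) (+-identityʳ _)

⟦∘⟧ : ∀ p q x → ⟦ p ∘ₚ q ⟧ x ≡ ⟦ p ⟧ (⟦ q ⟧ x)
⟦∘⟧ [] q x = refl
⟦∘⟧ (a ∷ p) q x = trans (⟦⊕⟧ (a ∷ []) (q ⊗ (p ∘ₚ q)) x)
  (cong₂ _+_ (⟦const⟧ a x) (trans (⟦⊗⟧ q (p ∘ₚ q) x) (cong (⟦ q ⟧ x *_) (⟦∘⟧ p q x))))

⟦deriv⟧ : ∀ a p x → ⟦ deriv (a ∷ p) ⟧ x ≡ ⟦ p ⟧ x + x * ⟦ deriv p ⟧ x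
⟦deriv⟧ a p x = trans (⟦⊕⟧ p (0ℤ ∷ deriv p) x) (cong (λ z → ⟦ p ⟧ x + z) (trans (cong (_+ x * ⟦ deriv p ⟧ x) fromℤ-0) (+-identityˡ _)))

nonNegCoeffs : Poly → Bool
nonNegCoeffs [] = true
nonNegCoeffs (a ∷ p) = (0ℤ ℤ.≤ᵇ a) ∧ nonNegCoeffs p

∧-split : ∀ {a b} → T (a ∧ b) → T a × T b
∧-split = Equivalence.to T-∧

⟦⟧-nonNeg : ∀ p {x} → T (nonNegCoeffs p) → 0ℚ ≤ x → 0ℚ ≤ ⟦ p ⟧ x
⟦⟧-nonNeg [] _ _ = ≤-refl
⟦⟧-nonNeg (a ∷ p) pos 0≤x = let (0≤a , 0≤p) = ∧-split {0ℤ ℤ.≤ᵇ a} pos in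
  0≤+ (fromℤ-nonNeg {a} (ℤ.≤ᵇ⇒≤ 0≤a)) (0≤* 0≤x (⟦⟧-nonNeg p 0≤p 0≤x))

⟦⟧-mono : ∀ p {u w} → T (nonNegCoeffs p) → 0ℚ ≤ u → u ≤ w → ⟦ p ⟧ u ≤ ⟦ p ⟧ w
⟦⟧-mono [] _ _ _ = ≤-refl
⟦⟧-mono (a ∷ p) pos 0≤u u≤w = let (_ , 0≤p) = ∧-split {0ℤ ℤ.≤ᵇ a} pos in
  +-monoʳ-≤ (fromℤ a) (*-mono-≤ 0≤u (⟦⟧-nonNeg p 0≤p (≤-trans 0≤u u≤w)) u≤w (⟦⟧-mono p 0≤p 0≤u u≤w))

deriv-nonNeg : ∀ p {x} → T (nonNegCoeffs p) → 0ℚ ≤ x → 0ℚ ≤ ⟦ deriv p ⟧ x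
deriv-nonNeg [] _ _ = ≤-refl
deriv-nonNeg (a ∷ p) {x} pos 0≤x = let (_ , 0≤p) = ∧-split {0ℤ ℤ.≤ᵇ a} pos in
  subst (0ℚ ≤_) (sym (⟦deriv⟧ a p x)) (0≤+ (⟦⟧-nonNeg p 0≤p 0≤x) (0≤* 0≤x (deriv-nonNeg p 0≤p 0≤x)))

-- Nonnegative coefficients make the polynomial convex on the nonnegative axis. Induction along
-- Horner's scheme leaves a manifestly nonnegative remainder, with `deriv` as a purely formal
-- derivative.
secant≤tangent : ∀ p {u w} → T (nonNegCoeffs p) → 0ℚ ≤ u → u ≤ w →
                 ⟦ p ⟧ w - ⟦ p ⟧ u ≤ (w - u) * ⟦ deriv p ⟧ w
secant≤tangent [] {u} {w} _ _ _ = ≤-reflexive (sym (*-zeroʳ (w - u)))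
secant≤tangent (a ∷ p) {u} {w} pos 0≤u u≤w with ∧-split {0ℤ ℤ.≤ᵇ a} pos
... | _ , 0≤p = by-diff
  (trans (cong (λ d → (w - u) * d - (⟦ a ∷ p ⟧ w - ⟦ a ∷ p ⟧ u)) (⟦deriv⟧ a p w))
         (regroup (fromℤ a) w u (⟦ p ⟧ w) (⟦ deriv p ⟧ w) (⟦ p ⟧ u)))
  (0≤+ (0≤* 0≤u (≤⇒0≤- (secant≤tangent p 0≤p 0≤u u≤w)))
       (0≤* (0≤* 0≤w-u 0≤w-u) (deriv-nonNeg p 0≤p (≤-trans 0≤u u≤w))))
  where
  0≤w-u = ≤⇒0≤- u≤w
  regroup : ∀ a w u P P′ Q → (w - u) * (P + w * P′) - (a + w * P - (a + u * Q)) ≡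
            u * ((w - u) * P′ - (P - Q)) + (w - u) * (w - u) * P′
  regroup = solve-∀ ℚ-ring

tangent≤secant : ∀ p {u w} → T (nonNegCoeffs p) → 0ℚ ≤ u → u ≤ w →
                 (w - u) * ⟦ deriv p ⟧ u ≤ ⟦ p ⟧ w - ⟦ p ⟧ u
tangent≤secant [] {u} {w} _ _ _ = ≤-reflexive (*-zeroʳ (w - u))
tangent≤secant (a ∷ p) {u} {w} pos 0≤u u≤w with ∧-split {0ℤ ℤ.≤ᵇ a} pos
... | _ , 0≤p = by-diff
  (trans (cong (λ d → ⟦ a ∷ p ⟧ w - ⟦ a ∷ p ⟧ u - (w - u) * d) (⟦deriv⟧ a p u))
         (regroup (fromℤ a) w u (⟦ p ⟧ w) (⟦ p ⟧ u) (⟦ deriv p ⟧ u)))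
  (0≤+ (0≤* 0≤u (≤⇒0≤- (tangent≤secant p 0≤p 0≤u u≤w)))
       (0≤* 0≤w-u (≤⇒0≤- (⟦⟧-mono p 0≤p 0≤u u≤w))))
  where
  0≤w-u = ≤⇒0≤- u≤w
  regroup : ∀ a w u P Q Q′ → (a + w * P - (a + u * Q)) - (w - u) * (Q + u * Q′) ≡
            u * (P - Q - (w - u) * Q′) + (w - u) * (P - Q)
  regroup = solve-∀ ℚ-ring

-- The polynomial 2ⁿ p(x / 2), with n the number of coefficients; the factor 2ⁿ keeps the
-- coefficients integral. Composing it with 1 + x then gives the right half of the unit interval.
half : Poly → Poly
half [] = []
half (a ∷ p) = (+ 2) ℤ.^ suc (length p) ℤ.* a ∷ half p

⟦half⟧ : ∀ p x → ⟦ half p ⟧ (x + x) ≡ fromℤ ((+ 2) ℤ.^ length p) * ⟦ p ⟧ x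
⟦half⟧ [] x = sym (*-zeroʳ (fromℤ 1ℤ))
⟦half⟧ (a ∷ p) x = begin
  fromℤ (+ 2 ℤ.* 2ⁿ ℤ.* a) + (x + x) * ⟦ half p ⟧ (x + x)
    ≡⟨ cong₂ (λ b r → b + (x + x) * r) (trans (fromℤ-* (+ 2 ℤ.* 2ⁿ) a) (cong (_* fromℤ a) double)) (⟦half⟧ p x) ⟩
  (1ℚ + 1ℚ) * fromℤ 2ⁿ * fromℤ a + (x + x) * (fromℤ 2ⁿ * ⟦ p ⟧ x)
    ≡⟨ regroup (fromℤ 2ⁿ) (fromℤ a) x (⟦ p ⟧ x) ⟩
  (1ℚ + 1ℚ) * fromℤ 2ⁿ * (fromℤ a + x * ⟦ p ⟧ x)
    ≡⟨ cong (_* ⟦ a ∷ p ⟧ x) (sym double) ⟩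
  fromℤ (+ 2 ℤ.* 2ⁿ) * (fromℤ a + x * ⟦ p ⟧ x) ∎
  where
  open ≡-Reasoning
  2ⁿ = (+ 2) ℤ.^ length p
  double : fromℤ (+ 2 ℤ.* 2ⁿ) ≡ (1ℚ + 1ℚ) * fromℤ 2ⁿ
  double = trans (fromℤ-* (+ 2) 2ⁿ) (cong (_* fromℤ 2ⁿ) fromℤ-2)
  regroup : ∀ n a x p → (1ℚ + 1ℚ) * n * a + (x + x) * (n * p) ≡ (1ℚ + 1ℚ) * n * (a + x * p)
  regroup = solve-∀ ℚ-ring

partialSums≥0 : ℤ → Poly → Bool
partialSums≥0 s [] = true
partialSums≥0 s (a ∷ p) = (0ℤ ℤ.≤ᵇ (s ℤ.+ a)) ∧ partialSums≥0 (s ℤ.+ a) p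

-- Abel summation, as the powers of x decrease on [0 , 1]
partialSums-sound : ∀ s p {x} → 0ℤ ℤ.≤ s → T (partialSums≥0 s p) → 0ℚ ≤ x → x ≤ 1ℚ →
                    0ℚ ≤ fromℤ s + ⟦ p ⟧ x
partialSums-sound s [] 0≤s _ _ _ = 0≤+ (fromℤ-nonNeg 0≤s) ≤-refl
partialSums-sound s (a ∷ p) {x} 0≤s ok 0≤x x≤1 =
  let (ok₁ , ok₂) = ∧-split ok
      0≤s+a = ℤ.≤ᵇ⇒≤ ok₁
  in subst (0ℚ ≤_)
       (trans (cong (λ c → (1ℚ - x) * c + x * (c + ⟦ p ⟧ x)) (fromℤ-+ s a)) (regroup (fromℤ s) (fromℤ a) x (⟦ p ⟧ x)))
       (0≤+ (0≤* (≤⇒0≤- x≤1) (fromℤ-nonNeg 0≤s+a))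
            (0≤* 0≤x (partialSums-sound (s ℤ.+ a) p 0≤s+a ok₂ 0≤x x≤1)))
  where
  regroup : ∀ s a x p → (1ℚ - x) * (s + a) + x * (s + a + p) ≡ s + (a + x * p)
  regroup = solve-∀ ℚ-ring

-- A sufficient test only: a positive polynomial can have a negative partial sum of coefficients.
-- Each of the at most n levels of bisection rescales both halves to the unit interval and tries
-- again.
nonNegOn01 : ℕ → Poly → Bool
nonNegOn01 zero p = partialSums≥0 0ℤ p
nonNegOn01 (suc n) p = partialSums≥0 0ℤ p ∨
  nonNegOn01 n (half p) ∧ nonNegOn01 n (half p ∘ₚ (1ℤ ∷ 1ℤ ∷ []))

0+ : ∀ p x → fromℤ 0ℤ + ⟦ p ⟧ x ≡ ⟦ p ⟧ x
0+ p x = trans (cong (_+ ⟦ p ⟧ x) fromℤ-0) (+-identityˡ (⟦ p ⟧ x))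

nonNegOn01-sound : ∀ n p {x} → T (nonNegOn01 n p) → 0ℚ ≤ x → x ≤ 1ℚ → 0ℚ ≤ ⟦ p ⟧ x
nonNegOn01-sound zero p {x} ok 0≤x x≤1 =
  subst (0ℚ ≤_) (0+ p x) (partialSums-sound 0ℤ p ℤ.≤-refl ok 0≤x x≤1)
nonNegOn01-sound (suc n) p {x} ok 0≤x x≤1 with Equivalence.to T-∨ ok
... | inj₁ ok₁ = subst (0ℚ ≤_) (0+ p x) (partialSums-sound 0ℤ p ℤ.≤-refl ok₁ 0≤x x≤1)
... | inj₂ ok₂ = *-cancelˡ-≤ 0<2ⁿ (subst₂ _≤_ (sym (*-zeroʳ (fromℤ 2ⁿ))) (⟦half⟧ p x) (halves (≤-total x ½)))
  where
  2ⁿ = (+ 2) ℤ.^ length p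
  0<2ⁿ : 0ℚ < fromℤ 2ⁿ
  0<2ⁿ = go (length p)
    where
    go : ∀ k → 0ℚ < fromℤ ((+ 2) ℤ.^ k)
    go zero = subst (0ℚ <_) (sym fromℤ-1) (positive⁻¹ 1ℚ)
    go (suc k) = subst (0ℚ <_) (sym (trans (fromℤ-* (+ 2) ((+ 2) ℤ.^ k)) (cong (_* fromℤ ((+ 2) ℤ.^ k)) fromℤ-2)))
      (subst (_< (1ℚ + 1ℚ) * fromℤ ((+ 2) ℤ.^ k)) (*-zeroʳ (1ℚ + 1ℚ)) (*-monoʳ-<-pos (1ℚ + 1ℚ) (go k)))
  left = proj₁ (∧-split ok₂)
  right = proj₂ (∧-split ok₂)
  2x-1 = x + x - 1ℚ
  shift : ⟦ half p ∘ₚ (1ℤ ∷ 1ℤ ∷ []) ⟧ 2x-1 ≡ ⟦ half p ⟧ (x + x)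
  shift = trans (⟦∘⟧ (half p) _ 2x-1) (cong ⟦ half p ⟧ (trans (cong (λ c → c + 2x-1 * (c + 2x-1 * 0ℚ)) fromℤ-1) (arg x)))
    where
    arg : ∀ x → 1ℚ + (x + x - 1ℚ) * (1ℚ + (x + x - 1ℚ) * 0ℚ) ≡ x + x
    arg = solve-∀ ℚ-ring
  halves : _ → 0ℚ ≤ ⟦ half p ⟧ (x + x)
  halves (inj₁ x≤½) = nonNegOn01-sound n (half p) left (0≤+ 0≤x 0≤x) (+-mono-≤ x≤½ x≤½)
  halves (inj₂ ½≤x) = subst (0ℚ ≤_) shift
    (nonNegOn01-sound n _ right (≤⇒0≤- (+-mono-≤ ½≤x ½≤x))
      (by-diff (arg x) (0≤+ (≤⇒0≤- x≤1) (≤⇒0≤- x≤1))))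
    where
    arg : ∀ x → 1ℚ - (x + x - 1ℚ) ≡ (1ℚ - x) + (1ℚ - x)
    arg = solve-∀ ℚ-ring

-- Piecewise polynomial functions

fromℕ : ℕ → ℚ
fromℕ n = fromℤ (+ n)

fromℕ-suc : ∀ n → fromℕ (suc n) ≡ 1ℚ + fromℕ n
fromℕ-suc n = trans (fromℤ-+ (+ 1) (+ n)) (cong (_+ fromℕ n) fromℤ-1)

fromℕ-nonNeg : ∀ n → 0ℚ ≤ fromℕ n
fromℕ-nonNeg n = fromℤ-nonNeg {+ n} (ℤ.+≤+ z≤n)

fromℕ-mono : ∀ {m n} → m ℕ.≤ n → fromℕ m ≤ fromℕ n
fromℕ-mono {n = n} z≤n = subst (_≤ fromℕ n) (sym fromℤ-0) (fromℕ-nonNeg n)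
fromℕ-mono {suc m} {suc n} (s≤s m≤n) =
  subst₂ _≤_ (sym (fromℕ-suc m)) (sym (fromℕ-suc n)) (+-monoʳ-≤ 1ℚ (fromℕ-mono m≤n))

cell : List Poly → ℕ → Poly
cell [] _ = []
cell (p ∷ ps) zero = p
cell (p ∷ ps) (suc i) = cell ps i

-- On [i , i + 1] this is f (cell ps i) in the local coordinate z - i; right of the last
-- cell it is constantly e.
glue : (Poly → ℚ → ℚ) → ℚ → List Poly → ℚ → ℚ
glue f e [] z = e
glue f e (p ∷ ps) z with z ≤? 1ℚ
... | yes _ = f p z
... | no _ = glue f e ps (z - 1ℚ)

-- At a joint `glue` uses the cell on the left. Agreement of the two values there makes the local
-- formula valid on closed cells, so that neighbouring cells share an endpoint at which inequalities
-- can be joined.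
Continuous : (Poly → ℚ → ℚ) → ℚ → List Poly → Set
Continuous f e [] = ⊤
Continuous f e (p ∷ ps) = f p 1ℚ ≡ glue f e ps 0ℚ × Continuous f e ps

continuous? : ∀ f e ps → Dec (Continuous f e ps)
continuous? f e [] = yes tt
continuous? f e (p ∷ ps) = (f p 1ℚ ≟ glue f e ps 0ℚ) ×-dec continuous? f e ps

module _ (f : Poly → ℚ → ℚ) (e : ℚ) where

  glue-head : ∀ p ps {z} → z ≤ 1ℚ → glue f e (p ∷ ps) z ≡ f p z
  glue-head p ps {z} z≤1 with z ≤? 1ℚ
  ... | yes _ = refl
  ... | no z≰1 = ⊥-elim (z≰1 z≤1)

  glue-tail : ∀ p ps {z} → Continuous f e (p ∷ ps) → 1ℚ ≤ z → glue f e (p ∷ ps) z ≡ glue f e ps (z - 1ℚ)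
  glue-tail p ps {z} (joint , _) 1≤z with z ≤? 1ℚ
  ... | no _ = refl
  ... | yes z≤1 with ≤-antisym z≤1 1≤z
  ... | refl = joint

  glue-cell : ∀ ps → Continuous f e ps → ∀ i → i ℕ.< length ps → ∀ {z} →
              fromℕ i ≤ z → z ≤ fromℕ (suc i) → glue f e ps z ≡ f (cell ps i) (z - fromℕ i)
  glue-cell (p ∷ ps) cts zero _ {z} _ z≤1 = trans (glue-head p ps (subst (z ≤_) fromℤ-1 z≤1))
    (cong (f p) (trans (z≡z-0 z) (cong (λ t → z - t) (sym fromℤ-0))))
    where
    z≡z-0 : ∀ z → z ≡ z - 0ℚ
    z≡z-0 = solve-∀ ℚ-ring
  glue-cell (p ∷ ps) cts (suc i) (s≤s i<n) {z} i≤z z≤i = begin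
    glue f e (p ∷ ps) z               ≡⟨ glue-tail p ps cts 1≤z ⟩
    glue f e ps (z - 1ℚ)              ≡⟨ glue-cell ps (proj₂ cts) i i<n lower upper ⟩
    f (cell ps i) (z - 1ℚ - fromℕ i)  ≡⟨ cong (f (cell ps i)) (trans (shift z (fromℕ i)) (cong (λ t → z - t) (sym (fromℕ-suc i)))) ⟩
    f (cell ps i) (z - fromℕ (suc i)) ∎
    where
    open ≡-Reasoning
    shift : ∀ z i → z - 1ℚ - i ≡ z - (1ℚ + i)
    shift = solve-∀ ℚ-ring
    unshift : ∀ i → 1ℚ + i - 1ℚ ≡ i
    unshift = solve-∀ ℚ-ring
    1≤z = subst (_≤ z) fromℤ-1 (≤-trans (fromℕ-mono {1} {suc i} (s≤s z≤n)) i≤z)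
    lower = subst (_≤ z - 1ℚ) (trans (cong (_- 1ℚ) (fromℕ-suc i)) (unshift (fromℕ i))) (+-monoˡ-≤ (- 1ℚ) i≤z)
    upper = subst (z - 1ℚ ≤_) (trans (cong (_- 1ℚ) (fromℕ-suc (suc i))) (unshift (fromℕ (suc i)))) (+-monoˡ-≤ (- 1ℚ) z≤i)

  glue-end : ∀ ps → Continuous f e ps → ∀ {z} → fromℕ (length ps) ≤ z → glue f e ps z ≡ e
  glue-end [] _ _ = refl
  glue-end (p ∷ ps) cts {z} n≤z = trans (glue-tail p ps cts 1≤z) (glue-end ps (proj₂ cts) lower)
    where
    unshift : ∀ i → 1ℚ + i - 1ℚ ≡ i
    unshift = solve-∀ ℚ-ring
    1≤z = subst (_≤ z) fromℤ-1 (≤-trans (fromℕ-mono {1} {suc (length ps)} (s≤s z≤n)) n≤z)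
    lower = subst (_≤ z - 1ℚ) (trans (cong (_- 1ℚ) (fromℕ-suc (length ps))) (unshift (fromℕ (length ps)))) (+-monoˡ-≤ (- 1ℚ) n≤z)

-- Splitting the segment from u to w at the cell boundaries reduces a relation between two points to
-- points of a common cell, plus the tail beyond the last cell. The recursion is on the number n of
-- cells left.
chain : ∀ (R : ℚ → ℚ → Set) →
        (∀ {u v w} → 0ℚ ≤ u → u ≤ v → v ≤ w → R u v → R v w → R u w) →
        ∀ n {lo hi} → n ℕ.+ lo ≡ hi →
        (∀ i → lo ℕ.≤ i → i ℕ.< hi → ∀ {u w} → fromℕ i ≤ u → u ≤ w → w ≤ fromℕ (suc i) → R u w) →
        (∀ {u w} → fromℕ hi ≤ u → u ≤ w → R u w) →
        ∀ {u w} → fromℕ lo ≤ u → u ≤ w → R u w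
chain R R-trans zero refl step end = end
chain R R-trans (suc n) {lo} {hi} eq step end {u} {w} lo≤u u≤w = go (≤-total w m) (≤-total m u)
  where
  m = fromℕ (suc lo)
  first = step lo ℕ.≤-refl (subst (lo ℕ.<_) eq (s≤s (ℕ.m≤n+m lo n)))
  rest : ∀ {u w} → m ≤ u → u ≤ w → R u w
  rest = chain R R-trans n (trans (ℕ.+-suc n lo) eq) (λ i lo<i → step i (ℕ.<⇒≤ lo<i)) end
  go : _ → _ → R u w
  go (inj₁ w≤m) _ = first lo≤u u≤w w≤m
  go (inj₂ _) (inj₁ m≤u) = rest m≤u u≤w
  go (inj₂ m≤w) (inj₂ u≤m) =
    R-trans (≤-trans (fromℕ-nonNeg lo) lo≤u) u≤m m≤w (first lo≤u u≤m ≤-refl) (rest ≤-refl m≤w)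

chain₀ : ∀ (R : ℚ → ℚ → Set) →
         (∀ {u v w} → 0ℚ ≤ u → u ≤ v → v ≤ w → R u v → R v w → R u w) →
         ∀ n →
         (∀ i → i ℕ.< n → ∀ {u w} → fromℕ i ≤ u → u ≤ w → w ≤ fromℕ (suc i) → R u w) →
         (∀ {u w} → fromℕ n ≤ u → u ≤ w → R u w) →
         ∀ {u w} → 0ℚ ≤ u → u ≤ w → R u w
chain₀ R R-trans n step end {u} 0≤u =
  chain R R-trans n (ℕ.+-identityʳ n) (λ i _ → step i) end (subst (_≤ u) (sym fromℤ-0) 0≤u)

allBelow : ℕ → (ℕ → Bool) → Bool
allBelow zero f = true
allBelow (suc n) f = f 0 ∧ allBelow n (λ i → f (suc i))

allBelow-sound : ∀ n f → T (allBelow n f) → ∀ i → i ℕ.< n → T (f i)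
allBelow-sound (suc n) f ok zero _ = proj₁ (∧-split {f 0} ok)
allBelow-sound (suc n) f ok (suc i) (s≤s i<n) = allBelow-sound n (λ i → f (suc i)) (proj₂ (∧-split {f 0} ok)) i i<n

-- The tables below are in units of 10⁻⁸, and a cell is a load interval of length 1/10.
-- The hazard cells are Taylor polynomials of the solution of τ′(y) = ρ(y) τ(y), τ(0) = 1,
-- where ρ = 1 on [0 , 1] and ρ(y) = τ(min(y - 1, 1.4)) afterwards.  The coefficients are
-- rounded down, which makes τ′ ≤ ρ τ hold coefficientwise.
hazardCells : List Poly
hazardCells =
  (+ 100000000 ∷ + 10000000 ∷ + 500000 ∷ + 16666 ∷ + 416 ∷ []) ∷
  (+ 110517082 ∷ + 11051708 ∷ + 552585 ∷ + 18419 ∷ + 460 ∷ []) ∷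
  (+ 122140254 ∷ + 12214025 ∷ + 610701 ∷ + 20356 ∷ + 508 ∷ []) ∷
  (+ 134985844 ∷ + 13498584 ∷ + 674929 ∷ + 22497 ∷ + 562 ∷ []) ∷
  (+ 149182416 ∷ + 14918241 ∷ + 745912 ∷ + 24863 ∷ + 621 ∷ []) ∷
  (+ 164872053 ∷ + 16487205 ∷ + 824360 ∷ + 27478 ∷ + 686 ∷ []) ∷
  (+ 182211782 ∷ + 18221178 ∷ + 911058 ∷ + 30368 ∷ + 759 ∷ []) ∷
  (+ 201375145 ∷ + 20137514 ∷ + 1006875 ∷ + 33562 ∷ + 839 ∷ []) ∷
  (+ 222553935 ∷ + 22255393 ∷ + 1112769 ∷ + 37092 ∷ + 927 ∷ []) ∷
  (+ 245960116 ∷ + 24596011 ∷ + 1229800 ∷ + 40993 ∷ + 1024 ∷ []) ∷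
  (+ 271827944 ∷ + 27182794 ∷ + 2718279 ∷ + 226523 ∷ + 16989 ∷ []) ∷
  (+ 301972529 ∷ + 33373122 ∷ + 3512806 ∷ + 307973 ∷ + 24215 ∷ []) ∷
  (+ 339190645 ∷ + 41428831 ∷ + 4601505 ∷ + 425061 ∷ + 35081 ∷ []) ∷
  (+ 385681123 ∷ + 52061491 ∷ + 6116856 ∷ + 596250 ∷ + 51717 ∷ []) ∷
  (+ 444507437 ∷ + 66312693 ∷ + 8261978 ∷ + 851124 ∷ + 77685 ∷ []) ∷
  (+ 520010917 ∷ + 85735267 ∷ + 11354438 ∷ + 1238080 ∷ + 119073 ∷ []) ∷
  (+ 618457775 ∷ + 112690293 ∷ + 15901264 ∷ + 1838066 ∷ + 186526 ∷ []) ∷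
  (+ 749073924 ∷ + 150844870 ∷ + 22730447 ∷ + 2789737 ∷ + 299135 ∷ []) ∷
  (+ 925738113 ∷ + 206026659 ∷ + 33227354 ∷ + 4336738 ∷ + 492060 ∷ []) ∷
  (+ 1169820924 ∷ + 287729290 ∷ + 49771428 ∷ + 6919141 ∷ + 831953 ∷ []) ∷
  (+ 1515072736 ∷ + 411839106 ∷ + 76566643 ∷ + 12042093 ∷ + 1704341 ∷ []) ∷
  (+ 2017224919 ∷ + 609146510 ∷ + 125633302 ∷ + 21784348 ∷ + 3383028 ∷ []) ∷
  (+ 2777172107 ∷ + 941990798 ∷ + 217284730 ∷ + 41835232 ∷ + 7176753 ∷ []) ∷
  (+ 3985459620 ∷ + 1537116541 ∷ + 400162901 ∷ + 86246112 ∷ + 16468806 ∷ []) ∷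
  (+ 6025453980 ∷ + 2678359105 ∷ + 595275270 ∷ + 88201428 ∷ + 9801547 ∷ []) ∷
  (+ 9397091330 ∷ + 4177076982 ∷ + 928370891 ∷ + 137555921 ∷ + 15286157 ∷ []) ∷
  (+ 14655381281 ∷ + 6514425971 ∷ + 1447855395 ∷ + 214527496 ∷ + 23839766 ∷ []) ∷
  (+ 22856029909 ∷ + 10159675274 ∷ + 2258025608 ∷ + 334569725 ∷ + 37179682 ∷ []) ∷
  (+ 35645480198 ∷ + 15844681043 ∷ + 3521539280 ∷ + 521783466 ∷ + 57984157 ∷ []) ∷
  (+ 55591468144 ∷ + 24710821023 ∷ + 5492071859 ∷ + 813755595 ∷ + 90430103 ∷ []) ∷
  (+ 86698546724 ∷ + 38538148795 ∷ + 8565246873 ∷ + 1269105311 ∷ + 141031687 ∷ []) ∷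
  (+ 135212079390 ∷ + 60102774861 ∷ + 13358065205 ∷ + 1979253109 ∷ + 219948181 ∷ []) ∷
  (+ 210872120746 ∷ + 93734225927 ∷ + 20832780262 ∷ + 3086775253 ∷ + 343023639 ∷ []) ∷
  (+ 328868925827 ∷ + 146184683328 ∷ + 32490089457 ∷ + 4814028797 ∷ + 534967900 ∷ []) ∷
  (+ 512892695309 ∷ + 227984617447 ∷ + 50670428988 ∷ + 7507794173 ∷ + 834317586 ∷ []) ∷
  (+ 799889853503 ∷ + 355556988662 ∷ + 79023862868 ∷ + 11708898248 ∷ + 1301173087 ∷ []) ∷
  []

-- In powers of the distance to the right end of the cell, so that nonnegative coefficients
-- give a decreasing convex function Ψ.  Computed from right to left such that
-- Ψ - Ψ′ exceeds 1/τ as little as possible.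
dualCells : List Poly
dualCells =
  (+ 43802686 ∷ + 4668117 ∷ + 219384 ∷ + 7773 ∷ []) ∷
  (+ 39345804 ∷ + 4252737 ∷ + 197055 ∷ + 7090 ∷ []) ∷
  (+ 35282709 ∷ + 3879922 ∷ + 176704 ∷ + 6469 ∷ []) ∷
  (+ 31572735 ∷ + 3545938 ∷ + 158124 ∷ + 5912 ∷ []) ∷
  (+ 28178752 ∷ + 3247442 ∷ + 141127 ∷ + 5414 ∷ []) ∷
  (+ 25066793 ∷ + 2981447 ∷ + 125541 ∷ + 4971 ∷ []) ∷
  (+ 22205712 ∷ + 2745292 ∷ + 111212 ∷ + 4577 ∷ []) ∷
  (+ 19566875 ∷ + 2536611 ∷ + 97997 ∷ + 4229 ∷ []) ∷
  (+ 17123873 ∷ + 2353317 ∷ + 85761 ∷ + 3924 ∷ []) ∷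
  (+ 14851614 ∷ + 2194861 ∷ + 73738 ∷ + 3660 ∷ []) ∷
  (+ 12733970 ∷ + 2040427 ∷ + 77217 ∷ + 0 ∷ []) ∷
  (+ 10778235 ∷ + 1871043 ∷ + 84692 ∷ + 0 ∷ []) ∷
  (+ 8995433 ∷ + 1694561 ∷ + 88241 ∷ + 0 ∷ []) ∷
  (+ 7392944 ∷ + 1510417 ∷ + 92072 ∷ + 0 ∷ []) ∷
  (+ 5974964 ∷ + 1325543 ∷ + 92437 ∷ + 0 ∷ []) ∷
  (+ 4740645 ∷ + 1143095 ∷ + 91224 ∷ + 0 ∷ []) ∷
  (+ 3686623 ∷ + 966719 ∷ + 85533 ∷ + 1770 ∷ []) ∷
  (+ 2804477 ∷ + 799916 ∷ + 79887 ∷ + 2343 ∷ []) ∷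
  (+ 2082441 ∷ + 646958 ∷ + 72276 ∷ + 2802 ∷ []) ∷
  (+ 1505778 ∷ + 509483 ∷ + 64065 ∷ + 3115 ∷ []) ∷
  (+ 1057522 ∷ + 390128 ∷ + 55029 ∷ + 3099 ∷ []) ∷
  (+ 719927 ∷ + 288112 ∷ + 46433 ∷ + 3050 ∷ []) ∷
  (+ 475596 ∷ + 203525 ∷ + 37831 ∷ + 2975 ∷ []) ∷
  (+ 307657 ∷ + 135198 ∷ + 29896 ∷ + 2845 ∷ []) ∷
  (+ 198202 ∷ + 86596 ∷ + 19975 ∷ + 2884 ∷ []) ∷
  (+ 128117 ∷ + 55423 ∷ + 12813 ∷ + 1849 ∷ []) ∷
  (+ 83286 ∷ + 35425 ∷ + 8220 ∷ + 1186 ∷ []) ∷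
  (+ 54659 ∷ + 22589 ∷ + 5278 ∷ + 760 ∷ []) ∷
  (+ 36435 ∷ + 14346 ∷ + 3391 ∷ + 487 ∷ []) ∷
  (+ 24895 ∷ + 9046 ∷ + 2182 ∷ + 312 ∷ []) ∷
  (+ 17656 ∷ + 5632 ∷ + 1407 ∷ + 200 ∷ []) ∷
  (+ 13192 ∷ + 3424 ∷ + 912 ∷ + 128 ∷ []) ∷
  (+ 10526 ∷ + 1990 ∷ + 594 ∷ + 82 ∷ []) ∷
  (+ 9033 ∷ + 1048 ∷ + 393 ∷ + 52 ∷ []) ∷
  (+ 8316 ∷ + 419 ∷ + 265 ∷ + 33 ∷ []) ∷
  (+ 8117 ∷ + 0 ∷ + 178 ∷ + 21 ∷ []) ∷
  []

-- The hazard function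

unit : ℤ
unit = + 100000000

unit⁻¹ : ℚ
unit⁻¹ = + 1 / 100000000

0≤unit⁻¹ : 0ℚ ≤ unit⁻¹
0≤unit⁻¹ = from-yes (0ℚ ≤? unit⁻¹)

⟪_⟫ : Poly → ℚ → ℚ
⟪ p ⟫ s = unit⁻¹ * ⟦ p ⟧ s

-- The sum of the coefficients in the last hazard cell, so τ is continuous at load 3.6 and constant
-- from there on.
τ-end : ℚ
τ-end = unit⁻¹ * fromℤ (+ 1247480776368)

opaque
  τ : ℚ → ℚ
  τ = glue ⟪_⟫ τ-end hazardCells

τ-poly : ℕ → Poly
τ-poly = cell hazardCells

module _ {i : ℕ} where

  local-≤1 : ∀ {z} → z ≤ fromℕ (suc i) → z - fromℕ i ≤ 1ℚ
  local-≤1 {z} z≤ = subst (z - fromℕ i ≤_) (trans (cong (_- fromℕ i) (fromℕ-suc i)) (cancel (fromℕ i))) (+-monoˡ-≤ (- fromℕ i) z≤)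
    where
    cancel : ∀ i → 1ℚ + i - i ≡ 1ℚ
    cancel = solve-∀ ℚ-ring

  local-diff : ∀ u w → (w - fromℕ i) - (u - fromℕ i) ≡ w - u
  local-diff u w = cancel u w (fromℕ i)
    where
    cancel : ∀ u w i → (w - i) - (u - i) ≡ w - u
    cancel = solve-∀ ℚ-ring

opaque
  unfolding fromℤ τ

  τ-continuous : Continuous ⟪_⟫ τ-end hazardCells
  τ-continuous = from-yes (continuous? ⟪_⟫ τ-end hazardCells)

  τ-cell : ∀ i → i ℕ.< 36 → ∀ {z} → fromℕ i ≤ z → z ≤ fromℕ (suc i) → τ z ≡ ⟪ τ-poly i ⟫ (z - fromℕ i)
  τ-cell = glue-cell ⟪_⟫ τ-end hazardCells τ-continuous

  τ-tail : ∀ {z} → fromℕ 36 ≤ z → τ z ≡ τ-end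
  τ-tail = glue-end ⟪_⟫ τ-end hazardCells τ-continuous

  τ0≡1 : τ 0ℚ ≡ 1ℚ
  τ0≡1 = refl

  24-10≡14 : fromℕ 24 - fromℕ 10 ≡ fromℕ 14
  24-10≡14 = refl

  unit⁻¹*unit≡1 : unit⁻¹ * fromℤ unit ≡ 1ℚ
  unit⁻¹*unit≡1 = refl

  unit⁻¹*-10unit : unit⁻¹ * fromℤ (ℤ.- (+ 10 ℤ.* unit)) ≡ - (+ 10 / 1)
  unit⁻¹*-10unit = refl

  τ14 : τ (fromℕ 14) ≡ unit⁻¹ * fromℤ (+ 444507437)
  τ14 = refl

τ-poly-nonNeg : ∀ i → i ℕ.< 36 → T (nonNegCoeffs (τ-poly i))
τ-poly-nonNeg = allBelow-sound 36 (λ i → nonNegCoeffs (τ-poly i)) tt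

τ-mono : ∀ {u w} → 0ℚ ≤ u → u ≤ w → τ u ≤ τ w
τ-mono = chain₀ (λ u w → τ u ≤ τ w) (λ _ _ _ → ≤-trans) 36
  (λ i i<36 i≤u u≤w w≤i → subst₂ _≤_
    (sym (τ-cell i i<36 i≤u (≤-trans u≤w w≤i))) (sym (τ-cell i i<36 (≤-trans i≤u u≤w) w≤i))
    (*-monoʳ-≤ 0≤unit⁻¹ (⟦⟧-mono (τ-poly i) (τ-poly-nonNeg i i<36) (≤⇒0≤- i≤u) (+-monoˡ-≤ (- fromℕ i) u≤w))))
  (λ 36≤u u≤w → ≤-reflexive (trans (τ-tail 36≤u) (sym (τ-tail (≤-trans 36≤u u≤w)))))

1≤τ : ∀ {z} → 0ℚ ≤ z → 1ℚ ≤ τ z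
1≤τ {z} 0≤z = subst (_≤ τ z) τ0≡1 (τ-mono ≤-refl 0≤z)

0≤τ : ∀ {z} → 0ℚ ≤ z → 0ℚ ≤ τ z
0≤τ 0≤z = ≤-trans 0≤1ℚ (1≤τ 0≤z)

-- The load one unit (ten cells) earlier, kept within [0 , 14].
delay : ℚ → ℚ
delay z = (z - fromℕ 10 ⊔ 0ℚ) ⊓ fromℕ 14

0≤delay : ∀ z → 0ℚ ≤ delay z
0≤delay z = ⊓-glb (p≤q⊔p (z - fromℕ 10) 0ℚ) (fromℕ-nonNeg 14)

delay-mono : ∀ {u w} → u ≤ w → delay u ≤ delay w
delay-mono u≤w = ⊓-monoˡ-≤ (fromℕ 14) (⊔-monoˡ-≤ 0ℚ (+-monoˡ-≤ (- fromℕ 10) u≤w))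

delay-early : ∀ {z} → z ≤ fromℕ 10 → delay z ≡ 0ℚ
delay-early {z} z≤10 = trans (cong (_⊓ fromℕ 14) (p≤q⇒p⊔q≡q (subst (z - fromℕ 10 ≤_) (+-inverseʳ (fromℕ 10)) (+-monoˡ-≤ (- fromℕ 10) z≤10))))
  (p≤q⇒p⊓q≡p (fromℕ-nonNeg 14))

delay-middle : ∀ {z} → fromℕ 10 ≤ z → z ≤ fromℕ 24 → delay z ≡ z - fromℕ 10
delay-middle {z} 10≤z z≤24 = trans (cong (_⊓ fromℕ 14) (p≥q⇒p⊔q≡p (≤⇒0≤- 10≤z)))
  (p≤q⇒p⊓q≡p (subst (z - fromℕ 10 ≤_) 24-10≡14 (+-monoˡ-≤ (- fromℕ 10) z≤24)))

delay-late : ∀ {z} → fromℕ 24 ≤ z → delay z ≡ fromℕ 14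
delay-late {z} 24≤z = p≥q⇒p⊓q≡q
  (≤-trans (subst (_≤ z - fromℕ 10) 24-10≡14 (+-monoˡ-≤ (- fromℕ 10) 24≤z)) (p≤p⊔q (z - fromℕ 10) 0ℚ))

rate : ℚ → ℚ
rate z = τ (delay z)

rate-mono : ∀ {u w} → u ≤ w → rate u ≤ rate w
rate-mono {u} u≤w = τ-mono (0≤delay u) (delay-mono u≤w)

0≤rate : ∀ z → 0ℚ ≤ rate z
0≤rate z = 0≤τ (0≤delay z)

rate-early : ∀ {i z} → i ℕ.< 10 → z ≤ fromℕ (suc i) → rate z ≡ 1ℚ
rate-early {i} i<10 z≤i = trans (cong τ (delay-early (≤-trans z≤i (fromℕ-mono {suc i} {10} i<10)))) τ0≡1

rate-late : ∀ {i z} → 24 ℕ.≤ i → fromℕ i ≤ z → rate z ≡ unit⁻¹ * fromℤ (+ 444507437)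
rate-late {i} 24≤i i≤z = trans (cong τ (delay-late (≤-trans (fromℕ-mono {24} {i} 24≤i) i≤z))) τ14

rate-middle : ∀ {j z} → j ℕ.< 14 → fromℕ (10 ℕ.+ j) ≤ z → z ≤ fromℕ (suc (10 ℕ.+ j)) →
              rate z ≡ ⟪ τ-poly j ⟫ (z - fromℕ (10 ℕ.+ j))
rate-middle {j} {z} j<14 i≤z z≤i = begin
  τ (delay z)                                ≡⟨ cong τ (delay-middle 10≤z z≤24) ⟩
  τ (z - fromℕ 10)                           ≡⟨ τ-cell j (ℕ.<-≤-trans j<14 (ℕ.m≤m+n 14 22)) lower upper ⟩
  ⟪ τ-poly j ⟫ (z - fromℕ 10 - fromℕ j)      ≡⟨ cong ⟪ τ-poly j ⟫ (trans (regroup z (fromℕ 10) (fromℕ j)) (cong (λ t → z - t) (sym (split j)))) ⟩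
  ⟪ τ-poly j ⟫ (z - fromℕ (10 ℕ.+ j))        ∎
  where
  open ≡-Reasoning
  split : ∀ j → fromℕ (10 ℕ.+ j) ≡ fromℕ 10 + fromℕ j
  split j = fromℤ-+ (+ 10) (+ j)
  cancel : ∀ a b → a + b - a ≡ b
  cancel = solve-∀ ℚ-ring
  regroup : ∀ z a b → z - a - b ≡ z - (a + b)
  regroup = solve-∀ ℚ-ring
  10≤z = ≤-trans (fromℕ-mono {10} {10 ℕ.+ j} (ℕ.m≤m+n 10 j)) i≤z
  z≤24 = ≤-trans z≤i (fromℕ-mono {suc (10 ℕ.+ j)} {24} (ℕ.+-monoʳ-≤ 10 j<14))
  lower = subst (_≤ z - fromℕ 10) (trans (cong (_- fromℕ 10) (split j)) (cancel (fromℕ 10) (fromℕ j))) (+-monoˡ-≤ (- fromℕ 10) i≤z)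
  upper = subst (z - fromℕ 10 ≤_) (trans (cong (_- fromℕ 10) (split (suc j))) (cancel (fromℕ 10) (fromℕ (suc j)))) (+-monoˡ-≤ (- fromℕ 10) z≤i)

rate-poly-by : ∀ {i} → Dec (i ℕ.< 10) → Dec (i ℕ.< 24) → Poly
rate-poly-by {i} (yes _) _ = unit ∷ []
rate-poly-by {i} (no _) (yes _) = τ-poly (i ℕ.∸ 10)
rate-poly-by {i} (no _) (no _) = + 444507437 ∷ []

rate-poly : ℕ → Poly
rate-poly i = rate-poly-by (i ℕ.<? 10) (i ℕ.<? 24)

⟪const⟫ : ∀ a s → ⟪ a ∷ [] ⟫ s ≡ unit⁻¹ * fromℤ a
⟪const⟫ a s = cong (unit⁻¹ *_) (⟦const⟧ a s)

rate-cell : ∀ i {z} → fromℕ i ≤ z → z ≤ fromℕ (suc i) → rate z ≡ ⟪ rate-poly i ⟫ (z - fromℕ i)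
rate-cell i {z} i≤z z≤i = by-cases (i ℕ.<? 10) (i ℕ.<? 24)
  where
  by-cases : ∀ d e → rate z ≡ ⟪ rate-poly-by {i} d e ⟫ (z - fromℕ i)
  by-cases (yes i<10) _ = trans (rate-early i<10 z≤i) (sym (trans (⟪const⟫ unit (z - fromℕ i)) unit⁻¹*unit≡1))
  by-cases (no i≮10) (no i≮24) = trans (rate-late (ℕ.≮⇒≥ i≮24) i≤z) (sym (⟪const⟫ (+ 444507437) (z - fromℕ i)))
  by-cases (no i≮10) (yes i<24) = subst (λ k → rate z ≡ ⟪ τ-poly (i ℕ.∸ 10) ⟫ (z - fromℕ k)) i≡10+j
    (rate-middle (ℕ.+-cancelˡ-< 10 (i ℕ.∸ 10) 14 (subst (ℕ._< 24) (sym i≡10+j) i<24))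
      (subst (λ k → fromℕ k ≤ z) (sym i≡10+j) i≤z)
      (subst (λ k → z ≤ fromℕ (suc k)) (sym i≡10+j) z≤i))
    where
    i≡10+j = ℕ.m+[n∸m]≡n (ℕ.≮⇒≥ i≮10)

-- The factor 10 converts the derivative in the cell coordinate into one in the load; the extra
-- `unit` is there because the product of two tables carries the scale squared and the derivative
-- carries it once.
rate-check : ∀ i → i ℕ.< 36 →
  T (nonNegOn01 0 (rate-poly i ⊗ τ-poly i ⊕ (ℤ.- (+ 10 ℤ.* unit)) ⊙ deriv (τ-poly i)))
rate-check = allBelow-sound 36
  (λ i → nonNegOn01 0 (rate-poly i ⊗ τ-poly i ⊕ (ℤ.- (+ 10 ℤ.* unit)) ⊙ deriv (τ-poly i))) tt

1/10 : ℚ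
1/10 = + 1 / 10

derivative≤ : ∀ i → i ℕ.< 36 → ∀ {s} → 0ℚ ≤ s → s ≤ 1ℚ →
              unit⁻¹ * ⟦ deriv (τ-poly i) ⟧ s ≤ 1/10 * (⟪ rate-poly i ⟫ s * ⟪ τ-poly i ⟫ s)
derivative≤ i i<36 {s} 0≤s s≤1 = by-diff
  (sym (trans (regroup unit⁻¹ (fromℤ k) (⟦ c ⟧ s) (⟦ p ⟧ s) (⟦ deriv p ⟧ s))
    (trans (cong (λ t → 1/10 * (⟪ c ⟫ s * ⟪ p ⟫ s) + 1/10 * t * (unit⁻¹ * ⟦ deriv p ⟧ s)) unit⁻¹*-10unit)
           (simplify (⟪ c ⟫ s * ⟪ p ⟫ s) (unit⁻¹ * ⟦ deriv p ⟧ s)))))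
  (0≤* (from-yes (0ℚ ≤? unit⁻¹ * unit⁻¹ * 1/10))
       (subst (0ℚ ≤_) meaning (nonNegOn01-sound 0 (c ⊗ p ⊕ k ⊙ deriv p) (rate-check i i<36) 0≤s s≤1)))
  where
  c = rate-poly i
  p = τ-poly i
  k = ℤ.- (+ 10 ℤ.* unit)
  meaning : ⟦ c ⊗ p ⊕ k ⊙ deriv p ⟧ s ≡ ⟦ c ⟧ s * ⟦ p ⟧ s + fromℤ k * ⟦ deriv p ⟧ s
  meaning = trans (⟦⊕⟧ (c ⊗ p) (k ⊙ deriv p) s) (cong₂ _+_ (⟦⊗⟧ c p s) (⟦⊙⟧ k (deriv p) s))
  regroup : ∀ u k C P P′ → u * u * 1/10 * (C * P + k * P′) ≡
            1/10 * (u * C * (u * P)) + 1/10 * (u * k) * (u * P′)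
  regroup = solve-∀ ℚ-ring
  simplify : ∀ a b → 1/10 * a + 1/10 * (- (+ 10 / 1)) * b ≡ 1/10 * a - b
  simplify = solve-∀ ℚ-ring

-- The integrated form of τ′ ≤ ρ τ. In a cell a secant is at most as steep as the tangent at its
-- right end; the pieces add up because the bound at the right end is nondecreasing.
τ-hazard : ∀ {u w} → 0ℚ ≤ u → u ≤ w → τ w - τ u ≤ (w - u) * (1/10 * (rate w * τ w))
τ-hazard = chain₀ (λ u w → τ w - τ u ≤ (w - u) * (1/10 * (rate w * τ w))) transitive 36 step end
  where
  bound : ℚ → ℚ
  bound w = 1/10 * (rate w * τ w)
  bound-mono : ∀ {v w} → 0ℚ ≤ v → v ≤ w → bound v ≤ bound w
  bound-mono {v} 0≤v v≤w = *-monoʳ-≤ (from-yes (0ℚ ≤? 1/10))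
    (*-mono-≤ (0≤rate v) (0≤τ (≤-trans 0≤v v≤w)) (rate-mono v≤w) (τ-mono 0≤v v≤w))
  transitive : ∀ {u v w} → 0ℚ ≤ u → u ≤ v → v ≤ w →
    τ v - τ u ≤ (v - u) * bound v → τ w - τ v ≤ (w - v) * bound w → τ w - τ u ≤ (w - u) * bound w
  transitive {u} {v} {w} 0≤u u≤v v≤w uv vw = by-diff
    (regroup (τ u) (τ v) (τ w) u v w (bound v) (bound w))
    (0≤+ (0≤+ (≤⇒0≤- uv) (≤⇒0≤- vw)) (0≤* (≤⇒0≤- u≤v) (≤⇒0≤- (bound-mono (≤-trans 0≤u u≤v) v≤w))))
    where
    regroup : ∀ a b c u v w B C → (w - u) * C - (c - a) ≡
              ((v - u) * B - (b - a)) + ((w - v) * C - (c - b)) + (v - u) * (C - B)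
    regroup = solve-∀ ℚ-ring
  step : ∀ i → i ℕ.< 36 → ∀ {u w} → fromℕ i ≤ u → u ≤ w → w ≤ fromℕ (suc i) →
         τ w - τ u ≤ (w - u) * bound w
  step i i<36 {u} {w} i≤u u≤w w≤i = subst₂ _≤_
    (sym (cong₂ _-_ τw (τ-cell i i<36 i≤u (≤-trans u≤w w≤i))))
    (sym (cong (λ t → (w - u) * (1/10 * t)) (cong₂ _*_ (rate-cell i (≤-trans i≤u u≤w) w≤i) τw)))
    (by-diff (trans (cong (λ d → d * B - (unit⁻¹ * P s - unit⁻¹ * P r)) (sym (local-diff {i} u w)))
                   (regroup unit⁻¹ s r (P s) (P r) P′ B))
      (0≤+ (0≤* 0≤unit⁻¹ (≤⇒0≤- (secant≤tangent (τ-poly i) (τ-poly-nonNeg i i<36) (≤⇒0≤- i≤u) r≤s)))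
           (0≤* (≤⇒0≤- r≤s) (≤⇒0≤- (derivative≤ i i<36 (≤⇒0≤- (≤-trans i≤u u≤w)) (local-≤1 {i} w≤i))))))
    where
    τw = τ-cell i i<36 (≤-trans i≤u u≤w) w≤i
    s = w - fromℕ i
    r = u - fromℕ i
    r≤s : r ≤ s
    r≤s = +-monoˡ-≤ (- fromℕ i) u≤w
    P = ⟦ τ-poly i ⟧
    P′ = ⟦ deriv (τ-poly i) ⟧ s
    B = 1/10 * (⟪ rate-poly i ⟫ s * ⟪ τ-poly i ⟫ s)
    regroup : ∀ k s r p q p′ B → (s - r) * B - (k * p - k * q) ≡
              k * ((s - r) * p′ - (p - q)) + (s - r) * (B - k * p′)
    regroup = solve-∀ ℚ-ring
  end : ∀ {u w} → fromℕ 36 ≤ u → u ≤ w → τ w - τ u ≤ (w - u) * bound w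
  end {u} {w} 36≤u u≤w = subst (_≤ (w - u) * bound w)
    (sym (trans (cong₂ _-_ (τ-tail (≤-trans 36≤u u≤w)) (τ-tail 36≤u)) (+-inverseʳ τ-end)))
    (0≤* (≤⇒0≤- u≤w) (0≤* (from-yes (0ℚ ≤? 1/10)) (0≤* (0≤rate w) (0≤τ (≤-trans (≤-trans (fromℕ-nonNeg 36) 36≤u) u≤w)))))

-- The balance inequality

opaque
  pow : ℚ → ℕ → ℚ
  pow x zero = 1ℚ
  pow x (suc n) = x * pow x n

  pow-* : ∀ x y n → pow (x * y) n ≡ pow x n * pow y n
  pow-* x y zero = refl
  pow-* x y (suc n) = trans (cong (x * y *_) (pow-* x y n)) (regroup x y (pow x n) (pow y n))
    where
    regroup : ∀ x y p q → x * y * (p * q) ≡ x * p * (y * q)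
    regroup = solve-∀ ℚ-ring

  0≤pow : ∀ {x} n → 0ℚ ≤ x → 0ℚ ≤ pow x n
  0≤pow zero _ = 0≤1ℚ
  0≤pow (suc n) 0≤x = 0≤* 0≤x (0≤pow n 0≤x)

  pow≤1 : ∀ {x} n → 0ℚ ≤ x → x ≤ 1ℚ → pow x n ≤ 1ℚ
  pow≤1 zero _ _ = ≤-refl
  pow≤1 (suc n) 0≤x x≤1 = *-mono-≤ 0≤x 0≤1ℚ x≤1 (pow≤1 n 0≤x x≤1)

  ⟦^⟧ : ∀ p n x → ⟦ p ^ₚ n ⟧ x ≡ pow (⟦ p ⟧ x) n
  ⟦^⟧ p zero x = trans (⟦const⟧ 1ℤ x) fromℤ-1
  ⟦^⟧ p (suc n) x = trans (⟦⊗⟧ p (p ^ₚ n) x) (cong (⟦ p ⟧ x *_) (⟦^⟧ p n x))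

  fromℤ-^ : ∀ a n → fromℤ (a ℤ.^ n) ≡ pow (fromℤ a) n
  fromℤ-^ a zero = fromℤ-1
  fromℤ-^ a (suc n) = trans (fromℤ-* a (a ℤ.^ n)) (cong (fromℤ a *_) (fromℤ-^ a n))

  pow-suc : ∀ x n → pow x (suc n) ≡ x * pow x n
  pow-suc x n = refl

  pow-zero : ∀ x → pow x 0 ≡ 1ℚ
  pow-zero x = refl

  pow-4 : ∀ x → pow x 4 ≡ x * (x * (x * (x * 1ℚ)))
  pow-4 x = refl

fromℤ-neg : ∀ a → fromℤ (ℤ.- a) ≡ - fromℤ a
fromℤ-neg a = begin
  fromℤ (ℤ.- a)                       ≡⟨ add-sub (fromℤ (ℤ.- a)) (fromℤ a) ⟩
  fromℤ (ℤ.- a) + fromℤ a - fromℤ a   ≡⟨ cong (_- fromℤ a) (trans (sym (fromℤ-+ (ℤ.- a) a)) (trans (cong fromℤ (ℤ.+-inverseˡ a)) fromℤ-0)) ⟩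
  0ℚ - fromℤ a                        ≡⟨ +-identityˡ (- fromℤ a) ⟩
  - fromℤ a                           ∎
  where
  open ≡-Reasoning
  add-sub : ∀ x y → x ≡ x + y - y
  add-sub = solve-∀ ℚ-ring

fromℤ-pos : ∀ {a} → 0ℤ ℤ.< a → 0ℚ < fromℤ a
fromℤ-pos {a} 0<a = toℚᵘ-cancel-<
  (ℚᵘ.<-respʳ-≃ (ℚᵘ.≃-sym (toℚᵘ-fromℤ a)) (ℚᵘ.*<* (subst (0ℤ ℤ.<_) (sym (ℤ.*-identityʳ a)) 0<a)))

fromℤ-mono : ∀ {a b} → a ℤ.≤ b → fromℤ a ≤ fromℤ b
fromℤ-mono {a} {b} a≤b = 0≤-⇒≤ (subst (0ℚ ≤_)
  (trans (fromℤ-+ b (ℤ.- a)) (cong (λ t → fromℤ b + t) (fromℤ-neg a)))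
  (fromℤ-nonNeg (ℤ.i≤j⇒0≤j-i a≤b)))

-- Polynomial certificates for the balance inequality

ε : ℚ
ε = + 1 / 100000

0≤ε : 0ℚ ≤ ε
0≤ε = from-yes (0ℚ ≤? ε)

1/32 1/1000 5/2 : ℚ
1/32 = + 1 / 32
1/1000 = + 1 / 1000
5/2 = + 5 / 2

-- Its nonnegativity says that the logarithmic derivative of τ, per cell, is at least 10⁻⁵ (a + b (u
-- - lo)) on cell i. The values of a and b used later are the hazard rate and its slope at `lo`,
-- rounded down: 12200 and 1220 come from τ = 1.2214 at load 0.2, 13480 and 1348 from τ = 1.3499 at
-- load 0.3. For the first range, 9990 is a constant bound slightly below rate 1.
growthPoly : ℕ → ℤ → ℤ → ℕ → Poly
growthPoly lo a b i =
  + 100000 ⊙ deriv (τ-poly i) ⊕ -1ℤ ⊙ ((a ℤ.+ b ℤ.* (+ i ℤ.- + lo) ∷ b ∷ []) ⊗ τ-poly i)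

growthCheck : ℕ → ℤ → ℤ → ℕ → Bool
growthCheck lo a b i = (i ℕ.<ᵇ lo) ∨ nonNegOn01 0 (growthPoly lo a b i)

-- An Euler factor 1 + δ ε (a + b m δ) with step δ = 5x/2, a quarter of the distance 10x in cell
-- coordinates; multiplying by 400000 clears its denominators.
factorPoly : ℤ → ℤ → ℤ → Poly
factorPoly a b m = + 400000 ∷ + 10 ℤ.* a ∷ + 25 ℤ.* (b ℤ.* m) ∷ []

gainPoly : ℤ → ℤ → Poly
gainPoly a b = f (+ 0) ⊗ (f (+ 1) ⊗ (f (+ 2) ⊗ f (+ 3)))
  where
  f = factorPoly a b

opaque
  combine : ℕ → (A X C L : Poly) → ℤ → ℤ → Poly
  combine n A X C L k l = (A ^ₚ n) ⊗ (k ⊙ X ⊕ C ⊗ L) ⊕ (ℤ.- l) ⊙ X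

  ⟦combine⟧ : ∀ n A X C L k l x → ⟦ combine n A X C L k l ⟧ x ≡
    pow (⟦ A ⟧ x) n * (fromℤ k * ⟦ X ⟧ x + ⟦ C ⟧ x * ⟦ L ⟧ x) + - fromℤ l * ⟦ X ⟧ x
  ⟦combine⟧ n A X C L k l x =
    trans (⟦⊕⟧ ((A ^ₚ n) ⊗ (k ⊙ X ⊕ C ⊗ L)) ((ℤ.- l) ⊙ X) x)
      (cong₂ _+_
        (trans (⟦⊗⟧ (A ^ₚ n) (k ⊙ X ⊕ C ⊗ L) x)
          (cong₂ _*_ (⟦^⟧ A n x)
            (trans (⟦⊕⟧ (k ⊙ X) (C ⊗ L) x) (cong₂ _+_ (⟦⊙⟧ k X x) (⟦⊗⟧ C L x)))))
        (trans (⟦⊙⟧ (ℤ.- l) X x) (cong (_* ⟦ X ⟧ x) (fromℤ-neg l))))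

scale : ℤ
scale = + 1000 ℤ.* ((+ 32000) ℤ.^ 32 ℤ.* (+ 400000) ℤ.^ 4)

-- The balance inequality after division by q, with 1/q replaced by the lower bound gain times τ v,
-- and τ v by C / 1000; `scale` clears all denominators.
stepPoly : ℤ → ℤ → ℤ → Poly
stepPoly a b C = combine 32 (+ 32000 ∷ ℤ.- C ∷ []) (1ℤ ∷ -1ℤ ∷ []) (0ℤ ∷ C ∷ []) (gainPoly a b)
  (+ 1000 ℤ.* (+ 400000) ℤ.^ 4) scale

opaque
  unfolding fromℤ

  ε*100000≡1 : ε * fromℤ (+ 100000) ≡ 1ℚ
  ε*100000≡1 = refl

  400000*5/2*ε : fromℤ (+ 400000) * 5/2 * ε ≡ fromℤ (+ 10)
  400000*5/2*ε = refl

  400000*5/2*5/2*ε : fromℤ (+ 400000) * 5/2 * 5/2 * ε ≡ fromℤ (+ 25)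
  400000*5/2*5/2*ε = refl

  1000*1/1000 : fromℤ (+ 1000) * 1/1000 ≡ 1ℚ
  1000*1/1000 = refl

  32000*1/1000*1/32 : fromℤ (+ 32000) * 1/1000 * 1/32 ≡ 1ℚ
  32000*1/1000*1/32 = refl

  5/2+5/2+5/2+5/2≡10 : 0ℚ + 5/2 + 5/2 + 5/2 + 5/2 ≡ fromℕ 10
  5/2+5/2+5/2+5/2≡10 = refl

  fromℤ-neg1 : fromℤ -1ℤ ≡ - 1ℚ
  fromℤ-neg1 = refl

⟦linear⟧ : ∀ a b x → ⟦ a ∷ b ∷ [] ⟧ x ≡ fromℤ a + x * fromℤ b
⟦linear⟧ a b x = cong (λ t → fromℤ a + x * t) (⟦const⟧ b x)

⟦1-x⟧ : ∀ x → ⟦ 1ℤ ∷ -1ℤ ∷ [] ⟧ x ≡ 1ℚ - x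
⟦1-x⟧ x = trans (⟦linear⟧ 1ℤ -1ℤ x) (trans (cong₂ (λ c d → c + x * d) fromℤ-1 fromℤ-neg1) (regroup x))
  where
  regroup : ∀ x → 1ℚ + x * - 1ℚ ≡ 1ℚ - x
  regroup = solve-∀ ℚ-ring

-- Lets one numerical check at the upper bound C serve all smaller values c. Morally, d (1 - c
-- e)^(-n) is convex in c, d + c m is linear, and they agree at c = 0, so an inequality at C
-- persists below it. The induction avoids division by absorbing one factor 1 - C e into m.
shrink : ∀ n {c C e d m} → 0ℚ ≤ c → c ≤ C → 0ℚ < C → 0ℚ ≤ e → C * e ≤ 1ℚ → 0ℚ ≤ d → 0ℚ ≤ m →
         d ≤ pow (1ℚ - C * e) n * (d + C * m) → d ≤ pow (1ℚ - c * e) n * (d + c * m)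
shrink zero {c} {e = e} {d} {m} 0≤c _ _ _ _ _ 0≤m _ = by-diff
  (trans (cong (λ t → t * (d + c * m) - d) (pow-zero (1ℚ - c * e))) (regroup d c m)) (0≤* 0≤c 0≤m)
  where
  regroup : ∀ d c m → 1ℚ * (d + c * m) - d ≡ c * m
  regroup = solve-∀ ℚ-ring
shrink (suc n) {c} {C} {e} {d} {m} 0≤c c≤C 0<C 0≤e Ce≤1 0≤d 0≤m h = begin
  d                                             ≤⟨ shrink n 0≤c c≤C 0<C 0≤e Ce≤1 0≤d 0≤m′ h′ ⟩
  pow (1ℚ - c * e) n * (d + c * m′)             ≤⟨ *-monoʳ-≤ (0≤pow n 0≤1-ce) step ⟩
  pow (1ℚ - c * e) n * ((1ℚ - c * e) * (d + c * m)) ≡⟨ swap (pow (1ℚ - c * e) n) (1ℚ - c * e) (d + c * m) ⟩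
  (1ℚ - c * e) * pow (1ℚ - c * e) n * (d + c * m) ≡⟨ cong (_* (d + c * m)) (sym (pow-suc (1ℚ - c * e) n)) ⟩
  pow (1ℚ - c * e) (suc n) * (d + c * m)        ∎
  where
  open ≤-Reasoning
  m′ = m - e * d - C * e * m
  0≤C = <⇒≤ 0<C
  0≤1-Ce = ≤⇒0≤- Ce≤1
  0≤1-ce = ≤⇒0≤- (≤-trans (*-monoˡ-≤ 0≤e c≤C) Ce≤1)
  swap : ∀ p q r → p * (q * r) ≡ q * p * r
  swap = solve-∀ ℚ-ring
  expand : ∀ C e d m → (1ℚ - C * e) * (d + C * m) ≡ d + C * (m - e * d - C * e * m)
  expand = solve-∀ ℚ-ring
  P = pow (1ℚ - C * e) n
  h′ : d ≤ P * (d + C * m′)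
  h′ = subst (d ≤_) (trans (sym (swap P (1ℚ - C * e) (d + C * m))) (cong (P *_) (expand C e d m)))
    (subst (λ t → d ≤ t * (d + C * m)) (pow-suc (1ℚ - C * e) n) h)
  d≤ : d ≤ d + C * m′
  d≤ = ≤-trans h′ (subst (P * (d + C * m′) ≤_) (*-identityˡ (d + C * m′)) (*-monoˡ-≤
    (subst (0ℚ ≤_) (expand C e d m) (0≤* 0≤1-Ce (0≤+ 0≤d (0≤* 0≤C 0≤m))))
    (pow≤1 n 0≤1-Ce (by-diff (one-minus (C * e)) (0≤* 0≤C 0≤e)))))
    where
    one-minus : ∀ z → 1ℚ - (1ℚ - z) ≡ z
    one-minus = solve-∀ ℚ-ring
  0≤m′ : 0ℚ ≤ m′
  0≤m′ = *-cancelˡ-≤ 0<C (subst₂ _≤_ (sym (*-zeroʳ C)) (cancel d (C * m′)) (≤⇒0≤- d≤))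
    where
    cancel : ∀ d k → d + k - d ≡ k
    cancel = solve-∀ ℚ-ring
  step : d + c * m′ ≤ (1ℚ - c * e) * (d + c * m)
  step = by-diff (regroup c C e d m) (0≤* (0≤* (0≤* 0≤c 0≤e) 0≤m) (≤⇒0≤- c≤C))
    where
    regroup : ∀ c C e d m → (1ℚ - c * e) * (d + c * m) - (d + c * (m - e * d - C * e * m)) ≡ c * e * m * (C - c)
    regroup = solve-∀ ℚ-ring

-- On the cells lo … hi - 1 the hazard rate grows at least linearly; this yields the balance
-- inequality for all loads v in [lo , hi - 10], where C / 1000 bounds τ v.
module Class (lo hi n : ℕ) (n+lo≡hi : n ℕ.+ lo ≡ hi) (hi≤36 : hi ℕ.≤ 36) (a b C : ℤ)
  (0<C : 0ℤ ℤ.< C) (C≤32000 : C ℤ.≤ + 32000) (0≤a : 0ℤ ℤ.≤ a) (0≤b : 0ℤ ℤ.≤ b)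
  (growth-ok : T (allBelow hi (growthCheck lo a b))) (step-ok : T (nonNegOn01 4 (stepPoly a b C))) where

  A B : ℚ
  A = fromℤ a
  B = fromℤ b

  slope : ℚ → ℚ
  slope u = ε * (A + B * (u - fromℕ lo))

  0≤A = fromℤ-nonNeg 0≤a
  0≤B = fromℤ-nonNeg 0≤b

  slope-mono : ∀ {u v} → u ≤ v → slope u ≤ slope v
  slope-mono u≤v = *-monoʳ-≤ 0≤ε (+-monoʳ-≤ A (*-monoʳ-≤ 0≤B (+-monoˡ-≤ (- fromℕ lo) u≤v)))

  0≤slope : ∀ {u} → fromℕ lo ≤ u → 0ℚ ≤ slope u
  0≤slope lo≤u = 0≤* 0≤ε (0≤+ 0≤A (0≤* 0≤B (≤⇒0≤- lo≤u)))

  0≤lo : 0ℚ ≤ fromℕ lo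
  0≤lo = fromℕ-nonNeg lo

  check-at : ∀ i → lo ℕ.≤ i → i ℕ.< hi → T (nonNegOn01 0 (growthPoly lo a b i))
  check-at i lo≤i i<hi with Equivalence.to T-∨ (allBelow-sound hi (growthCheck lo a b) growth-ok i i<hi)
  ... | inj₁ i<lo = ⊥-elim (ℕ.<⇒≱ (ℕ.<ᵇ⇒< i lo i<lo) lo≤i)
  ... | inj₂ ok = ok

  derivative≥ : ∀ i → lo ℕ.≤ i → i ℕ.< hi → ∀ {u} → fromℕ i ≤ u → u ≤ fromℕ (suc i) →
                slope u * ⟦ τ-poly i ⟧ (u - fromℕ i) ≤ ⟦ deriv (τ-poly i) ⟧ (u - fromℕ i)
  derivative≥ i lo≤i i<hi {u} i≤u u≤i = by-diff
    (sym (trans (regroup ε (fromℤ (+ 100000)) A B u (fromℕ lo) (fromℕ i) P′ P)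
           (trans (cong (λ t → t * P′ - slope u * P) ε*100000≡1) (cong (_- slope u * P) (*-identityˡ P′)))))
    (0≤* 0≤ε (subst (0ℚ ≤_) meaning (nonNegOn01-sound 0 (growthPoly lo a b i) (check-at i lo≤i i<hi) (≤⇒0≤- i≤u) (local-≤1 {i} u≤i))))
    where
    r = u - fromℕ i
    p = τ-poly i
    P = ⟦ p ⟧ r
    P′ = ⟦ deriv p ⟧ r
    l : Poly
    l = a ℤ.+ b ℤ.* (+ i ℤ.- + lo) ∷ b ∷ []
    l-value : ⟦ l ⟧ r ≡ A + B * (fromℕ i - fromℕ lo) + r * B
    l-value = trans (⟦linear⟧ (a ℤ.+ b ℤ.* (+ i ℤ.- + lo)) b r) (cong (_+ r * B)
      (trans (fromℤ-+ a (b ℤ.* (+ i ℤ.- + lo))) (cong (λ t → A + t)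
        (trans (fromℤ-* b (+ i ℤ.- + lo)) (cong (B *_)
          (trans (fromℤ-+ (+ i) (ℤ.- + lo)) (cong (λ t → fromℕ i + t) (fromℤ-neg (+ lo)))))))))
    meaning : ⟦ growthPoly lo a b i ⟧ r ≡ fromℤ (+ 100000) * P′ + - 1ℚ * ((A + B * (fromℕ i - fromℕ lo) + r * B) * P)
    meaning = trans (⟦⊕⟧ (+ 100000 ⊙ deriv p) (-1ℤ ⊙ (l ⊗ p)) r) (cong₂ _+_ (⟦⊙⟧ (+ 100000) (deriv p) r)
      (trans (⟦⊙⟧ -1ℤ (l ⊗ p) r) (cong₂ _*_ fromℤ-neg1 (trans (⟦⊗⟧ l p r) (cong (_* P) l-value)))))
    regroup : ∀ e k A B u o i P′ P → e * (k * P′ + - 1ℚ * ((A + B * (i - o) + (u - i) * B) * P)) ≡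
              e * k * P′ - e * (A + B * (u - o)) * P
    regroup = solve-∀ ℚ-ring

  growth : ∀ {u w} → fromℕ lo ≤ u → u ≤ w → w ≤ fromℕ hi → (w - u) * (slope u * τ u) ≤ τ w - τ u
  growth lo≤u u≤w w≤hi = chain R transitive n n+lo≡hi step end lo≤u u≤w lo≤u w≤hi
    where
    R : ℚ → ℚ → Set
    -- `chain` covers the whole half-line, so the range restrictions are put inside the relation; to
    -- the right of `hi` they leave only u = w.
    R u w = fromℕ lo ≤ u → w ≤ fromℕ hi → (w - u) * (slope u * τ u) ≤ τ w - τ u
    transitive : ∀ {u v w} → 0ℚ ≤ u → u ≤ v → v ≤ w → R u v → R v w → R u w
    transitive {u} {v} {w} 0≤u u≤v v≤w uv vw lo≤u w≤hi = by-diff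
      (regroup (τ u) (τ v) (τ w) u v w (slope u * τ u) (slope v * τ v))
      (0≤+ (0≤+ (≤⇒0≤- (uv lo≤u (≤-trans v≤w w≤hi))) (≤⇒0≤- (vw lo≤v w≤hi)))
           (0≤* (≤⇒0≤- v≤w) (≤⇒0≤- (*-mono-≤ (0≤slope lo≤u) (0≤τ (≤-trans 0≤u u≤v)) (slope-mono u≤v) (τ-mono 0≤u u≤v)))))
      where
      lo≤v = ≤-trans lo≤u u≤v
      regroup : ∀ a b c u v w X Y → (c - a) - (w - u) * X ≡
                ((b - a) - (v - u) * X) + ((c - b) - (w - v) * Y) + (w - v) * (Y - X)
      regroup = solve-∀ ℚ-ring
    step : ∀ i → lo ℕ.≤ i → i ℕ.< hi → ∀ {u w} → fromℕ i ≤ u → u ≤ w → w ≤ fromℕ (suc i) → R u w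
    step i lo≤i i<hi {u} {w} i≤u u≤w w≤i _ _ = subst₂ _≤_
      (cong (λ t → (w - u) * (slope u * t)) (sym τu))
      (sym (cong₂ _-_ (τ-cell i i<36 (≤-trans i≤u u≤w) w≤i) τu))
      (by-diff (trans (cong (λ d → unit⁻¹ * P s - unit⁻¹ * P r - d * (slope u * (unit⁻¹ * P r))) (sym (local-diff {i} u w)))
                      (regroup unit⁻¹ s r (P s) (P r) (⟦ deriv (τ-poly i) ⟧ r) (slope u)))
        (0≤* 0≤unit⁻¹ (0≤+ (≤⇒0≤- (tangent≤secant (τ-poly i) (τ-poly-nonNeg i i<36) (≤⇒0≤- i≤u) r≤s))
             (0≤* (≤⇒0≤- r≤s) (≤⇒0≤- (derivative≥ i lo≤i i<hi i≤u (≤-trans u≤w w≤i)))))))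
      where
      i<36 = ℕ.<-≤-trans i<hi hi≤36
      s = w - fromℕ i
      r = u - fromℕ i
      r≤s : r ≤ s
      r≤s = +-monoˡ-≤ (- fromℕ i) u≤w
      P = ⟦ τ-poly i ⟧
      τu = τ-cell i i<36 i≤u (≤-trans u≤w w≤i)
      regroup : ∀ k s r p q q′ l → k * p - k * q - (s - r) * (l * (k * q)) ≡
                k * ((p - q - (s - r) * q′) + (s - r) * (q′ - l * q))
      regroup = solve-∀ ℚ-ring
    end : ∀ {u w} → fromℕ hi ≤ u → u ≤ w → R u w
    end {u} {w} hi≤u u≤w _ w≤hi = subst (λ w → (w - u) * (slope u * τ u) ≤ τ w - τ u)
      (≤-antisym u≤w (≤-trans w≤hi hi≤u))
      (≤-reflexive (regroup u (slope u * τ u) (τ u)))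
      where
      regroup : ∀ u X t → (u - u) * X ≡ t - t
      regroup = solve-∀ ℚ-ring

  factor : ℚ → ℚ → ℚ
  factor δ d = 1ℚ + δ * (ε * (A + B * d))

  0≤factor : ∀ {δ d} → 0ℚ ≤ δ → 0ℚ ≤ d → 0ℚ ≤ factor δ d
  0≤factor 0≤δ 0≤d = 0≤+ 0≤1ℚ (0≤* 0≤δ (0≤* 0≤ε (0≤+ 0≤A (0≤* 0≤B 0≤d))))

  grow-step : ∀ {v d δ} → fromℕ lo ≤ v → 0ℚ ≤ d → 0ℚ ≤ δ → v + (d + δ) ≤ fromℕ hi →
              factor δ d * τ (v + d) ≤ τ (v + (d + δ))
  grow-step {v} {d} {δ} lo≤v 0≤d 0≤δ ≤hi = by-diff
    (regroup ε A B v d δ (fromℕ lo) (τ (v + d)) (τ (v + (d + δ))))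
    (0≤+ (≤⇒0≤- (growth lo≤v+d v+d≤ ≤hi))
         (0≤* 0≤δ (0≤* (0≤* 0≤ε (0≤* 0≤B (≤⇒0≤- lo≤v))) (0≤τ (≤-trans 0≤lo lo≤v+d)))))
    where
    lo≤v+d = ≤-trans lo≤v (by-diff (cancel v d) 0≤d)
      where
      cancel : ∀ v d → v + d - v ≡ d
      cancel = solve-∀ ℚ-ring
    v+d≤ : v + d ≤ v + (d + δ)
    v+d≤ = by-diff (cancel v d δ) 0≤δ
      where
      cancel : ∀ v d δ → v + (d + δ) - (v + d) ≡ δ
      cancel = solve-∀ ℚ-ring
    regroup : ∀ e A B v d δ o t t′ → t′ - (1ℚ + δ * (e * (A + B * d))) * t ≡
      (t′ - t - (v + (d + δ) - (v + d)) * (e * (A + B * (v + d - o)) * t)) + δ * (e * (B * (v - o)) * t)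
    regroup = solve-∀ ℚ-ring

  -- Four explicit Euler steps for the linear lower bound on the growth rate, with the rate read as
  -- if the walk began at `lo`, where it is smallest. This keeps the lower bound on τ (v + 4δ) / τ v
  -- polynomial in δ while it still compounds.
  gain : ℚ → ℚ
  gain δ = factor δ 0ℚ * (factor δ (0ℚ + δ) * (factor δ (0ℚ + δ + δ) * factor δ (0ℚ + δ + δ + δ)))

  grow : ∀ {v δ} → fromℕ lo ≤ v → 0ℚ ≤ δ → v + (0ℚ + δ + δ + δ + δ) ≤ fromℕ hi →
         gain δ * τ v ≤ τ (v + (0ℚ + δ + δ + δ + δ))
  grow {v} {δ} lo≤v 0≤δ ≤hi = begin
    f₀ * (f₁ * (f₂ * f₃)) * τ v       ≡⟨ regroup f₀ f₁ f₂ f₃ (τ v) ⟩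
    f₃ * (f₂ * (f₁ * (f₀ * τ v)))     ≡⟨ cong (λ t → f₃ * (f₂ * (f₁ * (f₀ * τ t)))) (sym (+-identityʳ v)) ⟩
    f₃ * (f₂ * (f₁ * (f₀ * τ (v + 0ℚ)))) ≤⟨ *-monoʳ-≤ (0≤factor 0≤δ 0≤3) (*-monoʳ-≤ (0≤factor 0≤δ 0≤2) (*-monoʳ-≤ (0≤factor 0≤δ 0≤1) (grow-step lo≤v ≤-refl 0≤δ ≤1))) ⟩
    f₃ * (f₂ * (f₁ * τ (v + (0ℚ + δ)))) ≤⟨ *-monoʳ-≤ (0≤factor 0≤δ 0≤3) (*-monoʳ-≤ (0≤factor 0≤δ 0≤2) (grow-step lo≤v 0≤1 0≤δ ≤2)) ⟩
    f₃ * (f₂ * τ (v + (0ℚ + δ + δ)))  ≤⟨ *-monoʳ-≤ (0≤factor 0≤δ 0≤3) (grow-step lo≤v 0≤2 0≤δ ≤3) ⟩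
    f₃ * τ (v + (0ℚ + δ + δ + δ))     ≤⟨ grow-step lo≤v 0≤3 0≤δ ≤hi ⟩
    τ (v + (0ℚ + δ + δ + δ + δ))      ∎
    where
    open ≤-Reasoning
    f₀ = factor δ 0ℚ
    f₁ = factor δ (0ℚ + δ)
    f₂ = factor δ (0ℚ + δ + δ)
    f₃ = factor δ (0ℚ + δ + δ + δ)
    0≤1 = 0≤+ ≤-refl 0≤δ
    0≤2 = 0≤+ 0≤1 0≤δ
    0≤3 = 0≤+ 0≤2 0≤δ
    drop : ∀ d → v + (d + δ) ≤ fromℕ hi → v + d ≤ fromℕ hi
    drop d = ≤-trans (by-diff (cancel v d δ) 0≤δ)
      where
      cancel : ∀ v d δ → v + (d + δ) - (v + d) ≡ δ
      cancel = solve-∀ ℚ-ring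
    ≤3 = drop (0ℚ + δ + δ + δ) ≤hi
    ≤2 = drop (0ℚ + δ + δ) ≤3
    ≤1 = drop (0ℚ + δ) ≤2
    regroup : ∀ a b c d t → a * (b * (c * d)) * t ≡ d * (c * (b * (a * t)))
    regroup = solve-∀ ℚ-ring

  C′ Ĉ : ℚ
  C′ = fromℤ C
  Ĉ = C′ * 1/1000

  ⟦factor⟧ : ∀ m x {d} → d ≡ fromℤ m * (5/2 * x) → ⟦ factorPoly a b m ⟧ x ≡ fromℤ (+ 400000) * factor (5/2 * x) d
  ⟦factor⟧ m x {d} d≡ = begin
    fromℤ (+ 400000) + x * ⟦ + 10 ℤ.* a ∷ + 25 ℤ.* (b ℤ.* m) ∷ [] ⟧ x
      ≡⟨ cong (λ t → fromℤ (+ 400000) + x * t) (⟦linear⟧ (+ 10 ℤ.* a) (+ 25 ℤ.* (b ℤ.* m)) x) ⟩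
    fromℤ (+ 400000) + x * (fromℤ (+ 10 ℤ.* a) + x * fromℤ (+ 25 ℤ.* (b ℤ.* m)))
      ≡⟨ cong₂ (λ s t → fromℤ (+ 400000) + x * (s + x * t))
           (trans (fromℤ-* (+ 10) a) (cong (_* A) (sym 400000*5/2*ε)))
           (trans (fromℤ-* (+ 25) (b ℤ.* m)) (cong₂ _*_ (sym 400000*5/2*5/2*ε) (fromℤ-* b m))) ⟩
    k + x * (k * 5/2 * ε * A + x * (k * 5/2 * 5/2 * ε * (B * fromℤ m)))
      ≡⟨ regroup k 5/2 ε x A B (fromℤ m) ⟩
    k * factor (5/2 * x) (fromℤ m * (5/2 * x))
      ≡⟨ cong (λ t → k * factor (5/2 * x) t) (sym d≡) ⟩
    k * factor (5/2 * x) d ∎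
    where
    open ≡-Reasoning
    k = fromℤ (+ 400000)
    regroup : ∀ k h e x A B m → k + x * (k * h * e * A + x * (k * h * h * e * (B * m))) ≡
              k * (1ℚ + h * x * (e * (A + B * (m * (h * x)))))
    regroup = solve-∀ ℚ-ring

  ⟦gain⟧ : ∀ x → ⟦ gainPoly a b ⟧ x ≡
           pow (fromℤ (+ 400000)) 4 * gain (5/2 * x)
  ⟦gain⟧ x = begin
    ⟦ p₀ ⊗ (p₁ ⊗ (p₂ ⊗ p₃)) ⟧ x
      ≡⟨ trans (⟦⊗⟧ p₀ (p₁ ⊗ (p₂ ⊗ p₃)) x) (cong (⟦ p₀ ⟧ x *_) (trans (⟦⊗⟧ p₁ (p₂ ⊗ p₃) x) (cong (⟦ p₁ ⟧ x *_) (⟦⊗⟧ p₂ p₃ x)))) ⟩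
    ⟦ p₀ ⟧ x * (⟦ p₁ ⟧ x * (⟦ p₂ ⟧ x * ⟦ p₃ ⟧ x))
      ≡⟨ cong₂ _*_ (⟦factor⟧ (+ 0) x m₀) (cong₂ _*_ (⟦factor⟧ (+ 1) x m₁) (cong₂ _*_ (⟦factor⟧ (+ 2) x m₂) (⟦factor⟧ (+ 3) x m₃))) ⟩
    k * f₀ * (k * f₁ * (k * f₂ * (k * f₃)))
      ≡⟨ trans (regroup k f₀ f₁ f₂ f₃) (cong (_* (f₀ * (f₁ * (f₂ * f₃)))) (sym (pow-4 k))) ⟩
    pow k 4 * (f₀ * (f₁ * (f₂ * f₃))) ∎
    where
    open ≡-Reasoning
    p₀ = factorPoly a b (+ 0)
    p₁ = factorPoly a b (+ 1)
    p₂ = factorPoly a b (+ 2)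
    p₃ = factorPoly a b (+ 3)
    k = fromℤ (+ 400000)
    δ = 5/2 * x
    f₀ = factor δ 0ℚ
    f₁ = factor δ (0ℚ + δ)
    f₂ = factor δ (0ℚ + δ + δ)
    f₃ = factor δ (0ℚ + δ + δ + δ)
    next : ∀ m {d} → d ≡ fromℤ m * δ → d + δ ≡ fromℤ (m ℤ.+ + 1) * δ
    next m d≡ = trans (cong (_+ δ) d≡) (trans (distrib (fromℤ m) δ) (cong (_* δ)
      (trans (cong (λ t → fromℤ m + t) (sym fromℤ-1)) (sym (fromℤ-+ m (+ 1))))))
      where
      distrib : ∀ m δ → m * δ + δ ≡ (m + 1ℚ) * δ
      distrib = solve-∀ ℚ-ring
    m₀ : 0ℚ ≡ fromℤ (+ 0) * δ
    m₀ = sym (trans (cong (_* δ) fromℤ-0) (*-zeroˡ δ))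
    m₁ = next (+ 0) m₀
    m₂ = next (+ 1) m₁
    m₃ = next (+ 2) m₂
    regroup : ∀ k a b c d → k * a * (k * b * (k * c * (k * d))) ≡ k * (k * (k * (k * 1ℚ))) * (a * (b * (c * d)))
    regroup = solve-∀ ℚ-ring

  ⟦stepPoly⟧ : ∀ x → ⟦ stepPoly a b C ⟧ x ≡
    fromℤ scale * (pow (1ℚ - Ĉ * (x * 1/32)) 32 * ((1ℚ - x) + Ĉ * (x * gain (5/2 * x))) - (1ℚ - x))
  ⟦stepPoly⟧ x = begin
    ⟦ stepPoly a b C ⟧ x
      ≡⟨ ⟦combine⟧ 32 pA pX pC (gainPoly a b) (+ 1000 ℤ.* E) scale x ⟩
    pow (⟦ pA ⟧ x) 32 * (fromℤ (+ 1000 ℤ.* E) * ⟦ pX ⟧ x + ⟦ pC ⟧ x * ⟦ gainPoly a b ⟧ x) + - K * ⟦ pX ⟧ x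
      ≡⟨ cong₂ (λ s t → s + - K * t)
           (cong₂ _*_ A-value (cong₂ _+_ (cong₂ _*_ k-value (⟦1-x⟧ x)) (cong₂ _*_ C-value (⟦gain⟧ x)))) (⟦1-x⟧ x) ⟩
    kᴺ * gᴺ * (k₁ * k₄ * (1ℚ - x) + x * C′ * (k₄ * g₄)) + - K * (1ℚ - x)
      ≡⟨ cong (λ t → kᴺ * gᴺ * (k₁ * k₄ * (1ℚ - x) + x * C′ * (k₄ * g₄)) + - t * (1ℚ - x)) K-value ⟩
    kᴺ * gᴺ * (k₁ * k₄ * (1ℚ - x) + x * C′ * (k₄ * g₄)) + - (k₁ * (kᴺ * k₄)) * (1ℚ - x)
      ≡⟨ cong (λ c → kᴺ * gᴺ * (k₁ * k₄ * (1ℚ - x) + x * c * (k₄ * g₄)) + - (k₁ * (kᴺ * k₄)) * (1ℚ - x)) C-split ⟩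
    kᴺ * gᴺ * (k₁ * k₄ * (1ℚ - x) + x * (k₁ * 1/1000 * C′) * (k₄ * g₄)) + - (k₁ * (kᴺ * k₄)) * (1ℚ - x)
      ≡⟨ regroup kᴺ gᴺ k₄ x C′ g₄ k₁ 1/1000 ⟩
    k₁ * (kᴺ * k₄) * (gᴺ * ((1ℚ - x) + Ĉ * (x * g₄)) - (1ℚ - x))
      ≡⟨ cong (_* (gᴺ * ((1ℚ - x) + Ĉ * (x * g₄)) - (1ℚ - x))) (sym K-value) ⟩
    K * (gᴺ * ((1ℚ - x) + Ĉ * (x * g₄)) - (1ℚ - x)) ∎
    where
    open ≡-Reasoning
    E = (+ 400000) ℤ.^ 4
    pA pX pC : Poly
    pA = + 32000 ∷ ℤ.- C ∷ []
    pX = 1ℤ ∷ -1ℤ ∷ []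
    pC = 0ℤ ∷ C ∷ []
    K = fromℤ scale
    k₁ = fromℤ (+ 1000)
    kᴺ = pow (fromℤ (+ 32000)) 32
    k₄ = pow (fromℤ (+ 400000)) 4
    g = 1ℚ - Ĉ * (x * 1/32)
    gᴺ = pow g 32
    g₄ = gain (5/2 * x)
    K-value : K ≡ k₁ * (kᴺ * k₄)
    K-value = trans (fromℤ-* (+ 1000) ((+ 32000) ℤ.^ 32 ℤ.* E)) (cong (k₁ *_)
      (trans (fromℤ-* ((+ 32000) ℤ.^ 32) E) (cong₂ _*_ (fromℤ-^ (+ 32000) 32) (fromℤ-^ (+ 400000) 4))))
    A-linear : ⟦ pA ⟧ x ≡ fromℤ (+ 32000) * g
    A-linear = trans (⟦linear⟧ (+ 32000) (ℤ.- C) x) (trans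
      (cong (λ c → fromℤ (+ 32000) + x * c) (fromℤ-neg C))
      (trans (cong (λ t → fromℤ (+ 32000) + x * - t)
               (trans (sym (*-identityˡ C′)) (cong (_* C′) (sym 32000*1/1000*1/32))))
             (regroup₁ (fromℤ (+ 32000)) 1/1000 1/32 x C′)))
      where
      regroup₁ : ∀ k u v x c → k + x * - (k * u * v * c) ≡ k * (1ℚ - c * u * (x * v))
      regroup₁ = solve-∀ ℚ-ring
    C-split : C′ ≡ k₁ * 1/1000 * C′
    C-split = trans (sym (*-identityˡ C′)) (cong (_* C′) (sym 1000*1/1000))
    A-value : pow (⟦ pA ⟧ x) 32 ≡ kᴺ * gᴺ
    A-value = trans (cong (λ t → pow t 32) A-linear) (pow-* (fromℤ (+ 32000)) g 32)
    k-value : fromℤ (+ 1000 ℤ.* E) ≡ k₁ * k₄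
    k-value = trans (fromℤ-* (+ 1000) E) (cong (k₁ *_) (fromℤ-^ (+ 400000) 4))
    C-value : ⟦ pC ⟧ x ≡ x * C′
    C-value = trans (⟦linear⟧ 0ℤ C x) (trans (cong (_+ x * C′) fromℤ-0) (+-identityˡ (x * C′)))
    regroup : ∀ n g k x c l t u → n * g * (t * k * (1ℚ - x) + x * (t * u * c) * (k * l)) + - (t * (n * k)) * (1ℚ - x) ≡
              t * (n * k) * (g * ((1ℚ - x) + c * u * (x * l)) - (1ℚ - x))
    regroup = solve-∀ ℚ-ring

  0≤Ĉ : 0ℚ ≤ Ĉ
  0≤Ĉ = 0≤* (fromℤ-nonNeg (ℤ.<⇒≤ 0<C)) (from-yes (0ℚ ≤? 1/1000))

  0<Ĉ : 0ℚ < Ĉ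
  0<Ĉ = subst (_< Ĉ) (*-zeroˡ 1/1000) (*-monoˡ-<-pos 1/1000 (fromℤ-pos 0<C))

  Ĉx/32≤1 : ∀ {x} → 0ℚ ≤ x → x ≤ 1ℚ → Ĉ * (x * 1/32) ≤ 1ℚ
  Ĉx/32≤1 {x} 0≤x x≤1 = begin
    Ĉ * (x * 1/32)                            ≤⟨ *-monoʳ-≤ 0≤Ĉ (*-monoˡ-≤ (from-yes (0ℚ ≤? 1/32)) x≤1) ⟩
    Ĉ * (1ℚ * 1/32)                           ≤⟨ *-monoˡ-≤ (from-yes (0ℚ ≤? 1ℚ * 1/32)) (*-monoˡ-≤ (from-yes (0ℚ ≤? 1/1000)) (fromℤ-mono C≤32000)) ⟩
    fromℤ (+ 32000) * 1/1000 * (1ℚ * 1/32)    ≡⟨ cong (fromℤ (+ 32000) * 1/1000 *_) (*-identityˡ 1/32) ⟩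
    fromℤ (+ 32000) * 1/1000 * 1/32           ≡⟨ 32000*1/1000*1/32 ⟩
    1ℚ                                        ∎
    where open ≤-Reasoning

  0≤gain : ∀ {δ} → 0ℚ ≤ δ → 0ℚ ≤ gain δ
  0≤gain {δ} 0≤δ = 0≤* (0≤factor 0≤δ ≤-refl) (0≤* (0≤factor 0≤δ 0≤1) (0≤* (0≤factor 0≤δ 0≤2) (0≤factor 0≤δ (0≤+ 0≤2 0≤δ))))
    where
    0≤1 = 0≤+ ≤-refl 0≤δ
    0≤2 = 0≤+ 0≤1 0≤δ

  -- The hypothesis on q gives q * gain * τ v ≤ 1. It therefore suffices to prove the inequality
  -- with q divided out, which `stepPoly` certifies at the upper bound for τ v and `shrink` carries
  -- down to τ v itself.
  balance : ∀ {v x q} → fromℕ lo ≤ v → v + fromℕ 10 ≤ fromℕ hi → τ v ≤ Ĉ →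
            0ℚ ≤ x → x ≤ 1ℚ → 0ℚ ≤ q → q * τ (v + fromℕ 10 * x) ≤ 1ℚ →
            (1ℚ - x) * q ≤ pow (1ℚ - τ v * (x * 1/32)) 32 * (x + (1ℚ - x) * q)
  balance {v} {x} {q} lo≤v v≤hi τv≤Ĉ 0≤x x≤1 0≤q qτ≤1 = begin
    (1ℚ - x) * q                                ≤⟨ *-monoˡ-≤ 0≤q shrunk ⟩
    P * ((1ℚ - x) + τ v * (x * g)) * q          ≡⟨ regroup P x (τ v) g q ⟩
    P * (x * (q * (g * τ v)) + (1ℚ - x) * q)    ≤⟨ *-monoʳ-≤ 0≤P (+-monoˡ-≤ ((1ℚ - x) * q) (*-monoʳ-≤ 0≤x q*growth≤1)) ⟩
    P * (x * 1ℚ + (1ℚ - x) * q)                 ≡⟨ cong (λ t → P * (t + (1ℚ - x) * q)) (*-identityʳ x) ⟩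
    P * (x + (1ℚ - x) * q)                      ∎
    where
    open ≤-Reasoning
    δ = 5/2 * x
    g = gain δ
    e = x * 1/32
    0≤1/32 = from-yes (0ℚ ≤? 1/32)
    0≤δ = 0≤* (from-yes (0ℚ ≤? 5/2)) 0≤x
    0≤e = 0≤* 0≤x 0≤1/32
    0≤v = ≤-trans 0≤lo lo≤v
    P = pow (1ℚ - τ v * e) 32
    0≤P = 0≤pow 32 (≤⇒0≤- (≤-trans (*-monoˡ-≤ 0≤e τv≤Ĉ) (Ĉx/32≤1 0≤x x≤1)))
    checked : (1ℚ - x) ≤ pow (1ℚ - Ĉ * e) 32 * ((1ℚ - x) + Ĉ * (x * g))
    checked = 0≤-⇒≤ (*-cancelˡ-≤ (fromℤ-pos {scale} (from-yes (0ℤ ℤ.<? scale)))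
      (subst₂ _≤_ (sym (*-zeroʳ (fromℤ scale))) (⟦stepPoly⟧ x) (nonNegOn01-sound 4 (stepPoly a b C) step-ok 0≤x x≤1)))
    shrunk : (1ℚ - x) ≤ P * ((1ℚ - x) + τ v * (x * g))
    shrunk = shrink 32 (0≤τ 0≤v) τv≤Ĉ 0<Ĉ 0≤e (Ĉx/32≤1 0≤x x≤1) (≤⇒0≤- x≤1) (0≤* 0≤x (0≤gain 0≤δ)) checked
    4δ≡10x : 0ℚ + δ + δ + δ + δ ≡ fromℕ 10 * x
    4δ≡10x = trans (collect 5/2 x) (cong (_* x) 5/2+5/2+5/2+5/2≡10)
      where
      collect : ∀ h x → 0ℚ + h * x + h * x + h * x + h * x ≡ (0ℚ + h + h + h + h) * x
      collect = solve-∀ ℚ-ring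
    v+10x≤ : v + fromℕ 10 * x ≤ fromℕ hi
    v+10x≤ = ≤-trans (+-monoʳ-≤ v (subst (fromℕ 10 * x ≤_) (*-identityʳ (fromℕ 10)) (*-monoʳ-≤ (fromℕ-nonNeg 10) x≤1))) v≤hi
    q*growth≤1 : q * (g * τ v) ≤ 1ℚ
    q*growth≤1 = ≤-trans (*-monoʳ-≤ 0≤q (subst (λ t → g * τ v ≤ τ (v + t)) 4δ≡10x
      (grow lo≤v 0≤δ (subst (λ t → v + t ≤ fromℕ hi) (sym 4δ≡10x) v+10x≤)))) qτ≤1
    regroup : ∀ P x t g q → P * ((1ℚ - x) + t * (x * g)) * q ≡ P * (x * (q * (g * t)) + (1ℚ - x) * q)
    regroup = solve-∀ ℚ-ring

-- Certified instances of the balance inequality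

opaque
  unfolding combine

  step-ok₁ : T (nonNegOn01 4 (stepPoly (+ 9990) (+ 0) (+ 3392)))
  step-ok₁ = tt

  step-ok₂ : T (nonNegOn01 4 (stepPoly (+ 12200) (+ 1220) (+ 3857)))
  step-ok₂ = tt

  step-ok₃ : T (nonNegOn01 4 (stepPoly (+ 13480) (+ 1348) (+ 4446)))
  step-ok₃ = tt

opaque
  unfolding fromℤ τ

  12+10≤22 : fromℕ 12 + fromℕ 10 ≤ fromℕ 22
  12+10≤22 = ≤-refl

  13+10≤23 : fromℕ 13 + fromℕ 10 ≤ fromℕ 23
  13+10≤23 = ≤-refl

  14+10≤24 : fromℕ 14 + fromℕ 10 ≤ fromℕ 24
  14+10≤24 = ≤-refl

  32*1/32≡1 : fromℕ 32 * 1/32 ≡ 1ℚ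
  32*1/32≡1 = refl

  τ12≤ : τ (fromℕ 12) ≤ fromℤ (+ 3392) * 1/1000
  τ12≤ = from-yes (τ (fromℕ 12) ≤? fromℤ (+ 3392) * 1/1000)

  τ13≤ : τ (fromℕ 13) ≤ fromℤ (+ 3857) * 1/1000
  τ13≤ = from-yes (τ (fromℕ 13) ≤? fromℤ (+ 3857) * 1/1000)

  τ14≤ : τ (fromℕ 14) ≤ fromℤ (+ 4446) * 1/1000
  τ14≤ = from-yes (τ (fromℕ 14) ≤? fromℤ (+ 4446) * 1/1000)

-- The ranges [0 , 12], [12 , 13], [13 , 14] of v: the hazard rate is bounded below from its
-- value at the left end, τ from above by its value at the right end.
module Class₁ = Class 0 22 22 refl (ℕ.m≤m+n 22 14) (+ 9990) (+ 0) (+ 3392)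
  (from-yes (0ℤ ℤ.<? + 3392)) (from-yes (+ 3392 ℤ.≤? + 32000)) (ℤ.+≤+ z≤n) (ℤ.+≤+ z≤n) tt step-ok₁
module Class₂ = Class 12 23 11 refl (ℕ.m≤m+n 23 13) (+ 12200) (+ 1220) (+ 3857)
  (from-yes (0ℤ ℤ.<? + 3857)) (from-yes (+ 3857 ℤ.≤? + 32000)) (ℤ.+≤+ z≤n) (ℤ.+≤+ z≤n) tt step-ok₂
module Class₃ = Class 13 24 11 refl (ℕ.m≤m+n 24 12) (+ 13480) (+ 1348) (+ 4446)
  (from-yes (0ℤ ℤ.<? + 4446)) (from-yes (+ 4446 ℤ.≤? + 32000)) (ℤ.+≤+ z≤n) (ℤ.+≤+ z≤n) tt step-ok₃

bernoulli : ∀ n {e} → 0ℚ ≤ e → e ≤ 1ℚ → 1ℚ - fromℕ n * e ≤ pow (1ℚ - e) n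
bernoulli zero {e} _ _ = ≤-reflexive (trans (cong (λ t → 1ℚ - t * e) fromℤ-0) (trans (simplify e) (sym (pow-zero (1ℚ - e)))))
  where
  simplify : ∀ e → 1ℚ - 0ℚ * e ≡ 1ℚ
  simplify = solve-∀ ℚ-ring
bernoulli (suc n) {e} 0≤e e≤1 = subst (1ℚ - fromℕ (suc n) * e ≤_) (sym (pow-suc (1ℚ - e) n)) (begin
  1ℚ - fromℕ (suc n) * e             ≡⟨ cong (λ t → 1ℚ - t * e) (fromℕ-suc n) ⟩
  1ℚ - (1ℚ + fromℕ n) * e            ≤⟨ by-diff (regroup (fromℕ n) e) (0≤* (0≤* (fromℕ-nonNeg n) 0≤e) 0≤e) ⟩
  (1ℚ - e) * (1ℚ - fromℕ n * e)      ≤⟨ *-monoʳ-≤ (≤⇒0≤- e≤1) (bernoulli n 0≤e e≤1) ⟩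
  (1ℚ - e) * pow (1ℚ - e) n          ∎)
  where
  open ≤-Reasoning
  regroup : ∀ n e → (1ℚ - e) * (1ℚ - n * e) - (1ℚ - (1ℚ + n) * e) ≡ n * e * e
  regroup = solve-∀ ℚ-ring

balance-late : ∀ {v x q} → 0ℚ ≤ v → v ≤ fromℕ 14 → 0ℚ ≤ x → x ≤ 1ℚ → 0ℚ ≤ q → q * τ (v + fromℕ 10 * x) ≤ 1ℚ →
               (1ℚ - x) * q ≤ pow (1ℚ - τ v * (x * 1/32)) 32 * (x + (1ℚ - x) * q)
balance-late {v} {x} {q} 0≤v v≤14 0≤x x≤1 0≤q qτ≤1 = by-cases (≤-total v (fromℕ 12)) (≤-total v (fromℕ 13))
  where
  Goal = (1ℚ - x) * q ≤ pow (1ℚ - τ v * (x * 1/32)) 32 * (x + (1ℚ - x) * q)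
  shift : ∀ {m n} → fromℕ m + fromℕ 10 ≤ fromℕ n → v ≤ fromℕ m → v + fromℕ 10 ≤ fromℕ n
  shift m+10≤n v≤m = ≤-trans (+-monoˡ-≤ (fromℕ 10) v≤m) m+10≤n
  by-cases : _ → _ → Goal
  by-cases (inj₁ v≤12) _ = Class₁.balance (subst (_≤ v) (sym fromℤ-0) 0≤v) (shift {12} {22} 12+10≤22 v≤12)
    (≤-trans (τ-mono 0≤v v≤12) τ12≤) 0≤x x≤1 0≤q qτ≤1
  by-cases (inj₂ 12≤v) (inj₁ v≤13) = Class₂.balance 12≤v (shift {13} {23} 13+10≤23 v≤13)
    (≤-trans (τ-mono 0≤v v≤13) τ13≤) 0≤x x≤1 0≤q qτ≤1
  by-cases (inj₂ _) (inj₂ 13≤v) = Class₃.balance 13≤v (shift {14} {24} 14+10≤24 v≤14)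
    (≤-trans (τ-mono 0≤v v≤14) τ14≤) 0≤x x≤1 0≤q qτ≤1

-- At rate 1, Bernoulli's inequality bounds 1 - x by the damping factor, and q ≤ x + (1 - x) q holds
-- because q ≤ 1; no growth of τ enters.
balance-early : ∀ {x q} → 0ℚ ≤ x → x ≤ 1ℚ → 0ℚ ≤ q → q ≤ 1ℚ →
                (1ℚ - x) * q ≤ pow (1ℚ - 1ℚ * (x * 1/32)) 32 * (x + (1ℚ - x) * q)
balance-early {x} {q} 0≤x x≤1 0≤q q≤1 = begin
  (1ℚ - x) * q                                      ≡⟨ cong (λ t → (1ℚ - t) * q) (sym 32e≡x) ⟩
  (1ℚ - fromℕ 32 * (x * 1/32)) * q                  ≤⟨ *-monoˡ-≤ 0≤q (bernoulli 32 0≤e e≤1) ⟩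
  pow (1ℚ - x * 1/32) 32 * q                        ≤⟨ *-monoʳ-≤ (0≤pow 32 (≤⇒0≤- e≤1)) (by-diff (regroup x q) (0≤* 0≤x (≤⇒0≤- q≤1))) ⟩
  pow (1ℚ - x * 1/32) 32 * (x + (1ℚ - x) * q)       ≡⟨ cong (λ t → pow (1ℚ - t) 32 * (x + (1ℚ - x) * q)) (sym (*-identityˡ (x * 1/32))) ⟩
  pow (1ℚ - 1ℚ * (x * 1/32)) 32 * (x + (1ℚ - x) * q) ∎
  where
  open ≤-Reasoning
  0≤1/32 = from-yes (0ℚ ≤? 1/32)
  0≤e = 0≤* 0≤x 0≤1/32
  e≤1 = ≤-trans (*-monoˡ-≤ 0≤1/32 x≤1) (from-yes (1ℚ * 1/32 ≤? 1ℚ))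
  32e≡x : fromℕ 32 * (x * 1/32) ≡ x
  32e≡x = trans (swap (fromℕ 32) x 1/32) (trans (cong (x *_) 32*1/32≡1) (*-identityʳ x))
    where
    swap : ∀ a x b → a * (x * b) ≡ x * (a * b)
    swap = solve-∀ ℚ-ring
  regroup : ∀ x q → x + (1ℚ - x) * q - q ≡ x * (1ℚ - q)
  regroup = solve-∀ ℚ-ring

rate-balance : ∀ {z x q} → 0ℚ ≤ x → x ≤ 1ℚ → 0ℚ ≤ q → q ≤ 1ℚ →
               (0ℚ ≤ z - fromℕ 10 + fromℕ 10 * x → q * τ (z - fromℕ 10 + fromℕ 10 * x) ≤ 1ℚ) →
               (1ℚ - x) * q ≤ pow (1ℚ - rate z * (x * 1/32)) 32 * (x + (1ℚ - x) * q)
rate-balance {z} {x} {q} 0≤x x≤1 0≤q q≤1 qτ≤1 = by-cases (≤-total z (fromℕ 10))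
  where
  0≤10x = 0≤* (fromℕ-nonNeg 10) 0≤x
  by-cases : _ → (1ℚ - x) * q ≤ pow (1ℚ - rate z * (x * 1/32)) 32 * (x + (1ℚ - x) * q)
  by-cases (inj₁ z≤10) = subst (λ r → (1ℚ - x) * q ≤ pow (1ℚ - r * (x * 1/32)) 32 * (x + (1ℚ - x) * q))
    (sym (trans (cong τ (delay-early z≤10)) τ0≡1)) (balance-early 0≤x x≤1 0≤q q≤1)
  -- The delayed load is at most z - 10, so by monotonicity of τ the assumption on q at z - 10 + 10x
  -- implies the one required at the capped point.
  by-cases (inj₂ 10≤z) = balance-late (0≤delay z) (p⊓q≤q (z - fromℕ 10 ⊔ 0ℚ) (fromℕ 14)) 0≤x x≤1 0≤q
    (≤-trans (*-monoʳ-≤ 0≤q (τ-mono (0≤+ (0≤delay z) 0≤10x) (+-monoˡ-≤ (fromℕ 10 * x) delay≤)))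
             (qτ≤1 (0≤+ (≤⇒0≤- 10≤z) 0≤10x)))
    where
    delay≤ : delay z ≤ z - fromℕ 10
    delay≤ = ≤-trans (p⊓q≤p (z - fromℕ 10 ⊔ 0ℚ) (fromℕ 14)) (≤-reflexive (p≥q⇒p⊔q≡p (≤⇒0≤- 10≤z)))

rate≤32 : ∀ z → rate z * 1/32 ≤ 1ℚ
rate≤32 z = ≤-trans (*-monoˡ-≤ (from-yes (0ℚ ≤? 1/32)) (≤-trans (τ-mono (0≤delay z) (p⊓q≤q (z - fromℕ 10 ⊔ 0ℚ) (fromℕ 14))) τ14≤))
  (subst (_≤ 1ℚ) (cong (Class₃.Ĉ *_) (*-identityˡ 1/32)) (Class₃.Ĉx/32≤1 0≤1ℚ ≤-refl))

-- The survival bound φ as a function of the load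

10ℚ : ℚ
10ℚ = fromℕ 10

0≤10ℚ : 0ℚ ≤ 10ℚ
0≤10ℚ = fromℕ-nonNeg 10

opaque
  unfolding fromℤ

  1/10*10≡1 : 1/10 * 10ℚ ≡ 1ℚ
  1/10*10≡1 = refl

-- Clamping the load at 0 keeps the value at least 1, so its reciprocal φ is defined at every
-- rational.
τ-at : ℚ → ℚ
τ-at y = τ (10ℚ * (y ⊔ 0ℚ))

τ-at-positive : ∀ y → Positive (τ-at y)
τ-at-positive y = positive (<-≤-trans (positive⁻¹ 1ℚ) (1≤τ (0≤* 0≤10ℚ (p≤q⊔p y 0ℚ))))

opaque
  -- The bound on the probability that an offline vertex of load y is still unmatched.
  φ : ℚ → ℚ
  φ y = 1/_ (τ-at y) {{pos⇒nonZero (τ-at y) {{τ-at-positive y}}}}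

  τ*φ≡1 : ∀ {y} → 0ℚ ≤ y → τ (10ℚ * y) * φ y ≡ 1ℚ
  τ*φ≡1 {y} 0≤y = trans (cong (λ t → τ (10ℚ * t) * φ y) (sym (p≥q⇒p⊔q≡p 0≤y)))
    (*-inverseʳ (τ-at y) {{pos⇒nonZero (τ-at y) {{τ-at-positive y}}}})

  0≤φ : ∀ y → 0ℚ ≤ φ y
  0≤φ y = nonNegative⁻¹ (φ y) {{pos⇒nonNeg (φ y) {{1/pos⇒pos (τ-at y) {{τ-at-positive y}}}}}}

1≤τ10 : ∀ {y} → 0ℚ ≤ y → 1ℚ ≤ τ (10ℚ * y)
1≤τ10 0≤y = 1≤τ (0≤* 0≤10ℚ 0≤y)

φ≤1 : ∀ {y} → 0ℚ ≤ y → φ y ≤ 1ℚ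
φ≤1 {y} 0≤y = subst₂ _≤_ (*-identityˡ (φ y)) (τ*φ≡1 0≤y) (*-monoˡ-≤ (0≤φ y) (1≤τ10 0≤y))

φ-antitone : ∀ {u w} → 0ℚ ≤ u → u ≤ w → φ w ≤ φ u
φ-antitone {u} {w} 0≤u u≤w = subst₂ _≤_
  (trans (regroup (τ (10ℚ * u)) (φ u) (φ w)) (trans (cong (_* φ w) (τ*φ≡1 0≤u)) (*-identityˡ (φ w))))
  (trans (cong (φ u *_) (τ*φ≡1 (≤-trans 0≤u u≤w))) (*-identityʳ (φ u)))
  (*-monoʳ-≤ (0≤φ u) (*-monoˡ-≤ (0≤φ w) (τ-mono (0≤* 0≤10ℚ 0≤u) (*-monoʳ-≤ 0≤10ℚ u≤w))))
  where
  regroup : ∀ t p q → p * (t * q) ≡ t * p * q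
  regroup = solve-∀ ℚ-ring

rate-at : ℚ → ℚ
rate-at y = rate (10ℚ * y)

-- `τ-hazard` multiplied by φ u φ w. Evaluating the rate at a common v ≥ w, which only enlarges it,
-- gives all neighbours raised to the same threshold one decay rate.
φ-decay : ∀ {u w v} → 0ℚ ≤ u → u ≤ w → w ≤ v → φ u * (1ℚ - rate-at v * (w - u)) ≤ φ w
φ-decay {u} {w} {v} 0≤u u≤w w≤v = by-diff identity
  (0≤+ (0≤* (0≤* (0≤φ u) (0≤φ w)) (≤⇒0≤- hazard))
       (0≤* (0≤* (≤⇒0≤- (rate-mono (*-monoʳ-≤ 0≤10ℚ w≤v))) (0≤φ u)) (≤⇒0≤- u≤w)))
  where
  U = τ (10ℚ * u)
  W = τ (10ℚ * w)
  r = rate-at w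
  hazard : W - U ≤ (10ℚ * w - 10ℚ * u) * (1/10 * (r * W))
  hazard = τ-hazard (0≤* 0≤10ℚ 0≤u) (*-monoʳ-≤ 0≤10ℚ u≤w)
  regroup : ∀ p q U W k l r w u → p * q * ((k * w - k * u) * (l * (r * W)) - (W - U)) ≡
            (W * q) * (p * ((l * k) * (r * (w - u)))) - (W * q) * p + (U * p) * q
  regroup = solve-∀ ℚ-ring
  collect : ∀ p q r s d → q - p * (1ℚ - s * d) ≡ 1ℚ * (p * (1ℚ * (r * d))) - 1ℚ * p + 1ℚ * q + (s - r) * p * d
  collect = solve-∀ ℚ-ring
  identity : φ w - φ u * (1ℚ - rate-at v * (w - u)) ≡
             φ u * φ w * ((10ℚ * w - 10ℚ * u) * (1/10 * (r * W)) - (W - U)) + (rate-at v - r) * φ u * (w - u)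
  identity = trans (collect (φ u) (φ w) r (rate-at v) (w - u))
    (cong (_+ (rate-at v - r) * φ u * (w - u)) (sym (trans (regroup (φ u) (φ w) U W 10ℚ 1/10 r w u)
      (trans (cong₂ (λ a b → a * (φ u * ((1/10 * 10ℚ) * (r * (w - u)))) - a * φ u + b * φ w) (τ*φ≡1 (≤-trans 0≤u u≤w)) (τ*φ≡1 0≤u))
             (cong (λ k → 1ℚ * (φ u * (k * (r * (w - u)))) - 1ℚ * φ u + 1ℚ * φ w) 1/10*10≡1)))))

φ-decay-pow : ∀ n {u e v} → 0ℚ ≤ u → 0ℚ ≤ e → rate-at v * e ≤ 1ℚ → u + fromℕ n * e ≤ v →
              φ u * pow (1ℚ - rate-at v * e) n ≤ φ (u + fromℕ n * e)
φ-decay-pow zero {u} {e} {v} 0≤u 0≤e re≤1 ≤v = ≤-reflexive (trans (cong (φ u *_) (pow-zero (1ℚ - rate-at v * e)))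
  (trans (*-identityʳ (φ u)) (cong φ (trans (simplify u e) (cong (λ k → u + k * e) (sym fromℤ-0))))))
  where
  simplify : ∀ u e → u ≡ u + 0ℚ * e
  simplify = solve-∀ ℚ-ring
φ-decay-pow (suc n) {u} {e} {v} 0≤u 0≤e re≤1 ≤v = begin
  φ u * pow s (suc n)       ≡⟨ cong (φ u *_) (pow-suc s n) ⟩
  φ u * (s * pow s n)       ≡⟨ swap (φ u) s (pow s n) ⟩
  φ u * pow s n * s         ≤⟨ *-monoˡ-≤ (≤⇒0≤- re≤1) (φ-decay-pow n 0≤u 0≤e re≤1 (≤-trans uₙ≤ ≤v)) ⟩
  φ uₙ * s                  ≡⟨ cong (λ d → φ uₙ * (1ℚ - rate-at v * d)) (sym gap) ⟩
  φ uₙ * (1ℚ - rate-at v * (uₙ₊₁ - uₙ)) ≤⟨ φ-decay 0≤uₙ uₙ≤ ≤v ⟩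
  φ uₙ₊₁                    ∎
  where
  open ≤-Reasoning
  s = 1ℚ - rate-at v * e
  uₙ = u + fromℕ n * e
  uₙ₊₁ = u + fromℕ (suc n) * e
  gap : uₙ₊₁ - uₙ ≡ e
  gap = trans (cong (λ k → u + k * e - uₙ) (fromℕ-suc n)) (cancel u (fromℕ n) e)
    where
    cancel : ∀ u n e → u + (1ℚ + n) * e - (u + n * e) ≡ e
    cancel = solve-∀ ℚ-ring
  uₙ≤ : uₙ ≤ uₙ₊₁
  uₙ≤ = by-diff gap 0≤e
  0≤uₙ = 0≤+ 0≤u (0≤* (fromℕ-nonNeg n) 0≤e)
  swap : ∀ p s q → p * (s * q) ≡ p * q * s
  swap = solve-∀ ℚ-ring

-- A rational stand-in for exp(-rate · x), lying below it when the base is nonnegative. It must be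
-- small enough that φ falls by no stronger factor while the load rises by x, and large enough for
-- the balance inequality.
damping : ℚ → ℚ → ℚ
damping v x = pow (1ℚ - rate-at v * (x * 1/32)) 32

rate-at*≤1 : ∀ v {x} → 0ℚ ≤ x → x ≤ 1ℚ → rate-at v * (x * 1/32) ≤ 1ℚ
rate-at*≤1 v {x} 0≤x x≤1 = ≤-trans
  (*-monoʳ-≤ (0≤rate (10ℚ * v)) (*-monoˡ-≤ (from-yes (0ℚ ≤? 1/32)) x≤1))
  (subst (λ t → rate-at v * t ≤ 1ℚ) (sym (*-identityˡ 1/32)) (rate≤32 (10ℚ * v)))

0≤damping : ∀ v {x} → 0ℚ ≤ x → x ≤ 1ℚ → 0ℚ ≤ damping v x
0≤damping v 0≤x x≤1 = 0≤pow 32 (≤⇒0≤- (rate-at*≤1 v 0≤x x≤1))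

damping≤1 : ∀ v {x} → 0ℚ ≤ x → x ≤ 1ℚ → damping v x ≤ 1ℚ
damping≤1 v {x} 0≤x x≤1 = pow≤1 32 (≤⇒0≤- (rate-at*≤1 v 0≤x x≤1))
  (by-diff (one-minus (rate-at v * (x * 1/32))) (0≤* (0≤rate (10ℚ * v)) (0≤* 0≤x (from-yes (0ℚ ≤? 1/32)))))
  where
  one-minus : ∀ z → 1ℚ - (1ℚ - z) ≡ z
  one-minus = solve-∀ ℚ-ring

φ-damping : ∀ {u x v} → 0ℚ ≤ u → 0ℚ ≤ x → x ≤ 1ℚ → u + x ≤ v → φ u * damping v x ≤ φ (u + x)
φ-damping {u} {x} {v} 0≤u 0≤x x≤1 u+x≤v = subst (λ t → φ u * damping v x ≤ φ (u + t)) 32e≡x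
  (φ-decay-pow 32 0≤u (0≤* 0≤x (from-yes (0ℚ ≤? 1/32))) (rate-at*≤1 v 0≤x x≤1) (subst (λ t → u + t ≤ v) (sym 32e≡x) u+x≤v))
  where
  32e≡x : fromℕ 32 * (x * 1/32) ≡ x
  32e≡x = trans (swap (fromℕ 32) x 1/32) (trans (cong (x *_) 32*1/32≡1) (*-identityʳ x))
    where
    swap : ∀ a x b → a * (x * b) ≡ x * (a * b)
    swap = solve-∀ ℚ-ring

-- The exponential would give equality; here (1 - a)(1 - b) ≥ 1 - a - b inside the power gives the
-- direction needed to compare the total mass in U with the product over its vertices.
damping-mul : ∀ v {x y} → 0ℚ ≤ x → 0ℚ ≤ y → x + y ≤ 1ℚ → damping v (x + y) ≤ damping v x * damping v y
damping-mul v {x} {y} 0≤x 0≤y x+y≤1 = subst (damping v (x + y) ≤_) (pow-* a b 32)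
  (pow-mono 32 (≤⇒0≤- (rate-at*≤1 v (0≤+ 0≤x 0≤y) x+y≤1))
    (by-diff (regroup (rate-at v) x y 1/32) (0≤* (0≤* r (0≤* 0≤x 0≤1/32)) (0≤* r (0≤* 0≤y 0≤1/32)))))
  where
  0≤1/32 = from-yes (0ℚ ≤? 1/32)
  r = 0≤rate (10ℚ * v)
  a = 1ℚ - rate-at v * (x * 1/32)
  b = 1ℚ - rate-at v * (y * 1/32)
  regroup : ∀ r x y e → (1ℚ - r * (x * e)) * (1ℚ - r * (y * e)) - (1ℚ - r * ((x + y) * e)) ≡ r * (x * e) * (r * (y * e))
  regroup = solve-∀ ℚ-ring
  pow-mono : ∀ n {a b} → 0ℚ ≤ a → a ≤ b → pow a n ≤ pow b n
  pow-mono zero {a} {b} _ _ = ≤-reflexive (trans (pow-zero a) (sym (pow-zero b)))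
  pow-mono (suc n) {a} {b} 0≤a a≤b = subst₂ _≤_ (sym (pow-suc a n)) (sym (pow-suc b n))
    (*-mono-≤ 0≤a (0≤pow n (≤-trans 0≤a a≤b)) a≤b (pow-mono n 0≤a a≤b))

-- x is the mass on the still unmatched set under consideration; the rest of the mass
-- can sit no lower than load v - 1 + x.
damping-balance : ∀ {v x} → 0ℚ ≤ x → x ≤ 1ℚ → let q = φ ((v - 1ℚ + x) ⊔ 0ℚ) in
                  (1ℚ - x) * q ≤ damping v x * (x + (1ℚ - x) * q)
damping-balance {v} {x} 0≤x x≤1 = rate-balance {10ℚ * v} 0≤x x≤1 (0≤φ y⁺) (φ≤1 0≤y⁺) λ 0≤10y →
  ≤-reflexive (trans (cong (λ t → φ y⁺ * τ t) (trans regroup (cong (10ℚ *_) (sym (p≥q⇒p⊔q≡p (0≤y 0≤10y))))))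
    (trans (*-comm (φ y⁺) (τ (10ℚ * y⁺))) (τ*φ≡1 0≤y⁺)))
  where
  y = v - 1ℚ + x
  y⁺ = y ⊔ 0ℚ
  0≤y⁺ = p≤q⊔p y 0ℚ
  regroup : 10ℚ * v - 10ℚ + 10ℚ * x ≡ 10ℚ * y
  regroup = factor 10ℚ v x
    where
    factor : ∀ k v x → k * v - k + k * x ≡ k * (v - 1ℚ + x)
    factor = solve-∀ ℚ-ring
  0≤y : 0ℚ ≤ 10ℚ * v - 10ℚ + 10ℚ * x → 0ℚ ≤ y
  0≤y 0≤10y = *-cancelˡ-≤ (fromℤ-pos {+ 10} (from-yes (0ℤ ℤ.<? + 10)))
    (subst₂ _≤_ (sym (*-zeroʳ 10ℚ)) regroup 0≤10y)

damping-0 : ∀ v → damping v 0ℚ ≡ 1ℚ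
damping-0 v = trans (cong (λ s → pow s 32) (simplify (rate-at v) 1/32)) (pow-1 32)
  where
  simplify : ∀ r e → 1ℚ - r * (0ℚ * e) ≡ 1ℚ
  simplify = solve-∀ ℚ-ring
  pow-1 : ∀ n → pow 1ℚ n ≡ 1ℚ
  pow-1 zero = pow-zero 1ℚ
  pow-1 (suc n) = trans (pow-suc 1ℚ n) (trans (*-identityˡ (pow 1ℚ n)) (pow-1 n))

-- The dual certificate

dual-poly : ℕ → Poly
dual-poly = cell dualCells

-- The argument is reversed because the dual cells use the distance to the right end. The derivative
-- in that distance is minus the derivative in the cell coordinate, so `b-local` is minus the
-- derivative of `Ψ-local` in the load, the factor 10 converting cells to loads.
Ψ-local b-local : Poly → ℚ → ℚ
Ψ-local q s = unit⁻¹ * ⟦ q ⟧ (1ℚ - s)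
b-local q s = unit⁻¹ * (10ℚ * ⟦ deriv q ⟧ (1ℚ - s))

-- The constant term of the last dual cell. Its linear term is 0, so b reaches 0 continuously at
-- load 3.6; on the tail the constant Ψ alone must dominate 1 / `τ-end`.
Ψ-end : ℚ
Ψ-end = unit⁻¹ * fromℤ (+ 8117)

opaque
  Ψ b : ℚ → ℚ
  Ψ = glue Ψ-local Ψ-end dualCells
  b = glue b-local 0ℚ dualCells

opaque
  unfolding fromℤ Ψ b

  Ψ-cell : ∀ i → i ℕ.< 36 → ∀ {z} → fromℕ i ≤ z → z ≤ fromℕ (suc i) → Ψ z ≡ Ψ-local (dual-poly i) (z - fromℕ i)
  Ψ-cell = glue-cell Ψ-local Ψ-end dualCells (from-yes (continuous? Ψ-local Ψ-end dualCells))

  Ψ-tail : ∀ {z} → fromℕ 36 ≤ z → Ψ z ≡ Ψ-end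
  Ψ-tail = glue-end Ψ-local Ψ-end dualCells (from-yes (continuous? Ψ-local Ψ-end dualCells))

  b-cell : ∀ i → i ℕ.< 36 → ∀ {z} → fromℕ i ≤ z → z ≤ fromℕ (suc i) → b z ≡ b-local (dual-poly i) (z - fromℕ i)
  b-cell = glue-cell b-local 0ℚ dualCells (from-yes (continuous? b-local 0ℚ dualCells))

  b-tail : ∀ {z} → fromℕ 36 ≤ z → b z ≡ 0ℚ
  b-tail = glue-end b-local 0ℚ dualCells (from-yes (continuous? b-local 0ℚ dualCells))

  b0+Ψ0≡1 : b 0ℚ + Ψ 0ℚ ≡ 1ℚ
  b0+Ψ0≡1 = refl

  513≤b0 : + 513 / 1000 ≤ b 0ℚ
  513≤b0 = from-yes (+ 513 / 1000 ≤? b 0ℚ)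

  tail-check : 1ℚ ≤ τ-end * (0ℚ + Ψ-end)
  tail-check = from-yes (1ℚ ≤? τ-end * (0ℚ + Ψ-end))

  unit⁻²*unit² : unit⁻¹ * unit⁻¹ * fromℤ (unit ℤ.* unit) ≡ 1ℚ
  unit⁻²*unit² = refl

dual-poly-nonNeg : ∀ i → i ℕ.< 36 → T (nonNegCoeffs (dual-poly i))
dual-poly-nonNeg = allBelow-sound 36 (λ i → nonNegCoeffs (dual-poly i)) tt

deriv-poly-nonNeg : ∀ i → i ℕ.< 36 → T (nonNegCoeffs (deriv (dual-poly i)))
deriv-poly-nonNeg = allBelow-sound 36 (λ i → nonNegCoeffs (deriv (dual-poly i))) tt

module _ {i : ℕ} where

  reverse-nonNeg : ∀ {z} → z ≤ fromℕ (suc i) → 0ℚ ≤ 1ℚ - (z - fromℕ i)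
  reverse-nonNeg z≤ = ≤⇒0≤- (local-≤1 {i} z≤)

  reverse-antitone : ∀ {u w} → u ≤ w → 1ℚ - (w - fromℕ i) ≤ 1ℚ - (u - fromℕ i)
  reverse-antitone u≤w = +-monoʳ-≤ 1ℚ (neg-antimono-≤ (+-monoˡ-≤ (- fromℕ i) u≤w))

b-antitone : ∀ {u w} → 0ℚ ≤ u → u ≤ w → b w ≤ b u
b-antitone = chain₀ (λ u w → b w ≤ b u) (λ _ _ _ vu wv → ≤-trans wv vu) 36
  (λ i i<36 i≤u u≤w w≤i → subst₂ _≤_
    (sym (b-cell i i<36 (≤-trans i≤u u≤w) w≤i)) (sym (b-cell i i<36 i≤u (≤-trans u≤w w≤i)))
    (*-monoʳ-≤ 0≤unit⁻¹ (*-monoʳ-≤ 0≤10ℚ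
      (⟦⟧-mono (deriv (dual-poly i)) (deriv-poly-nonNeg i i<36) (reverse-nonNeg {i} w≤i) (reverse-antitone {i} u≤w)))))
  (λ 36≤u u≤w → ≤-reflexive (trans (b-tail (≤-trans 36≤u u≤w)) (sym (b-tail 36≤u))))

0≤b : ∀ {z} → 0ℚ ≤ z → 0ℚ ≤ b z
0≤b {z} 0≤z = ≤-trans (≤-reflexive (sym (b-tail 36≤m))) (b-antitone 0≤z (p≤p⊔q z (fromℕ 36)))
  where
  36≤m : fromℕ 36 ≤ z ⊔ fromℕ 36
  36≤m = p≤q⊔p z (fromℕ 36)

Ψ-drop : ∀ {u w} → 0ℚ ≤ u → u ≤ w → (w - u) * (1/10 * b w) ≤ Ψ u - Ψ w
Ψ-drop = chain₀ (λ u w → (w - u) * (1/10 * b w) ≤ Ψ u - Ψ w) transitive 36 step end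
  where
  transitive : ∀ {u v w} → 0ℚ ≤ u → u ≤ v → v ≤ w → (v - u) * (1/10 * b v) ≤ Ψ u - Ψ v →
    (w - v) * (1/10 * b w) ≤ Ψ v - Ψ w → (w - u) * (1/10 * b w) ≤ Ψ u - Ψ w
  transitive {u} {v} {w} 0≤u u≤v v≤w uv vw = by-diff
    (regroup (Ψ u) (Ψ v) (Ψ w) u v w (b v) (b w) 1/10)
    (0≤+ (0≤+ (≤⇒0≤- uv) (≤⇒0≤- vw))
         (0≤* (≤⇒0≤- u≤v) (0≤* (from-yes (0ℚ ≤? 1/10)) (≤⇒0≤- (b-antitone (≤-trans 0≤u u≤v) v≤w)))))
    where
    regroup : ∀ p q r u v w B C k → p - r - (w - u) * (k * C) ≡
              (p - q - (v - u) * (k * B)) + (q - r - (w - v) * (k * C)) + (v - u) * (k * (B - C))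
    regroup = solve-∀ ℚ-ring
  step : ∀ i → i ℕ.< 36 → ∀ {u w} → fromℕ i ≤ u → u ≤ w → w ≤ fromℕ (suc i) →
         (w - u) * (1/10 * b w) ≤ Ψ u - Ψ w
  step i i<36 {u} {w} i≤u u≤w w≤i = subst₂ _≤_
    (trans (trans (collect unit⁻¹ u w (fromℕ i) (⟦ deriv q ⟧ r)) (cong (λ k → (w - u) * (k * (unit⁻¹ * ⟦ deriv q ⟧ r))) (sym 1/10*10≡1)))
           (trans (expand 1/10 10ℚ (w - u) unit⁻¹ (⟦ deriv q ⟧ r))
                  (cong (λ t → (w - u) * (1/10 * t)) (sym (b-cell i i<36 (≤-trans i≤u u≤w) w≤i)))))
    (trans (distrib unit⁻¹ (⟦ q ⟧ t) (⟦ q ⟧ r))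
      (sym (cong₂ _-_ (Ψ-cell i i<36 i≤u (≤-trans u≤w w≤i)) (Ψ-cell i i<36 (≤-trans i≤u u≤w) w≤i))))
    (*-monoʳ-≤ 0≤unit⁻¹ (tangent≤secant q (dual-poly-nonNeg i i<36) (reverse-nonNeg {i} w≤i) (reverse-antitone {i} u≤w)))
    where
    q = dual-poly i
    t = 1ℚ - (u - fromℕ i)
    r = 1ℚ - (w - fromℕ i)
    collect : ∀ e u w i d → e * ((1ℚ - (u - i) - (1ℚ - (w - i))) * d) ≡ (w - u) * (1ℚ * (e * d))
    collect = solve-∀ ℚ-ring
    expand : ∀ k l x e d → x * (k * l * (e * d)) ≡ x * (k * (e * (l * d)))
    expand = solve-∀ ℚ-ring
    distrib : ∀ e p q → e * (p - q) ≡ e * p - e * q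
    distrib = solve-∀ ℚ-ring
  end : ∀ {u w} → fromℕ 36 ≤ u → u ≤ w → (w - u) * (1/10 * b w) ≤ Ψ u - Ψ w
  end {u} {w} 36≤u u≤w = ≤-reflexive (trans
    (cong (λ t → (w - u) * (1/10 * t)) (b-tail 36≤w))
    (trans (zeros (w - u) 1/10 Ψ-end) (sym (cong₂ _-_ (Ψ-tail 36≤u) (Ψ-tail 36≤w)))))
    where
    36≤w = ≤-trans 36≤u u≤w
    zeros : ∀ x k e → x * (k * 0ℚ) ≡ e - e
    zeros = solve-∀ ℚ-ring

-- The certificate τ (b + Ψ) - 1 ≥ 0, times the square of the table unit. Composition with 1 - s
-- brings the reversed dual polynomial into the coordinate of the hazard polynomial.
dualPoly : ℕ → Poly
dualPoly i = τ-poly i ⊗ (dual-poly i ⊕ + 10 ⊙ deriv (dual-poly i)) ∘ₚ (1ℤ ∷ -1ℤ ∷ []) ⊕ (ℤ.- (unit ℤ.* unit) ∷ [])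

dual-check : ∀ i → i ℕ.< 36 → T (nonNegOn01 10 (dualPoly i))
dual-check = allBelow-sound 36 (λ i → nonNegOn01 10 (dualPoly i)) tt

1≤τ*[b+Ψ] : ∀ {z} → 0ℚ ≤ z → 1ℚ ≤ τ z * (b z + Ψ z)
-- A pointwise property is cast as a relation holding at both ends of a segment, so that `chain₀`
-- can sort points into cells; it is then applied to the segment from z to z.
1≤τ*[b+Ψ] 0≤z = proj₁ (chain₀ (λ u w → Good u × Good w) (λ _ _ _ uv vw → proj₁ uv , proj₂ vw) 36
    (λ i i<36 i≤u u≤w w≤i → in-cell i i<36 i≤u (≤-trans u≤w w≤i) , in-cell i i<36 (≤-trans i≤u u≤w) w≤i)
    (λ 36≤u u≤w → in-tail 36≤u , in-tail (≤-trans 36≤u u≤w)) 0≤z ≤-refl)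
  where
  Good : ℚ → Set
  Good z = 1ℚ ≤ τ z * (b z + Ψ z)
  in-tail : ∀ {z} → fromℕ 36 ≤ z → Good z
  in-tail 36≤z = subst (1ℚ ≤_) (sym (cong₂ _*_ (τ-tail 36≤z) (cong₂ _+_ (b-tail 36≤z) (Ψ-tail 36≤z)))) tail-check
  in-cell : ∀ i → i ℕ.< 36 → ∀ {z} → fromℕ i ≤ z → z ≤ fromℕ (suc i) → Good z
  in-cell i i<36 {z} i≤z z≤i = subst (1ℚ ≤_)
    (sym (cong₂ _*_ (τ-cell i i<36 i≤z z≤i) (cong₂ _+_ (b-cell i i<36 i≤z z≤i) (Ψ-cell i i<36 i≤z z≤i))))
    (by-diff (sym (trans (regroup unit⁻¹ (⟦ p ⟧ s) (⟦ q ⟧ r) (⟦ deriv q ⟧ r) 10ℚ (fromℤ (unit ℤ.* unit)))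
               (cong (λ t → ⟪ p ⟫ s * (b-local q s + Ψ-local q s) - t) unit⁻²*unit²)))
      (0≤* (0≤* 0≤unit⁻¹ 0≤unit⁻¹) (subst (0ℚ ≤_) meaning
        (nonNegOn01-sound 10 (dualPoly i) (dual-check i i<36) (≤⇒0≤- i≤z) (local-≤1 {i} z≤i)))))
    where
    s = z - fromℕ i
    r = 1ℚ - s
    p = τ-poly i
    q = dual-poly i
    f = q ⊕ + 10 ⊙ deriv q
    f-value : ⟦ f ∘ₚ (1ℤ ∷ -1ℤ ∷ []) ⟧ s ≡ ⟦ q ⟧ r + 10ℚ * ⟦ deriv q ⟧ r
    f-value = trans (⟦∘⟧ f (1ℤ ∷ -1ℤ ∷ []) s) (trans (cong ⟦ f ⟧ (⟦1-x⟧ s))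
      (trans (⟦⊕⟧ q (+ 10 ⊙ deriv q) r) (cong (λ t → ⟦ q ⟧ r + t) (⟦⊙⟧ (+ 10) (deriv q) r))))
    meaning : ⟦ dualPoly i ⟧ s ≡ ⟦ p ⟧ s * (⟦ q ⟧ r + 10ℚ * ⟦ deriv q ⟧ r) + - fromℤ (unit ℤ.* unit)
    meaning = trans (⟦⊕⟧ (p ⊗ f ∘ₚ (1ℤ ∷ -1ℤ ∷ [])) (ℤ.- (unit ℤ.* unit) ∷ []) s)
      (cong₂ _+_ (trans (⟦⊗⟧ p (f ∘ₚ (1ℤ ∷ -1ℤ ∷ [])) s) (cong (⟦ p ⟧ s *_) f-value))
        (trans (⟦const⟧ (ℤ.- (unit ℤ.* unit)) s) (fromℤ-neg (unit ℤ.* unit))))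
    regroup : ∀ e p q d k n → e * e * (p * (q + k * d) + - n) ≡ e * p * (e * (k * d) + e * q) - e * e * n
    regroup = solve-∀ ℚ-ring

-- Sums and products over Fin

foldr-tabulate : ∀ {A B : Set} (c : A → B → B) e {n} (g : Fin n → A) →
                 foldr c e (tabulate g) ≡ foldr (λ i → c (g i)) e (allFin n)
foldr-tabulate c e {zero} g = refl
foldr-tabulate c e {suc n} g = cong (c (g zero))
  (trans (foldr-tabulate c e (g ∘ suc)) (sym (foldr-tabulate (λ i → c (g i)) e suc)))

opaque
  sum : ∀ {m} → (Fin m → ℚ) → ℚ
  sum = Σ

  sum≡Σ : ∀ {m} (f : Fin m → ℚ) → sum f ≡ Σ f
  sum≡Σ f = refl

  sum-zero : ∀ (f : Fin 0 → ℚ) → sum f ≡ 0ℚ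
  sum-zero f = refl

  sum-suc : ∀ {m} (f : Fin (suc m) → ℚ) → sum f ≡ f zero + sum (f ∘ suc)
  sum-suc f = cong (λ t → f zero + t) (foldr-tabulate (λ j acc → f j + acc) 0ℚ suc)

sum-mono : ∀ {m} {f g : Fin m → ℚ} → (∀ j → f j ≤ g j) → sum f ≤ sum g
sum-mono {zero} {f} {g} _ = ≤-reflexive (trans (sum-zero f) (sym (sum-zero g)))
sum-mono {suc m} {f} {g} f≤g =
  subst₂ _≤_ (sym (sum-suc f)) (sym (sum-suc g)) (+-mono-≤ (f≤g zero) (sum-mono (λ j → f≤g (suc j))))

sum-cong : ∀ {m} {f g : Fin m → ℚ} → (∀ j → f j ≡ g j) → sum f ≡ sum g
sum-cong f≡g = ≤-antisym (sum-mono (λ j → ≤-reflexive (f≡g j))) (sum-mono (λ j → ≤-reflexive (sym (f≡g j))))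

sum-+ : ∀ {m} (f g : Fin m → ℚ) → sum (λ j → f j + g j) ≡ sum f + sum g
sum-+ {zero} f g = trans (sum-zero _) (sym (cong₂ _+_ (sum-zero f) (sum-zero g)))
sum-+ {suc m} f g = begin
  sum (λ j → f j + g j)                                  ≡⟨ sum-suc (λ j → f j + g j) ⟩
  f zero + g zero + sum (λ j → f (suc j) + g (suc j))    ≡⟨ cong (λ t → f zero + g zero + t) (sum-+ (f ∘ suc) (g ∘ suc)) ⟩
  f zero + g zero + (sum (f ∘ suc) + sum (g ∘ suc))      ≡⟨ regroup (f zero) (g zero) (sum (f ∘ suc)) (sum (g ∘ suc)) ⟩
  f zero + sum (f ∘ suc) + (g zero + sum (g ∘ suc))      ≡⟨ cong₂ _+_ (sym (sum-suc f)) (sym (sum-suc g)) ⟩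
  sum f + sum g                                          ∎
  where
  open ≡-Reasoning
  regroup : ∀ a b s t → a + b + (s + t) ≡ a + s + (b + t)
  regroup = solve-∀ ℚ-ring

sum-* : ∀ {m} c (f : Fin m → ℚ) → sum (λ j → c * f j) ≡ c * sum f
sum-* {zero} c f = trans (sum-zero _) (sym (trans (cong (c *_) (sum-zero f)) (*-zeroʳ c)))
sum-* {suc m} c f = begin
  sum (λ j → c * f j)                      ≡⟨ sum-suc (λ j → c * f j) ⟩
  c * f zero + sum (λ j → c * f (suc j))   ≡⟨ cong (λ t → c * f zero + t) (sum-* c (f ∘ suc)) ⟩
  c * f zero + c * sum (f ∘ suc)           ≡⟨ sym (*-distribˡ-+ c (f zero) (sum (f ∘ suc))) ⟩
  c * (f zero + sum (f ∘ suc))             ≡⟨ cong (c *_) (sym (sum-suc f)) ⟩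
  c * sum f                                ∎
  where open ≡-Reasoning

sum-0 : ∀ m → sum {m} (λ _ → 0ℚ) ≡ 0ℚ
sum-0 zero = sum-zero (λ _ → 0ℚ)
sum-0 (suc m) = trans (sum-suc {m} (λ _ → 0ℚ)) (trans (+-identityˡ _) (sum-0 m))

sum-nonNeg : ∀ {m} {f : Fin m → ℚ} → (∀ j → 0ℚ ≤ f j) → 0ℚ ≤ sum f
sum-nonNeg {m} {f} 0≤f = subst (_≤ sum f) (sum-0 m) (sum-mono 0≤f)

sum-point : ∀ {m} (k : Fin m) c → sum (λ j → if does (k ≟ᶠ j) then c else 0ℚ) ≡ c
sum-point {suc m} zero c = trans (sum-suc {m} (λ j → if does (zero ≟ᶠ j) then c else 0ℚ))
  (trans (cong (λ t → c + t) (sum-0 m)) (+-identityʳ c))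
sum-point {suc m} (suc k) c = trans (sum-suc {m} (λ j → if does (suc k ≟ᶠ j) then c else 0ℚ))
  (trans (+-identityˡ _) (sum-point k c))

product : ∀ {m} → (Fin m → ℚ) → ℚ
product {zero} f = 1ℚ
product {suc m} f = f zero * product (f ∘ suc)

product-nonNeg : ∀ {m} {f : Fin m → ℚ} → (∀ j → 0ℚ ≤ f j) → 0ℚ ≤ product f
product-nonNeg {zero} _ = 0≤1ℚ
product-nonNeg {suc m} 0≤f = 0≤* (0≤f zero) (product-nonNeg (λ j → 0≤f (suc j)))

product-mono : ∀ {m} {f g : Fin m → ℚ} → (∀ j → 0ℚ ≤ f j) → (∀ j → f j ≤ g j) → product f ≤ product g
product-mono {zero} _ _ = ≤-refl
product-mono {suc m} 0≤f f≤g = *-mono-≤ (0≤f zero)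
  (product-nonNeg (λ j → ≤-trans (0≤f (suc j)) (f≤g (suc j)))) (f≤g zero)
  (product-mono (λ j → 0≤f (suc j)) (λ j → f≤g (suc j)))

product-* : ∀ {m} (f g : Fin m → ℚ) → product (λ j → f j * g j) ≡ product f * product g
product-* {zero} f g = refl
product-* {suc m} f g = trans (cong (f zero * g zero *_) (product-* (f ∘ suc) (g ∘ suc)))
  (regroup (f zero) (g zero) (product (f ∘ suc)) (product (g ∘ suc)))
  where
  regroup : ∀ a b s t → a * b * (s * t) ≡ a * s * (b * t)
  regroup = solve-∀ ℚ-ring

product-1 : ∀ m → product {m} (λ _ → 1ℚ) ≡ 1ℚ
product-1 zero = refl
product-1 (suc m) = trans (*-identityˡ _) (product-1 m)

insert : ∀ {m} → Fin m → (Fin m → Bool) → Fin m → Bool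
insert k U j = does (j ≟ᶠ k) ∨ U j

product-insert : ∀ {m} (k : Fin m) (U : Fin m → Bool) (f : Fin m → ℚ) → U k ≡ false →
  product (λ j → if insert k U j then f j else 1ℚ) ≡ product (λ j → if U j then f j else 1ℚ) * f k
product-insert {suc m} zero U f U0 = trans (swap (f zero) (product rest))
  (cong (λ c → (if c then f zero else 1ℚ) * product rest * f zero) (sym U0))
  where
  rest : Fin m → ℚ
  rest j = if U (suc j) then f (suc j) else 1ℚ
  swap : ∀ a p → a * p ≡ 1ℚ * p * a
  swap = solve-∀ ℚ-ring
product-insert {suc m} (suc k) U f Uk = trans
  (cong ((if U zero then f zero else 1ℚ) *_) (product-insert k (U ∘ suc) (f ∘ suc) Uk))
  (sym (*-assoc (if U zero then f zero else 1ℚ) (product (λ j → if U (suc j) then f (suc j) else 1ℚ)) (f (suc k))))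

-- The random process

sum-member : ∀ {m} {f : Fin m → ℚ} → (∀ j → 0ℚ ≤ f j) → ∀ k → f k ≤ sum f
sum-member {f = f} 0≤f k = subst (_≤ sum f) (sum-point k (f k)) (sum-mono below)
  where
  below : ∀ j → (if does (k ≟ᶠ j) then f k else 0ℚ) ≤ f j
  below j with k ≟ᶠ j
  ... | yes refl = ≤-refl
  ... | no _ = 0≤f j

divq-cancel : ∀ p {q} → q ≢ 0ℚ → q * divq p q ≡ p
divq-cancel p {q} q≢0 with q ≟ 0ℚ
... | yes q≡0 = ⊥-elim (q≢0 q≡0)
... | no q≢0 = trans (*-comm q (p * r)) (trans (*-assoc p r q) (trans (cong (p *_) (*-inverseˡ q {{≢-nonZero q≢0}})) (*-identityʳ p)))
  where r = 1/_ q {{≢-nonZero q≢0}}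

𝟙 : Bool → ℚ
𝟙 c = if c then 1ℚ else 0ℚ

0≤𝟙 : ∀ c → 0ℚ ≤ 𝟙 c
0≤𝟙 true = 0≤1ℚ
0≤𝟙 false = ≤-refl

module _ {m : ℕ} where

  free : (Fin m → Bool) → History m → Bool
  free U [] = true
  free U (nothing ∷ h) = free U h
  free U (just j ∷ h) = not (U j) ∧ free U h

  free-unmatched : ∀ U h j → free U h ≡ true → U j ≡ true → matched h j ≡ false
  free-unmatched U [] j _ _ = refl
  free-unmatched U (nothing ∷ h) j = free-unmatched U h j
  free-unmatched U (just k ∷ h) j free-h Uj with k ≟ᶠ j | U k in Uk | free-h
  ... | yes refl | true | ()
  ... | yes refl | false | _ with () ← trans (sym Uk) Uj
  ... | no _ | true | ()
  ... | no _ | false | free-h = free-unmatched U h j free-h Uj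

  free-insert : ∀ k U h → free (insert k U) h ≡ free U h ∧ not (matched h k)
  free-insert k U [] = refl
  free-insert k U (nothing ∷ h) = free-insert k U h
  free-insert k U (just j ∷ h) rewrite free-insert k U h = by-cases (does (j ≟ᶠ k)) (U j) (free U h) (matched h k)
    where
    by-cases : ∀ e u f t → not (e ∨ u) ∧ (f ∧ not t) ≡ (not u ∧ f) ∧ not (if e then true else t)
    by-cases true true true t = refl
    by-cases true true false t = refl
    by-cases true false true t = refl
    by-cases true false false t = refl
    by-cases false true f t = refl
    by-cases false false f t = refl

  free-extend : ∀ U c h → 𝟙 (free U (c ∷ h)) ≤ 𝟙 (free U h)
  free-extend U nothing h = ≤-refl
  free-extend U (just j) h with U j
  ... | true = 0≤𝟙 (free U h)
  ... | false = ≤-refl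

  unmatched : History m → Fin m → ℚ
  unmatched h j = 𝟙 (not (matched h j))

  reward : Maybe (Fin m) → ℚ
  reward (just _) = 1ℚ
  reward nothing = 0ℚ

  -- Only an inequality: when the chosen vertex is already matched in `h`, the reward is counted
  -- although nothing drops.
  unmatched-drop : ∀ c h → sum (unmatched h) ≤ reward c + sum (unmatched (c ∷ h))
  unmatched-drop nothing h = ≤-reflexive (sym (+-identityˡ _))
  unmatched-drop (just k) h = begin
    sum (unmatched h)                                           ≤⟨ sum-mono (λ j → pointwise (does (k ≟ᶠ j)) (matched h j)) ⟩
    sum (λ j → (if does (k ≟ᶠ j) then 1ℚ else 0ℚ) + unmatched (just k ∷ h) j)
      ≡⟨ sum-+ (λ j → if does (k ≟ᶠ j) then 1ℚ else 0ℚ) (unmatched (just k ∷ h)) ⟩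
    sum (λ j → if does (k ≟ᶠ j) then 1ℚ else 0ℚ) + sum (unmatched (just k ∷ h))
      ≡⟨ cong (_+ sum (unmatched (just k ∷ h))) (sum-point k 1ℚ) ⟩
    1ℚ + sum (unmatched (just k ∷ h)) ∎
    where
    open ≤-Reasoning
    pointwise : ∀ e t → 𝟙 (not t) ≤ 𝟙 e + 𝟙 (not (if e then true else t))
    pointwise true true = 0≤1ℚ
    pointwise true false = ≤-refl
    pointwise false t = ≤-reflexive (sym (+-identityˡ (𝟙 (not t))))

-- The outcome of one online vertex, as a random choice with weights x over the unmatched
-- neighbours (or the fallback policy if these weights all vanish).
module Kernel {m : ℕ} (N : Nbrs m) (x : Fin m → ℚ) (pol : Policy m)
  (0≤x : ∀ j → 0ℚ ≤ x j) (x-off : ∀ j → N j ≡ false → x j ≡ 0ℚ) where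

  available : History m → Fin m → Bool
  available h j = N j ∧ not (matched h j)

  total : History m → ℚ
  total h = Σ (λ j → if available h j then x j else 0ℚ)

  average-by : ∀ h → Dec (total h ≡ 0ℚ) → (Maybe (Fin m) → ℚ) → ℚ
  average-by h d F = if does d then F (pol h)
    else Σ (λ j → if available h j then divq (x j) (total h) * F (just j) else 0ℚ)

  average : History m → (Maybe (Fin m) → ℚ) → ℚ
  average h = average-by h (total h ≟ 0ℚ)

  weight : History m → Fin m → ℚ
  weight h j = if available h j then divq (x j) (total h) else 0ℚ

  weighted : ∀ h (F : Maybe (Fin m) → ℚ) → Σ (λ j → if available h j then divq (x j) (total h) * F (just j) else 0ℚ) ≡
             sum (λ j → weight h j * F (just j))
  weighted h F = trans (sym (sum≡Σ _)) (sum-cong (λ j → pointwise (available h j) (divq (x j) (total h)) (F (just j))))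
    where
    pointwise : ∀ c a b → (if c then a * b else 0ℚ) ≡ (if c then a else 0ℚ) * b
    pointwise true a b = refl
    pointwise false a b = sym (*-zeroˡ b)

  available-x : History m → Fin m → ℚ
  available-x h j = if available h j then x j else 0ℚ

  total≡sum : ∀ h → total h ≡ sum (available-x h)
  total≡sum h = sym (sum≡Σ (available-x h))

  0≤available-x : ∀ h j → 0ℚ ≤ available-x h j
  0≤available-x h j with available h j
  ... | true = 0≤x j
  ... | false = ≤-refl

  0<total : ∀ h → total h ≢ 0ℚ → 0ℚ < total h
  0<total h ≢0 = ≰⇒> (λ S≤0 → ≢0 (≤-antisym S≤0 (subst (0ℚ ≤_) (sym (total≡sum h)) (sum-nonNeg (0≤available-x h)))))

  total*weight : ∀ h → total h ≢ 0ℚ → ∀ j → total h * weight h j ≡ available-x h j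
  total*weight h ≢0 j = pointwise (available h j)
    where
    pointwise : ∀ c → total h * (if c then divq (x j) (total h) else 0ℚ) ≡ (if c then x j else 0ℚ)
    pointwise true = divq-cancel (x j) ≢0
    pointwise false = *-zeroʳ (total h)

  0≤weight : ∀ h → total h ≢ 0ℚ → ∀ j → 0ℚ ≤ weight h j
  0≤weight h ≢0 j = *-cancelˡ-≤ (0<total h ≢0)
    (subst₂ _≤_ (sym (*-zeroʳ (total h))) (sym (total*weight h ≢0 j)) (0≤available-x h j))

  sum-weight : ∀ h → total h ≢ 0ℚ → sum (weight h) ≡ 1ℚ
  sum-weight h ≢0 = *-cancelˡ-≡ (begin
    total h * sum (weight h)             ≡⟨ sym (sum-* (total h) (weight h)) ⟩
    sum (λ j → total h * weight h j)     ≡⟨ sum-cong (total*weight h ≢0) ⟩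
    sum (available-x h)                  ≡⟨ sym (total≡sum h) ⟩
    total h                              ≡⟨ sym (*-identityʳ (total h)) ⟩
    total h * 1ℚ                         ∎)
    where
    open ≡-Reasoning
    *-cancelˡ-≡ : ∀ {a b} → total h * a ≡ total h * b → a ≡ b
    *-cancelˡ-≡ eq = ≤-antisym (*-cancelˡ-≤ (0<total h ≢0) (≤-reflexive eq)) (*-cancelˡ-≤ (0<total h ≢0) (≤-reflexive (sym eq)))

  average-mono : ∀ h {F G} → (∀ c → F c ≤ G c) → average h F ≤ average h G
  average-mono h {F} {G} F≤G = by-cases (total h ≟ 0ℚ)
    where
    by-cases : ∀ d → average-by h d F ≤ average-by h d G
    by-cases (yes _) = F≤G (pol h)
    by-cases (no ≢0) = subst₂ _≤_ (sym (weighted h F)) (sym (weighted h G))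
      (sum-mono (λ j → *-monoʳ-≤ (0≤weight h ≢0 j) (F≤G (just j))))

  average-+ : ∀ h F G → average h (λ c → F c + G c) ≡ average h F + average h G
  average-+ h F G = by-cases (total h ≟ 0ℚ)
    where
    by-cases : ∀ d → average-by h d (λ c → F c + G c) ≡ average-by h d F + average-by h d G
    by-cases (yes _) = refl
    by-cases (no _) = trans (weighted h (λ c → F c + G c))
      (trans (sum-cong (λ j → *-distribˡ-+ (weight h j) (F (just j)) (G (just j))))
        (trans (sum-+ (λ j → weight h j * F (just j)) (λ j → weight h j * G (just j)))
          (sym (cong₂ _+_ (weighted h F) (weighted h G)))))

  average-* : ∀ h k F → average h (λ c → k * F c) ≡ k * average h F
  average-* h k F = by-cases (total h ≟ 0ℚ)
    where
    swap : ∀ w k f → w * (k * f) ≡ k * (w * f)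
    swap = solve-∀ ℚ-ring
    by-cases : ∀ d → average-by h d (λ c → k * F c) ≡ k * average-by h d F
    by-cases (yes _) = refl
    by-cases (no _) = trans (weighted h (λ c → k * F c))
      (trans (sum-cong (λ j → swap (weight h j) k (F (just j))))
        (trans (sum-* k (λ j → weight h j * F (just j))) (cong (k *_) (sym (weighted h F)))))

  average-const : ∀ h a → average h (λ _ → a) ≡ a
  average-const h a = by-cases (total h ≟ 0ℚ)
    where
    by-cases : ∀ d → average-by h d (λ _ → a) ≡ a
    by-cases (yes _) = refl
    by-cases (no ≢0) = trans (weighted h (λ _ → a))
      (trans (sum-cong (λ j → *-comm (weight h j) a))
        (trans (sum-* a (weight h)) (trans (cong (a *_) (sum-weight h ≢0)) (*-identityʳ a))))

  within outside : (Fin m → Bool) → Fin m → ℚ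
  within U j = if U j then x j else 0ℚ
  outside U j = if U j then 0ℚ else x j

  0≤within : ∀ U j → 0ℚ ≤ within U j
  0≤within U j with U j
  ... | true = 0≤x j
  ... | false = ≤-refl

  0≤outside : ∀ U j → 0ℚ ≤ outside U j
  0≤outside U j with U j
  ... | true = ≤-refl
  ... | false = 0≤x j

  within+outside : ∀ U → sum (within U) + sum (outside U) ≡ sum x
  within+outside U = trans (sym (sum-+ (within U) (outside U))) (sum-cong (λ j → pointwise (U j) (x j)))
    where
    pointwise : ∀ c a → (if c then a else 0ℚ) + (if c then 0ℚ else a) ≡ a
    pointwise true a = +-identityʳ a
    pointwise false a = +-identityˡ a

  -- Since x vanishes off the neighbourhood and U is untouched, all the mass in U is available;
  -- matching removes mass only outside U. This gives the total X + R.
  split : ∀ U h → free U h ≡ true → ∀ j → available-x h j ≡ within U j + outside U j * unmatched h j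
  split U h free-h j = pointwise (N j) (matched h j) (U j) (x j) (x-off j) (free-unmatched U h j free-h)
    where
    zero-term : ∀ b → 0ℚ ≡ 0ℚ + 0ℚ * b
    zero-term = solve-∀ ℚ-ring
    first-term : ∀ a b → a ≡ a + 0ℚ * b
    first-term = solve-∀ ℚ-ring
    last-term : ∀ a → a ≡ 0ℚ + a * 1ℚ
    last-term = solve-∀ ℚ-ring
    no-term : ∀ a → 0ℚ ≡ 0ℚ + a * 0ℚ
    no-term = solve-∀ ℚ-ring
    pointwise : ∀ n t u a → (n ≡ false → a ≡ 0ℚ) → (u ≡ true → t ≡ false) →
      (if n ∧ not t then a else 0ℚ) ≡ (if u then a else 0ℚ) + (if u then 0ℚ else a) * 𝟙 (not t)
    pointwise true true true a _ u⇒ with () ← u⇒ refl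
    pointwise true true false a _ _ = no-term a
    pointwise true false true a _ _ = first-term a 1ℚ
    pointwise true false false a _ _ = last-term a
    pointwise false t true a off _ = trans (sym (off refl)) (first-term a (𝟙 (not t)))
    pointwise false t false a off _ = trans (zero-term (𝟙 (not t))) (cong (λ b → 0ℚ + b * 𝟙 (not t)) (sym (off refl)))

  -- With X and R the weights of the unmatched vertices inside and outside U, the set U
  -- survives with probability R / (X + R), a concave function of R; the right-hand side is
  -- X times its tangent line at the point where it equals l.
  average-free : ∀ U l h → let X = sum (within U) in
    X * average h (λ c → 𝟙 (free U (c ∷ h))) ≤
    l * l * X * 𝟙 (free U h) + (1ℚ - l) * (1ℚ - l) * sum (λ k → outside U k * 𝟙 (free (insert k U) h))
  average-free U l h = by-free (free U h) refl
    where
    X = sum (within U)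
    0≤X = sum-nonNeg (0≤within U)
    F : Maybe (Fin m) → ℚ
    F c = 𝟙 (free U (c ∷ h))
    rest : ℚ
    rest = (1ℚ - l) * (1ℚ - l) * sum (λ k → outside U k * 𝟙 (free (insert k U) h))
    0≤rest : 0ℚ ≤ rest
    0≤rest = 0≤* (0≤² (1ℚ - l)) (sum-nonNeg (λ k → 0≤* (0≤outside U k) (0≤𝟙 (free (insert k U) h))))
    by-free : ∀ f → free U h ≡ f → X * average h F ≤ l * l * X * 𝟙 (free U h) + rest
    by-free false free-h = begin
      X * average h F                     ≤⟨ *-monoʳ-≤ 0≤X (average-mono h (λ c → free-extend U c h)) ⟩
      X * average h (λ _ → 𝟙 (free U h))  ≡⟨ cong (X *_) (trans (average-const h (𝟙 (free U h))) (cong 𝟙 free-h)) ⟩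
      X * 0ℚ                              ≡⟨ *-zeroʳ X ⟩
      0ℚ                                  ≤⟨ 0≤+ (0≤* (0≤* (0≤² l) 0≤X) (0≤𝟙 (free U h))) 0≤rest ⟩
      l * l * X * 𝟙 (free U h) + rest     ∎
      where open ≤-Reasoning
    by-free true free-h = subst (X * average h F ≤_) (sym value) (by-total (total h ≟ 0ℚ))
      where
      R = sum (λ k → outside U k * unmatched h k)
      0≤R = sum-nonNeg (λ k → 0≤* (0≤outside U k) (0≤𝟙 (not (matched h k))))
      total≡X+R : total h ≡ X + R
      total≡X+R = trans (total≡sum h) (trans (sum-cong (split U h free-h)) (sum-+ (within U) (λ k → outside U k * unmatched h k)))
      value : l * l * X * 𝟙 (free U h) + rest ≡ l * l * X * 1ℚ + (1ℚ - l) * (1ℚ - l) * R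
      value = cong₂ (λ a r → l * l * X * a + (1ℚ - l) * (1ℚ - l) * r) (cong 𝟙 free-h)
        (sum-cong (λ k → cong (λ c → outside U k * 𝟙 c) (trans (free-insert k U h) (cong (_∧ not (matched h k)) free-h))))
      -- The gap between tangent line and concave function, times X + R, is a perfect square; this
      -- is the whole concavity argument.
      square : ∀ X R l → (X + R) * (l * l * X * 1ℚ + (1ℚ - l) * (1ℚ - l) * R) - X * R ≡
               (l * X - (1ℚ - l) * R) * (l * X - (1ℚ - l) * R)
      square = solve-∀ ℚ-ring
      by-total : ∀ d → X * average-by h d F ≤ l * l * X * 1ℚ + (1ℚ - l) * (1ℚ - l) * R
      -- When the fallback policy acts, U carries no available mass, so X = 0 and the left-hand side
      -- vanishes whatever the policy returns.
      by-total (yes S≡0) = begin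
        X * F (pol h)                      ≡⟨ cong (_* F (pol h)) X≡0 ⟩
        0ℚ * F (pol h)                     ≡⟨ *-zeroˡ (F (pol h)) ⟩
        0ℚ                                 ≤⟨ 0≤+ (0≤* (0≤* (0≤² l) 0≤X) 0≤1ℚ) (0≤* (0≤² (1ℚ - l)) 0≤R) ⟩
        l * l * X * 1ℚ + (1ℚ - l) * (1ℚ - l) * R ∎
        where
        open ≤-Reasoning
        cancel : ∀ X R → X + R - X ≡ R
        cancel = solve-∀ ℚ-ring
        X≡0 : X ≡ 0ℚ
        X≡0 = ≤-antisym (subst (X ≤_) (trans (sym total≡X+R) S≡0) (by-diff (cancel X R) 0≤R)) 0≤X
      by-total (no ≢0) = *-cancelˡ-≤ (0<total h ≢0) (begin
        S * (X * average-by h (no ≢0) F)   ≡⟨ cong (λ a → S * (X * a)) (weighted h F) ⟩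
        S * (X * κ)                        ≡⟨ swap S X κ ⟩
        X * (S * κ)                        ≡⟨ cong (X *_) S*κ≡R ⟩
        X * R                              ≤⟨ by-diff (square X R l) (0≤² (l * X - (1ℚ - l) * R)) ⟩
        (X + R) * (l * l * X * 1ℚ + (1ℚ - l) * (1ℚ - l) * R) ≡⟨ cong (_* (l * l * X * 1ℚ + (1ℚ - l) * (1ℚ - l) * R)) (sym total≡X+R) ⟩
        S * (l * l * X * 1ℚ + (1ℚ - l) * (1ℚ - l) * R) ∎)
        where
        open ≤-Reasoning
        S = total h
        κ = sum (λ j → weight h j * F (just j))
        swap : ∀ s x k → s * (x * k) ≡ x * (s * k)
        swap = solve-∀ ℚ-ring
        term : ∀ j → S * (weight h j * F (just j)) ≡ outside U j * unmatched h j
        term j = trans (sym (*-assoc S (weight h j) (F (just j))))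
          (trans (cong₂ _*_ (trans (total*weight h ≢0 j) (split U h free-h j)) (cong (λ f → 𝟙 (not (U j) ∧ f)) free-h))
            (pointwise (U j) (x j) (unmatched h j)))
          where
          out : ∀ b c → (b + 0ℚ * c) * 0ℚ ≡ 0ℚ * c
          out = solve-∀ ℚ-ring
          in′ : ∀ b c → (0ℚ + b * c) * 1ℚ ≡ b * c
          in′ = solve-∀ ℚ-ring
          pointwise : ∀ u a c → ((if u then a else 0ℚ) + (if u then 0ℚ else a) * c) * 𝟙 (not u ∧ true) ≡ (if u then 0ℚ else a) * c
          pointwise true a c = out a c
          pointwise false a c = in′ a c
        S*κ≡R : S * κ ≡ R
        S*κ≡R = trans (sym (sum-* S (λ j → weight h j * F (just j)))) (sum-cong term)

-- A finitely supported distribution of histories, seen as a positive linear functional.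
record Expectation (m : ℕ) : Set where
  field
    𝔼 : (History m → ℚ) → ℚ
    mono : ∀ {f g} → (∀ h → f h ≤ g h) → 𝔼 f ≤ 𝔼 g
    additive : ∀ f g → 𝔼 (λ h → f h + g h) ≡ 𝔼 f + 𝔼 g
    scaling : ∀ k f → 𝔼 (λ h → k * f h) ≡ k * 𝔼 f

  𝔼-cong : ∀ {f g} → (∀ h → f h ≡ g h) → 𝔼 f ≡ 𝔼 g
  𝔼-cong f≡g = ≤-antisym (mono (λ h → ≤-reflexive (f≡g h))) (mono (λ h → ≤-reflexive (sym (f≡g h))))

  𝔼-0 : 𝔼 (λ _ → 0ℚ) ≡ 0ℚ
  𝔼-0 = trans (𝔼-cong (λ _ → sym (*-zeroˡ 0ℚ))) (trans (scaling 0ℚ (λ _ → 0ℚ)) (*-zeroˡ (𝔼 (λ _ → 0ℚ))))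

  𝔼-sum : ∀ {n} (f : Fin n → History m → ℚ) → 𝔼 (λ h → sum (λ k → f k h)) ≡ sum (λ k → 𝔼 (f k))
  𝔼-sum {zero} f = trans (𝔼-cong (λ h → sum-zero (λ k → f k h))) (trans 𝔼-0 (sym (sum-zero (λ k → 𝔼 (f k)))))
  𝔼-sum {suc n} f = begin
    𝔼 (λ h → sum (λ k → f k h))                              ≡⟨ 𝔼-cong (λ h → sum-suc (λ k → f k h)) ⟩
    𝔼 (λ h → f zero h + sum (λ k → f (suc k) h))             ≡⟨ additive (f zero) (λ h → sum (λ k → f (suc k) h)) ⟩
    𝔼 (f zero) + 𝔼 (λ h → sum (λ k → f (suc k) h))           ≡⟨ cong (λ t → 𝔼 (f zero) + t) (𝔼-sum (λ k → f (suc k))) ⟩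
    𝔼 (f zero) + sum (λ k → 𝔼 (f (suc k)))                   ≡⟨ sym (sum-suc (λ k → 𝔼 (f k))) ⟩
    sum (λ k → 𝔼 (f k))                                      ∎
    where open ≡-Reasoning

open Expectation using (𝔼)

empty-history : ∀ m → Expectation m
empty-history m = record
  { 𝔼 = λ f → f []
  ; mono = λ f≤g → f≤g []
  ; additive = λ _ _ → refl
  ; scaling = λ _ _ → refl
  }

-- Propagating the survival bound through one arrival

Φ : ∀ {m} → (Fin m → ℚ) → (Fin m → Bool) → ℚ
Φ y U = product (λ j → if U j then φ (y j) else 1ℚ)

-- All sets U are needed, even though only singletons are used in the end: the step for U involves
-- the probability that U together with one further vertex k is unmatched.
Dominated : ∀ {m} → Expectation m → (Fin m → ℚ) → Set
Dominated E y = ∀ U → 𝔼 E (λ h → 𝟙 (free U h)) ≤ Φ y U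

0≤Φ : ∀ {m} (y : Fin m → ℚ) U → 0ℚ ≤ Φ y U
0≤Φ y U = product-nonNeg (λ j → pointwise (U j) (y j))
  where
  pointwise : ∀ c a → 0ℚ ≤ (if c then φ a else 1ℚ)
  pointwise true a = 0≤φ a
  pointwise false a = 0≤1ℚ

product-damping : ∀ t {m} (f : Fin m → ℚ) → (∀ j → 0ℚ ≤ f j) → sum f ≤ 1ℚ →
                  damping t (sum f) ≤ product (λ j → damping t (f j))
product-damping t {zero} f _ ≤1 = damping≤1 t (≤-reflexive (sym (sum-zero f))) ≤1
product-damping t {suc m} f 0≤f ≤1 = begin
  damping t (sum f)                                           ≡⟨ cong (damping t) (sum-suc f) ⟩
  damping t (f zero + sum (f ∘ suc))                          ≤⟨ damping-mul t (0≤f zero) 0≤rest ≤1′ ⟩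
  damping t (f zero) * damping t (sum (f ∘ suc))              ≤⟨ *-monoʳ-≤ (0≤damping t (0≤f zero) first≤1) (product-damping t (f ∘ suc) (0≤f ∘ suc) rest≤1) ⟩
  damping t (f zero) * product (λ j → damping t (f (suc j)))  ∎
  where
  open ≤-Reasoning
  0≤rest = sum-nonNeg (λ j → 0≤f (suc j))
  ≤1′ = subst (_≤ 1ℚ) (sum-suc f) ≤1
  cancelˡ : ∀ a s → a + s - s ≡ a
  cancelˡ = solve-∀ ℚ-ring
  cancelʳ : ∀ a s → a + s - a ≡ s
  cancelʳ = solve-∀ ℚ-ring
  first≤1 = ≤-trans (by-diff (cancelʳ (f zero) (sum (f ∘ suc))) 0≤rest) ≤1′
  rest≤1 = ≤-trans (by-diff (cancelˡ (f zero) (sum (f ∘ suc))) (0≤f zero)) ≤1′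

module Step {m : ℕ} (N : Nbrs m) (t : ℚ) (y : Fin m → ℚ) (pol : Policy m)
  (0≤y : ∀ j → 0ℚ ≤ y j)
  (valid : (∃ λ j → N j ≡ true) → (0ℚ < t) × (Σ (alloc N y t) ≡ 1ℚ)) where

  x : Fin m → ℚ
  x = alloc N y t

  0≤x : ∀ j → 0ℚ ≤ x j
  0≤x j = pointwise (N j)
    where
    pointwise : ∀ c → 0ℚ ≤ (if c then pos (t - y j) else 0ℚ)
    pointwise true = p≤q⊔p (t - y j) 0ℚ
    pointwise false = ≤-refl

  x-off : ∀ j → N j ≡ false → x j ≡ 0ℚ
  x-off j Nj = cong (λ c → if c then pos (t - y j) else 0ℚ) Nj

  x-cases : ∀ j → x j ≡ 0ℚ ⊎ y j + x j ≡ t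
  x-cases j = pointwise (N j) (≤-total (t - y j) 0ℚ)
    where
    cancel : ∀ y t → y + (t - y) ≡ t
    cancel = solve-∀ ℚ-ring
    pointwise : ∀ c → _ → let z = if c then pos (t - y j) else 0ℚ in z ≡ 0ℚ ⊎ y j + z ≡ t
    pointwise false _ = inj₁ refl
    pointwise true (inj₁ ≤0) = inj₁ (p≤q⇒p⊔q≡q ≤0)
    pointwise true (inj₂ 0≤) = inj₂ (trans (cong (λ z → y j + z) (p≥q⇒p⊔q≡p 0≤)) (cancel (y j) t))

  open Kernel N x pol 0≤x x-off

  sum-x : (∃ λ j → N j ≡ true) → sum x ≡ 1ℚ
  sum-x nonempty = trans (sum≡Σ x) (proj₂ (valid nonempty))

  x-empty : ¬ (∃ λ j → N j ≡ true) → ∀ j → x j ≡ 0ℚ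
  x-empty empty j = x-off j (not-true (N j) (λ Nj → empty (j , Nj)))
    where
    not-true : ∀ c → c ≢ true → c ≡ false
    not-true true ≢ = ⊥-elim (≢ refl)
    not-true false _ = refl

  sum-x≤1 : sum x ≤ 1ℚ
  sum-x≤1 with any? (λ j → N j ≟ᵇ true)
  ... | yes nonempty = ≤-reflexive (sum-x nonempty)
  ... | no empty = ≤-trans (≤-reflexive (trans (sum-cong (x-empty empty)) (sum-0 m))) 0≤1ℚ

  advance : Expectation m → Expectation m
  advance E = record
    { 𝔼 = λ f → 𝔼 E (λ h → average h (λ c → f (c ∷ h)))
    ; mono = λ f≤g → E.mono (λ h → average-mono h (λ c → f≤g (c ∷ h)))
    ; additive = λ f g → trans (E.𝔼-cong (λ h → average-+ h (λ c → f (c ∷ h)) (λ c → g (c ∷ h))))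
        (E.additive (λ h → average h (λ c → f (c ∷ h))) (λ h → average h (λ c → g (c ∷ h))))
    ; scaling = λ k f → trans (E.𝔼-cong (λ h → average-* h k (λ c → f (c ∷ h))))
        (E.scaling k (λ h → average h (λ c → f (c ∷ h))))
    }
    where module E = Expectation E

  module _ (U : Fin m → Bool) where

    X : ℚ
    X = sum (within U)

    0≤X : 0ℚ ≤ X
    0≤X = sum-nonNeg (0≤within U)

    X≤1 : X ≤ 1ℚ
    X≤1 = ≤-trans (by-diff (trans (cong (_- X) (sym (within+outside U))) (cancel X (sum (outside U)))) (sum-nonNeg (0≤outside U))) sum-x≤1
      where
      cancel : ∀ a b → a + b - a ≡ b
      cancel = solve-∀ ℚ-ring

    within≤1 : ∀ j → within U j ≤ 1ℚ
    within≤1 j = ≤-trans (sum-member (0≤within U) j) X≤1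

    φ-within : ∀ j → φ (y j) * damping t (x j) ≤ φ (y j + x j) →
               (if U j then φ (y j) else 1ℚ) * damping t (within U j) ≤ (if U j then φ (y j + x j) else 1ℚ)
    φ-within j inside = pointwise (U j)
      where
      pointwise : ∀ c → (if c then φ (y j) else 1ℚ) * damping t (if c then x j else 0ℚ) ≤ (if c then φ (y j + x j) else 1ℚ)
      pointwise true = inside
      pointwise false = ≤-trans (≤-reflexive (*-identityˡ (damping t 0ℚ))) (damping≤1 t ≤-refl 0≤1ℚ)

    x≤1 : ∀ j → x j ≤ 1ℚ
    x≤1 j = ≤-trans (sum-member 0≤x j) sum-x≤1

    damped : ∀ j → φ (y j) * damping t (x j) ≤ φ (y j + x j)
    damped j = by-cases (x-cases j)
      where
      by-cases : _ → φ (y j) * damping t (x j) ≤ φ (y j + x j)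
      -- A vertex receiving nothing may already be loaded above t, where the rate at t does not
      -- bound its decay; its φ is unchanged, so damping ≤ 1 suffices.
      by-cases (inj₁ x≡0) = ≤-trans (*-monoʳ-≤ (0≤φ (y j)) (damping≤1 t (0≤x j) (x≤1 j)))
        (≤-reflexive (trans (*-identityʳ (φ (y j))) (cong φ (trans (sym (+-identityʳ (y j))) (cong (λ z → y j + z) (sym x≡0))))))
      by-cases (inj₂ y+x≡t) = φ-damping (0≤y j) (0≤x j) (x≤1 j) (≤-reflexive y+x≡t)

    Φ-damped : Φ y U * damping t X ≤ Φ (update N y t) U
    Φ-damped = begin
      Φ y U * damping t X                                       ≤⟨ *-monoʳ-≤ (0≤Φ y U) (product-damping t (within U) (0≤within U) X≤1) ⟩
      Φ y U * product (λ j → damping t (within U j))            ≡⟨ sym (product-* (λ j → if U j then φ (y j) else 1ℚ) (λ j → damping t (within U j))) ⟩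
      product (λ j → (if U j then φ (y j) else 1ℚ) * damping t (within U j))
        ≤⟨ product-mono (λ j → 0≤* (pointwise (U j) (y j)) (0≤damping t (0≤within U j) (within≤1 j))) (λ j → φ-within j (damped j)) ⟩
      Φ (update N y t) U                                        ∎
      where
      open ≤-Reasoning
      pointwise : ∀ c a → 0ℚ ≤ (if c then φ a else 1ℚ)
      pointwise true a = 0≤φ a
      pointwise false a = 0≤1ℚ

    Q : ℚ
    Q = sum (λ k → outside U k * φ (y k))

    Q-bound : sum x ≡ 1ℚ → (1ℚ - damping t X) * Q ≤ damping t X * X
    Q-bound sum≡1 = begin
      (1ℚ - l) * Q                 ≤⟨ *-monoʳ-≤ 0≤1-l Q≤ ⟩
      (1ℚ - l) * ((1ℚ - X) * q)    ≤⟨ by-diff (regroup l X q) (≤⇒0≤- (damping-balance {t} 0≤X X≤1)) ⟩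
      l * X                        ∎
      where
      open ≤-Reasoning
      l = damping t X
      0≤1-l = ≤⇒0≤- (damping≤1 t 0≤X X≤1)
      q = φ ((t - 1ℚ + X) ⊔ 0ℚ)
      regroup : ∀ l X q → l * X - (1ℚ - l) * ((1ℚ - X) * q) ≡ l * (X + (1ℚ - X) * q) - (1ℚ - X) * q
      regroup = solve-∀ ℚ-ring
      outside-sum : sum (outside U) ≡ 1ℚ - X
      outside-sum = trans (isolate X (sum (outside U))) (cong (_- X) (trans (within+outside U) sum≡1))
        where
        isolate : ∀ a b → b ≡ a + b - a
        isolate = solve-∀ ℚ-ring
      low : ∀ k → outside U k ≤ 1ℚ - X
      low k = subst (outside U k ≤_) outside-sum (sum-member (0≤outside U) k)
      term : ∀ k → outside U k * φ (y k) ≤ q * outside U k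
      term k = pointwise (U k) (low k) (x-cases k)
        where
        pointwise : ∀ c → (if c then 0ℚ else x k) ≤ 1ℚ - X → x k ≡ 0ℚ ⊎ y k + x k ≡ t →
                    (if c then 0ℚ else x k) * φ (y k) ≤ q * (if c then 0ℚ else x k)
        pointwise true _ _ = ≤-reflexive (trans (*-zeroˡ (φ (y k))) (sym (*-zeroʳ q)))
        pointwise false _ (inj₁ x≡0) = ≤-reflexive (trans (cong (_* φ (y k)) x≡0)
          (trans (*-zeroˡ (φ (y k))) (sym (trans (cong (q *_) x≡0) (*-zeroʳ q)))))
        pointwise false xk≤ (inj₂ y+x≡t) = ≤-trans (*-monoʳ-≤ (0≤x k) (φ-antitone (p≤q⊔p (t - 1ℚ + X) 0ℚ) (⊔-lub t-1+X≤y (0≤y k))))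
          (≤-reflexive (*-comm (x k) q))
          where
          collect : ∀ y x X → y - (y + x - 1ℚ + X) ≡ 1ℚ - X - x
          collect = solve-∀ ℚ-ring
          t-1+X≤y : t - 1ℚ + X ≤ y k
          t-1+X≤y = subst (λ s → s - 1ℚ + X ≤ y k) y+x≡t (by-diff (collect (y k) (x k) X) (≤⇒0≤- xk≤))
      Q≤ : Q ≤ (1ℚ - X) * q
      Q≤ = ≤-trans (sum-mono term) (≤-reflexive (trans (sum-* q (outside U)) (trans (cong (q *_) outside-sum) (*-comm q (1ℚ - X)))))

    module _ (E : Expectation m) (dominated : Dominated E y) where

      private
        module E = Expectation E

      survive : ℚ
      survive = 𝔼 (advance E) (λ h → 𝟙 (free U h))

      survive≤ : survive ≤ 𝔼 E (λ h → 𝟙 (free U h))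
      survive≤ = E.mono (λ h → ≤-trans (average-mono h (λ c → free-extend U c h)) (≤-reflexive (average-const h (𝟙 (free U h)))))

      -- The tangent-line bound is linear in the two survival indicators, so the expectation passes
      -- through it. Adding k to U multiplies Φ by φ (y k), which turns the expected outside mass
      -- into at most Φ times Q. The slope parameter l is left free for the caller.
      X*survive≤ : ∀ l → X * survive ≤ Φ y U * (l * l * X + (1ℚ - l) * (1ℚ - l) * Q)
      X*survive≤ l = begin
        X * survive
          ≡⟨ sym (E.scaling X (λ h → average h (λ c → 𝟙 (free U (c ∷ h))))) ⟩
        E.𝔼 (λ h → X * average h (λ c → 𝟙 (free U (c ∷ h))))
          ≤⟨ E.mono (average-free U l) ⟩
        E.𝔼 (λ h → l * l * X * 𝟙 (free U h) + (1ℚ - l) * (1ℚ - l) * sum (λ k → outside U k * 𝟙 (free (insert k U) h)))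
          ≡⟨ trans (E.additive (λ h → l * l * X * 𝟙 (free U h)) (λ h → (1ℚ - l) * (1ℚ - l) * sum (λ k → outside U k * 𝟙 (free (insert k U) h))))
               (cong₂ _+_ (E.scaling (l * l * X) (λ h → 𝟙 (free U h)))
                 (trans (E.scaling ((1ℚ - l) * (1ℚ - l)) (λ h → sum (λ k → outside U k * 𝟙 (free (insert k U) h))))
                   (cong ((1ℚ - l) * (1ℚ - l) *_) (trans (E.𝔼-sum (λ k h → outside U k * 𝟙 (free (insert k U) h)))
                     (sum-cong (λ k → E.scaling (outside U k) (λ h → 𝟙 (free (insert k U) h)))))))) ⟩
        l * l * X * E.𝔼 (λ h → 𝟙 (free U h)) + (1ℚ - l) * (1ℚ - l) * sum (λ k → outside U k * E.𝔼 (λ h → 𝟙 (free (insert k U) h)))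
          ≤⟨ +-mono-≤ (*-monoʳ-≤ (0≤* (0≤² l) 0≤X) (dominated U)) (*-monoʳ-≤ (0≤² (1ℚ - l)) (sum-mono term)) ⟩
        l * l * X * Φ y U + (1ℚ - l) * (1ℚ - l) * sum (λ k → Φ y U * (outside U k * φ (y k)))
          ≡⟨ cong (λ s → l * l * X * Φ y U + (1ℚ - l) * (1ℚ - l) * s) (sum-* (Φ y U) (λ k → outside U k * φ (y k))) ⟩
        l * l * X * Φ y U + (1ℚ - l) * (1ℚ - l) * (Φ y U * Q)
          ≡⟨ regroup l X (Φ y U) Q ⟩
        Φ y U * (l * l * X + (1ℚ - l) * (1ℚ - l) * Q) ∎
        where
        open ≤-Reasoning
        regroup : ∀ l X p q → l * l * X * p + (1ℚ - l) * (1ℚ - l) * (p * q) ≡ p * (l * l * X + (1ℚ - l) * (1ℚ - l) * q)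
        regroup = solve-∀ ℚ-ring
        term : ∀ k → outside U k * E.𝔼 (λ h → 𝟙 (free (insert k U) h)) ≤ Φ y U * (outside U k * φ (y k))
        term k = pointwise (U k) refl
          where
          zeros : ∀ a b c → 0ℚ * a ≡ b * (0ℚ * c)
          zeros = solve-∀ ℚ-ring
          swap : ∀ x p f → x * (p * f) ≡ p * (x * f)
          swap = solve-∀ ℚ-ring
          pointwise : ∀ c → U k ≡ c → (if c then 0ℚ else x k) * E.𝔼 (λ h → 𝟙 (free (insert k U) h)) ≤ Φ y U * ((if c then 0ℚ else x k) * φ (y k))
          pointwise true _ = ≤-reflexive (zeros (E.𝔼 (λ h → 𝟙 (free (insert k U) h))) (Φ y U) (φ (y k)))
          pointwise false Uk = ≤-trans (*-monoʳ-≤ (0≤x k) (≤-trans (dominated (insert k U)) (≤-reflexive (product-insert k U (λ j → φ (y j)) Uk))))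
            (≤-reflexive (swap (x k) (Φ y U) (φ (y k))))

      survive-damped : survive ≤ Φ y U * damping t X
      survive-damped = by-cases (X ≟ 0ℚ)
        where
        by-cases : Dec (X ≡ 0ℚ) → survive ≤ Φ y U * damping t X
        by-cases (yes X≡0) = ≤-trans survive≤ (≤-trans (dominated U) (≤-reflexive
          (trans (sym (*-identityʳ (Φ y U))) (cong (Φ y U *_) (sym (trans (cong (damping t) X≡0) (damping-0 t)))))))
        by-cases (no X≢0) = *-cancelˡ-≤ 0<X (begin
          X * survive                                           ≤⟨ X*survive≤ l ⟩
          Φ y U * (l * l * X + (1ℚ - l) * (1ℚ - l) * Q)          ≤⟨ *-monoʳ-≤ (0≤Φ y U) (by-diff (regroup l X Q) (0≤* 0≤1-l (≤⇒0≤- (Q-bound (sum-x nonempty))))) ⟩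
          Φ y U * (X * l)                                       ≡⟨ swap (Φ y U) X l ⟩
          X * (Φ y U * l)                                       ∎)
          where
          open ≤-Reasoning
          -- With the tangent at l equal to the damping factor, the required bound l² X + (1 - l)² Q
          -- ≤ l X has difference (1 - l)(l X - (1 - l) Q), whose second factor is nonnegative by
          -- `Q-bound`.
          l = damping t X
          0≤1-l = ≤⇒0≤- (damping≤1 t 0≤X X≤1)
          0<X : 0ℚ < X
          0<X = ≰⇒> (λ X≤0 → X≢0 (≤-antisym X≤0 0≤X))
          nonempty : ∃ λ j → N j ≡ true
          nonempty with any? (λ j → N j ≟ᵇ true)
          ... | yes found = found
          ... | no empty = ⊥-elim (X≢0 (trans (sum-cong (λ j → pointwise (U j) (x-empty empty j))) (sum-0 m)))
            where
            pointwise : ∀ c {a} → a ≡ 0ℚ → (if c then a else 0ℚ) ≡ 0ℚ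
            pointwise true a≡0 = a≡0
            pointwise false _ = refl
          regroup : ∀ l X Q → X * l - (l * l * X + (1ℚ - l) * (1ℚ - l) * Q) ≡ (1ℚ - l) * (l * X - (1ℚ - l) * Q)
          regroup = solve-∀ ℚ-ring
          swap : ∀ p x l → p * (x * l) ≡ x * (p * l)
          swap = solve-∀ ℚ-ring

  advance-dominated : ∀ E → Dominated E y → Dominated (advance E) (update N y t)
  advance-dominated E dominated U = ≤-trans (survive-damped U E dominated) (Φ-damped U)

  count-drop : ∀ (E : Expectation m) → sum (λ j → 𝔼 E (λ h → unmatched h j)) ≤
    𝔼 E (λ h → average h reward) + sum (λ j → 𝔼 (advance E) (λ h → unmatched h j))
  count-drop E = begin
    sum (λ j → E.𝔼 (λ h → unmatched h j))        ≡⟨ sym (E.𝔼-sum (λ j h → unmatched h j)) ⟩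
    E.𝔼 (λ h → sum (unmatched h))                ≤⟨ E.mono (λ h → subst (_≤ average h (λ c → reward c + sum (unmatched (c ∷ h))))
                                                      (average-const h (sum (unmatched h))) (average-mono h (λ c → unmatched-drop c h))) ⟩
    E.𝔼 (λ h → average h (λ c → reward c + sum (unmatched (c ∷ h))))
      ≡⟨ trans (E.𝔼-cong (λ h → average-+ h reward (λ c → sum (unmatched (c ∷ h)))))
           (E.additive (λ h → average h reward) (λ h → average h (λ c → sum (unmatched (c ∷ h))))) ⟩
    E.𝔼 (λ h → average h reward) + 𝔼 (advance E) (λ h → sum (unmatched h))
      ≡⟨ cong (λ t → E.𝔼 (λ h → average h reward) + t) (Expectation.𝔼-sum (advance E) (λ j h → unmatched h j)) ⟩
    E.𝔼 (λ h → average h reward) + sum (λ j → 𝔼 (advance E) (λ h → unmatched h j)) ∎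
    where
    open ≤-Reasoning
    module E = Expectation E

  size-step : ∀ {k} (G : Vec (Nbrs m) k) ts h → expBalanceSWOR (N ∷ G) (t ∷ ts) y pol h ≡
    average h reward + average h (λ c → expBalanceSWOR G ts (update N y t) pol (c ∷ h))
  size-step G ts h = trans (cong (λ z → if does (total h ≟ 0ℚ) then z else Σ (λ j → if available h j then divq (x j) (total h) * (1ℚ + rest (just j)) else 0ℚ)) (fallback (pol h)))
    (average-+ h reward rest)
    where
    rest : Maybe (Fin m) → ℚ
    rest c = expBalanceSWOR G ts (update N y t) pol (c ∷ h)
    fallback : ∀ c → maybe′ (λ j → 1ℚ + rest (just j)) (rest nothing) c ≡ reward c + rest c
    fallback (just j) = refl
    fallback nothing = sym (+-identityˡ (rest nothing))

loads : ∀ {n m} → Graph n m → Vec ℚ n → (Fin m → ℚ) → Fin m → ℚ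
loads [] [] y = y
loads (N ∷ G) (t ∷ ts) y = loads G ts (update N y t)

unmatched≤φ : ∀ {m} E {y : Fin m → ℚ} → Dominated E y → ∀ j → 𝔼 E (λ h → unmatched h j) ≤ φ (y j)
unmatched≤φ {m} E {y} dominated j = begin
  𝔼 E (λ h → unmatched h j)                  ≡⟨ Expectation.𝔼-cong E (λ h → cong 𝟙 (sym (trans (free-insert j ∅ h) (cong (_∧ not (matched h j)) (free-∅ h))))) ⟩
  𝔼 E (λ h → 𝟙 (free (insert j ∅) h))        ≤⟨ dominated (insert j ∅) ⟩
  Φ y (insert j ∅)                           ≡⟨ product-insert j ∅ (λ j → φ (y j)) refl ⟩
  product {m} (λ _ → 1ℚ) * φ (y j)           ≡⟨ trans (cong (_* φ (y j)) (product-1 m)) (*-identityˡ (φ (y j))) ⟩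
  φ (y j)                                    ∎
  where
  open ≤-Reasoning
  ∅ : Fin m → Bool
  ∅ _ = false
  free-∅ : ∀ h → free ∅ h ≡ true
  free-∅ [] = refl
  free-∅ (nothing ∷ h) = free-∅ h
  free-∅ (just _ ∷ h) = free-∅ h

-- `count-drop` telescopes over the arrivals: each expected decrease in the number of unmatched
-- vertices is paid for by expected reward, and the survivors at the end are bounded by domination
-- on singletons.
unmatched-total≤ : ∀ {n m} (G : Graph n m) ts {y : Fin m → ℚ} pol → (∀ j → 0ℚ ≤ y j) → ValidThresholds G ts y →
  ∀ E → Dominated E y →
  sum (λ j → 𝔼 E (λ h → unmatched h j)) ≤ 𝔼 E (expBalanceSWOR G ts y pol) + sum (λ j → φ (loads G ts y j))
unmatched-total≤ [] [] pol 0≤y _ E dominated = subst (_ ≤_)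
  (trans (sym (+-identityˡ _)) (cong (_+ _) (sym (Expectation.𝔼-0 E)))) (sum-mono (unmatched≤φ E dominated))
unmatched-total≤ {m = m} (N ∷ G) (t ∷ ts) {y} pol 0≤y (valid , valids) E dominated = begin
  sum (λ j → E.𝔼 (λ h → unmatched h j))
    ≤⟨ count-drop E ⟩
  E.𝔼 (λ h → average h reward) + sum (λ j → 𝔼 (advance E) (λ h → unmatched h j))
    ≤⟨ +-monoʳ-≤ (E.𝔼 (λ h → average h reward)) (unmatched-total≤ G ts pol (λ j → 0≤+ (0≤y j) (0≤x j)) valids (advance E) (advance-dominated E dominated)) ⟩
  E.𝔼 (λ h → average h reward) + (𝔼 (advance E) (expBalanceSWOR G ts (update N y t) pol) + φs)
    ≡⟨ sym (+-assoc (E.𝔼 (λ h → average h reward)) (𝔼 (advance E) (expBalanceSWOR G ts (update N y t) pol)) φs) ⟩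
  E.𝔼 (λ h → average h reward) + 𝔼 (advance E) (expBalanceSWOR G ts (update N y t) pol) + φs
    ≡⟨ cong (_+ φs) (sym (trans (E.𝔼-cong (size-step G ts)) (E.additive (λ h → average h reward) (λ h → average h (λ c → expBalanceSWOR G ts (update N y t) pol (c ∷ h)))))) ⟩
  E.𝔼 (expBalanceSWOR (N ∷ G) (t ∷ ts) y pol) + φs ∎
  where
  open ≤-Reasoning
  module E = Expectation E
  open Step N t y pol 0≤y valid
  open Kernel N x pol 0≤x x-off using (average)
  φs = sum (λ j → φ (loads G ts (update N y t) j))

-- Primal-dual analysis

-- β gives the dual variables, and ψ, with ψ′ = -β, the potential.
β ψ : ℚ → ℚ
β y = b (10ℚ * y)
ψ y = Ψ (10ℚ * y)

Γ : ℚ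
Γ = β 0ℚ

ψ0+Γ≡1 : ψ 0ℚ + Γ ≡ 1ℚ
ψ0+Γ≡1 = trans (+-comm (ψ 0ℚ) Γ) (trans (cong (λ z → b z + Ψ z) (*-zeroʳ 10ℚ)) b0+Ψ0≡1)

β-antitone : ∀ {u w} → 0ℚ ≤ u → u ≤ w → β w ≤ β u
β-antitone 0≤u u≤w = b-antitone (0≤* 0≤10ℚ 0≤u) (*-monoʳ-≤ 0≤10ℚ u≤w)

0≤β : ∀ {y} → 0ℚ ≤ y → 0ℚ ≤ β y
0≤β 0≤y = 0≤b (0≤* 0≤10ℚ 0≤y)

ψ-drop : ∀ {u w} → 0ℚ ≤ u → u ≤ w → (w - u) * β w ≤ ψ u - ψ w
ψ-drop {u} {w} 0≤u u≤w = subst (_≤ ψ u - ψ w)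
  (trans (regroup 10ℚ 1/10 u w (β w)) (trans (cong (λ k → k * ((w - u) * β w)) 1/10*10≡1) (*-identityˡ ((w - u) * β w))))
  (Ψ-drop (0≤* 0≤10ℚ 0≤u) (*-monoʳ-≤ 0≤10ℚ u≤w))
  where
  regroup : ∀ k l u w b → (k * w - k * u) * (l * b) ≡ l * k * ((w - u) * b)
  regroup = solve-∀ ℚ-ring

φ≤β+ψ : ∀ {y} → 0ℚ ≤ y → φ y ≤ β y + ψ y
φ≤β+ψ {y} 0≤y = subst₂ _≤_ (*-identityʳ (φ y))
  (trans (regroup (φ y) (τ (10ℚ * y)) (β y + ψ y)) (trans (cong (_* (β y + ψ y)) (τ*φ≡1 0≤y)) (*-identityˡ (β y + ψ y))))
  (*-monoʳ-≤ (0≤φ y) (1≤τ*[b+Ψ] (0≤* 0≤10ℚ 0≤y)))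
  where
  regroup : ∀ p t s → p * (t * s) ≡ t * p * s
  regroup = solve-∀ ℚ-ring

0≤alloc : ∀ {m} (N : Nbrs m) y t j → 0ℚ ≤ alloc N y t j
0≤alloc N y t j with N j
... | true = p≤q⊔p (t - y j) 0ℚ
... | false = ≤-refl

loads≥ : ∀ {n m} (G : Graph n m) ts y j → y j ≤ loads G ts y j
loads≥ [] [] y j = ≤-refl
loads≥ (N ∷ G) (t ∷ ts) y j = ≤-trans (by-diff (cancel (y j) (alloc N y t j)) (0≤alloc N y t j)) (loads≥ G ts (update N y t) j)
  where
  cancel : ∀ y x → y + x - y ≡ x
  cancel = solve-∀ ℚ-ring

matchingSize-suc : ∀ {n m} (M : Fin (suc n) → Maybe (Fin m)) →
  matchingSize M ≡ maybe′ (λ _ → suc (matchingSize (M ∘ suc))) (matchingSize (M ∘ suc)) (M zero)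
matchingSize-suc M = cong (λ s → maybe′ (λ _ → suc s) s (M zero))
  (foldr-tabulate (λ i acc → maybe′ (λ _ → suc acc) acc (M i)) 0 suc)

opaque
  unfolding fromℤ

  ℕtoℚ≡fromℕ : ∀ k → ℕtoℚ k ≡ fromℕ k
  ℕtoℚ≡fromℕ k = refl

-- Weak duality as an induction over arrivals. The set W contains the offline vertices that the rest
-- of M may use; removing the partner of the first online vertex ensures that each offline charge is
-- collected at most once.
dual-bound : ∀ {n m} (G : Graph n m) ts (y : Fin m → ℚ) (M : Fin n → Maybe (Fin m)) (W : Fin m → Bool) →
  (∀ j → 0ℚ ≤ y j) → ValidThresholds G ts y → IsMatching G M → (∀ i j → M i ≡ just j → W j ≡ true) →
  Γ * fromℕ (matchingSize M) + sum (λ j → ψ (loads G ts y j)) ≤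
  sum (λ j → ψ (y j)) + sum (λ j → if W j then Γ - β (loads G ts y j) else 0ℚ)
dual-bound [] [] y M W 0≤y _ _ _ = begin
  Γ * fromℕ 0 + S             ≡⟨ trans (cong (λ z → Γ * z + S) fromℤ-0) (trans (cong (_+ S) (*-zeroʳ Γ)) (+-comm 0ℚ S)) ⟩
  S + 0ℚ                      ≤⟨ +-monoʳ-≤ S (sum-nonNeg (λ j → pointwise (W j) (0≤y j))) ⟩
  S + sum (λ j → if W j then Γ - β (y j) else 0ℚ) ∎
  where
  open ≤-Reasoning
  S = sum (λ j → ψ (y j))
  pointwise : ∀ c {z} → 0ℚ ≤ z → 0ℚ ≤ (if c then Γ - β z else 0ℚ)
  pointwise true 0≤z = ≤⇒0≤- (β-antitone ≤-refl 0≤z)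
  pointwise false _ = ≤-refl
dual-bound {suc n} {m} (N ∷ G) (t ∷ ts) y M W 0≤y (valid , valids) (edges , injective) M⊆W =
  subst (λ s → Γ * fromℕ s + L ≤ S + A W) (sym (matchingSize-suc M)) (by-cases (M zero) refl)
  where
  open ≤-Reasoning
  open Step N t y (λ _ → nothing) 0≤y valid using (x; 0≤x; x-cases; sum-x)
  y′ = update N y t
  0≤y′ : ∀ j → 0ℚ ≤ y′ j
  0≤y′ j = 0≤+ (0≤y j) (0≤x j)
  S = sum (λ j → ψ (y j))
  S′ = sum (λ j → ψ (y′ j))
  L = sum (λ j → ψ (loads G ts y′ j))
  s = matchingSize (M ∘ suc)
  a : Fin m → ℚ
  a j = Γ - β (loads G ts y′ j)
  A : (Fin m → Bool) → ℚ
  A W = sum (λ j → if W j then a j else 0ℚ)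
  0≤loads : ∀ j → 0ℚ ≤ loads G ts y′ j
  0≤loads j = ≤-trans (0≤y′ j) (loads≥ G ts y′ j)
  0≤a : ∀ j → 0ℚ ≤ a j
  0≤a j = ≤⇒0≤- (β-antitone ≤-refl (0≤loads j))
  matching′ : IsMatching G (M ∘ suc)
  matching′ = (λ i → edges (suc i)) , λ i i′ j Mi Mi′ → suc-injective (injective (suc i) (suc i′) j Mi Mi′)
    where
    suc-injective : ∀ {i i′ : Fin n} → suc i ≡ suc i′ → i ≡ i′
    suc-injective refl = refl
  cancel : ∀ y x → y + x - y ≡ x
  cancel = solve-∀ ℚ-ring
  drop : ∀ j → x j * β (y′ j) ≤ ψ (y j) - ψ (y′ j)
  drop j = subst (λ d → d * β (y′ j) ≤ ψ (y j) - ψ (y′ j)) (cancel (y j) (x j)) (ψ-drop (0≤y j) (by-diff (cancel (y j) (x j)) (0≤x j)))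
  S′≤S : S′ ≤ S
  S′≤S = sum-mono (λ j → 0≤-⇒≤ (≤-trans (0≤* (0≤x j) (0≤β (0≤y′ j))) (drop j)))
  by-cases : ∀ c → M zero ≡ c → Γ * fromℕ (maybe′ (λ _ → suc s) s c) + L ≤ S + A W
  -- An arrival that M leaves single still lowers the potential, since β ≥ 0, and needs no charge.
  by-cases nothing _ = ≤-trans (dual-bound G ts y′ (M ∘ suc) W 0≤y′ valids matching′ (λ i → M⊆W (suc i))) (+-monoˡ-≤ (A W) S′≤S)
  by-cases (just k) M0 = begin
    Γ * fromℕ (suc s) + L           ≡⟨ trans (cong (λ z → Γ * z + L) (fromℕ-suc s)) (regroup₁ Γ (fromℕ s) L) ⟩
    (Γ * fromℕ s + L) + Γ           ≤⟨ +-monoˡ-≤ Γ (dual-bound G ts y′ (M ∘ suc) W′ 0≤y′ valids matching′ M⊆W′) ⟩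
    (S′ + A W′) + Γ                 ≡⟨ regroup₂ S′ (A W′) Γ (β t) ⟩
    (S′ + β t) + (A W′ + (Γ - β t)) ≤⟨ +-mono-≤ S′+βt≤S (≤-trans (+-monoʳ-≤ (A W′) βt≤) A-remove) ⟩
    S + A W                         ∎
    where
    regroup₁ : ∀ g s l → g * (1ℚ + s) + l ≡ (g * s + l) + g
    regroup₁ = solve-∀ ℚ-ring
    regroup₂ : ∀ s a g b → (s + a) + g ≡ (s + b) + (a + (g - b))
    regroup₂ = solve-∀ ℚ-ring
    Nk : N k ≡ true
    Nk = edges zero k M0
    0≤t : 0ℚ ≤ t
    0≤t = <⇒≤ (proj₁ (valid (k , Nk)))
    W′ : Fin m → Bool
    W′ j = W j ∧ not (does (k ≟ᶠ j))
    M⊆W′ : ∀ i j → M (suc i) ≡ just j → W′ j ≡ true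
    M⊆W′ i j Mi with k ≟ᶠ j | M⊆W (suc i) j Mi
    ... | yes refl | _ with () ← injective zero (suc i) j M0 Mi
    ... | no _ | Wj rewrite Wj = refl
    A-remove : A W′ + a k ≤ A W
    A-remove = begin
      A W′ + a k                                                    ≡⟨ cong (λ z → A W′ + z) (sym (sum-point k (a k))) ⟩
      A W′ + sum (λ j → if does (k ≟ᶠ j) then a k else 0ℚ)          ≡⟨ sym (sum-+ (λ j → if W′ j then a j else 0ℚ) (λ j → if does (k ≟ᶠ j) then a k else 0ℚ)) ⟩
      sum (λ j → (if W′ j then a j else 0ℚ) + (if does (k ≟ᶠ j) then a k else 0ℚ)) ≤⟨ sum-mono pointwise ⟩
      A W                                                           ∎
      where
      at : ∀ j (d : Dec (k ≡ j)) w → W j ≡ w → (if w ∧ not (does d) then a j else 0ℚ) + (if does d then a k else 0ℚ) ≤ (if w then a j else 0ℚ)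
      at j (yes refl) true _ = ≤-reflexive (+-identityˡ (a j))
      at j (yes refl) false Wj with () ← trans (sym Wj) (M⊆W zero k M0)
      at j (no _) true _ = ≤-reflexive (+-identityʳ (a j))
      at j (no _) false _ = ≤-refl
      pointwise : ∀ j → (if W′ j then a j else 0ℚ) + (if does (k ≟ᶠ j) then a k else 0ℚ) ≤ (if W j then a j else 0ℚ)
      pointwise j = at j (k ≟ᶠ j) (W j) refl
    t≤y′k : t ≤ y′ k
    t≤y′k = subst (λ c → t ≤ y k + (if c then pos (t - y k) else 0ℚ)) (sym Nk)
      (≤-trans (≤-reflexive (expand t (y k))) (+-monoʳ-≤ (y k) (p≤p⊔q (t - y k) 0ℚ)))
      where
      expand : ∀ t y → t ≡ y + (t - y)
      expand = solve-∀ ℚ-ring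
    -- Being a neighbour, k ends this arrival with load at least t, and loads never decrease; hence
    -- its final charge, together with β t, covers Γ.
    βt≤ : Γ - β t ≤ a k
    βt≤ = +-monoʳ-≤ Γ (neg-antimono-≤ (β-antitone 0≤t (≤-trans t≤y′k (loads≥ G ts y′ k))))
    -- Every vertex with positive x ends exactly at t, so its potential falls by at least x times β
    -- t; the x add up to 1.
    S′+βt≤S : S′ + β t ≤ S
    S′+βt≤S = begin
      S′ + β t                                    ≡⟨ cong (λ z → S′ + z) (sym (trans (sum-* (β t) x) (trans (cong (β t *_) (sum-x (k , Nk))) (*-identityʳ (β t))))) ⟩
      S′ + sum (λ j → β t * x j)                  ≡⟨ sym (sum-+ (λ j → ψ (y′ j)) (λ j → β t * x j)) ⟩
      sum (λ j → ψ (y′ j) + β t * x j)            ≤⟨ sum-mono term ⟩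
      S                                           ∎
      where
      move : ∀ p q b x → p - (q + b * x) ≡ p - q - x * b
      move = solve-∀ ℚ-ring
      term : ∀ j → ψ (y′ j) + β t * x j ≤ ψ (y j)
      term j = by-diff (move (ψ (y j)) (ψ (y′ j)) (β t) (x j)) (≤⇒0≤- (≤-trans (x*βt (x-cases j)) (drop j)))
        where
        x*βt : _ → x j * β t ≤ x j * β (y′ j)
        x*βt (inj₁ x≡0) = ≤-reflexive (trans (cong (_* β t) x≡0) (trans (*-zeroˡ (β t)) (sym (trans (cong (_* β (y′ j)) x≡0) (*-zeroˡ (β (y′ j)))))))
        x*βt (inj₂ y+x≡t) = ≤-reflexive (cong (λ z → x j * β z) (sym y+x≡t))

-- Initial state and conclusion

1≤φ0 : 1ℚ ≤ φ 0ℚ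
1≤φ0 = ≤-reflexive (trans (sym (τ*φ≡1 ≤-refl)) (trans (cong (_* φ 0ℚ) (trans (cong τ (*-zeroʳ 10ℚ)) τ0≡1)) (*-identityˡ (φ 0ℚ))))

start-dominated : ∀ {m} → Dominated (empty-history m) (λ _ → 0ℚ)
start-dominated {m} U = subst (_≤ Φ (λ _ → 0ℚ) U) (product-1 m) (product-mono (λ _ → 0≤1ℚ) (λ j → pointwise (U j)))
  where
  pointwise : ∀ c → 1ℚ ≤ (if c then φ 0ℚ else 1ℚ)
  pointwise true = 1≤φ0
  pointwise false = ≤-refl

mainTheorem1 : ∀ {n m : ℕ} (G : Graph n m) (ts : Vec ℚ n)
    → ValidThresholds G ts (λ _ → 0ℚ)
    → (pol : Policy m) → ValidPolicy G pol
    → (M : Fin n → Maybe (Fin m)) → IsMatching G M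
    → ((+ 513) / 1000) * ℕtoℚ (matchingSize M) ≤ expBalanceSWOR G ts (λ _ → 0ℚ) pol []
mainTheorem1 {n} {m} G ts valid pol _ M matching = begin
  + 513 / 1000 * ℕtoℚ (matchingSize M)   ≡⟨ cong (+ 513 / 1000 *_) (ℕtoℚ≡fromℕ (matchingSize M)) ⟩
  + 513 / 1000 * size                    ≤⟨ *-monoˡ-≤ (fromℕ-nonNeg (matchingSize M)) 513≤Γ ⟩
  Γ * size                               ≤⟨ 0≤-⇒≤ (subst (0ℚ ≤_) balance-sheet (0≤+ (0≤+ (≤⇒0≤- unmatched-bound) (≤⇒0≤- φ-bound)) (≤⇒0≤- matching-bound))) ⟩
  alg                                    ∎
  where
  open ≤-Reasoning
  size = fromℕ (matchingSize M)
  alg = expBalanceSWOR G ts (λ _ → 0ℚ) pol []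
  final = loads G ts (λ _ → 0ℚ)
  0≤final : ∀ j → 0ℚ ≤ final j
  0≤final = loads≥ G ts (λ _ → 0ℚ)
  513≤Γ : + 513 / 1000 ≤ Γ
  513≤Γ = subst (λ z → + 513 / 1000 ≤ b z) (sym (*-zeroʳ 10ℚ)) 513≤b0
  total φs βs ψs : ℚ
  total = sum {m} (λ _ → 1ℚ)
  φs = sum (λ j → φ (final j))
  βs = sum (λ j → β (final j))
  ψs = sum (λ j → ψ (final j))
  unmatched-bound : total ≤ alg + φs
  unmatched-bound = unmatched-total≤ G ts pol (λ _ → ≤-refl) valid (empty-history m) start-dominated
  φ-bound : φs ≤ βs + ψs
  φ-bound = ≤-trans (sum-mono (λ j → φ≤β+ψ (0≤final j))) (≤-reflexive (sum-+ (λ j → β (final j)) (λ j → ψ (final j))))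
  everything : Fin m → Bool
  everything _ = true
  -- Each offline vertex is worth exactly one unit because β(0) + ψ(0) = 1, which makes the dual
  -- budget equal to the number of offline vertices.
  constants : sum {m} (λ _ → ψ 0ℚ) + sum (λ j → Γ - β (final j)) + βs ≡ total
  constants = trans (cong (_+ βs) (sym (sum-+ {m} (λ _ → ψ 0ℚ) (λ j → Γ - β (final j)))))
    (trans (sym (sum-+ (λ j → ψ 0ℚ + (Γ - β (final j))) (λ j → β (final j))))
      (sum-cong (λ j → trans (cancel (ψ 0ℚ) Γ (β (final j))) ψ0+Γ≡1)))
    where
    cancel : ∀ p g b → p + (g - b) + b ≡ p + g
    cancel = solve-∀ ℚ-ring
  matching-bound : Γ * size + ψs + βs ≤ total
  matching-bound = subst (Γ * size + ψs + βs ≤_) constants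
    (+-monoˡ-≤ βs (dual-bound G ts (λ _ → 0ℚ) M everything (λ _ → ≤-refl) valid matching (λ _ _ _ → refl)))
  balance-sheet : (alg + φs - total) + (βs + ψs - φs) + (total - (Γ * size + ψs + βs)) ≡ alg - Γ * size
  balance-sheet = regroup alg φs total βs ψs (Γ * size)
    where
    regroup : ∀ a f t b p s → (a + f - t) + (b + p - f) + (t - (s + p + b)) ≡ a - s
    regroup = solve-∀ ℚ-ring
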